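{- Let $T$ be one of $C_2,C_3^0,C_3,C_4,C_5,C_6,C_7,C_8,C_9,C_{10},C_{12},C_2\times C_2,C_2\times C_4,C_2\times C_6,C_2\times C_8$, and let $E_T$ be the corresponding Weierstrass model with integer parameters satisfying the parameter conditions (P) below. Then the minimal discriminant of $E_T$ over $\mathbb{Q}$ is $u_T^{ -12}\gamma_T$, where $u_T$ is the positive integer given as follows: - $T=C_5,C_7,C_9,C_3^0$: $u_T=1$. - $T=C_3$: write $a=c^3d^2e$ with $c$ a positive integer and $d,e$ positive squarefree integers with $\gcd(d,e)=1$; then $u_T=c^2d$. - $T=C_4$: write $a=c^2d$ with $c$ a positive integer and $d$ a squarefree integer; then $u_T=2c$ if $v_2(a)\ge 8$ is even and $bd\equiv 3\pmod 4$, and $u_T=c$ if $v_2(a)\le 7$ or $bd\not\equiv 3\pmod 4$. - $T=C_2$: $u_T=4$ iff $v_2(b^2d-a^2)\ge 8$, $v_2(a)=v_2(b)=1$ and $a\equiv 2\pmod 8$; $u_T=2$ iff one of: (i) $v_2(b^2d-a^2)\ge 8$, $v_2(a)=v_2(b)=1$ and $a\equiv 6\pmod 8$; (ii) $4\le v_2(b^2d-a^2)\le 7$ with $v_2(a)=v_2(b)=1$; (iii) $v_2(b)\ge 3$ and $a\equiv 3\pmod 4$; and $u_T=1$ otherwise. - $T=C_6$: $u_T=2$ iff $v_2(a+b)\ge 3$, else $u_T=1$. - $T=C_8$: $u_T=2$ iff $v_2(a)=1$, else $u_T=1$. - $T=C_{10}$ and $T=C_{12}$: $u_T=2$ iff $a$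 is even, else $u_T=1$. - $T=C_2\times C_2$: $u_T=2$ iff $v_2(a)\ge 4$ and $bd\equiv 1\pmod 4$; $u_T=1$ iff $v_2(a)\le 3$ or $bd\not\equiv 1\pmod 4$. - $T=C_2\times C_4$: $u_T=4$ iff $v_2(a)=2$ and $v_2(a+4b)\ge 4$; $u_T=2$ iff $v_2(a)\ge 2$ and $v_2(a+4b)\le 3$; $u_T=1$ iff $v_2(a)\le 1$. - $T=C_2\times C_6$: $u_T=16$ iff $v_2(a+b)=1$; $u_T=4$ iff $v_2(a+b)\ge 2$; $u_T=1$ iff $v_2(a+b)=0$. - $T=C_2\times C_8$: $u_T=64$ iff $v_2(a)\ge 2$; $u_T=16$ iff $v_2(a)=1$; $u_T=1$ iff $v_2(a)=0$.
   Context: For each $T$, $E_T$ is the Weierstrass model $y^2+a_1xy+a_3y=x^3+a_2x^2+a_4x$ with coefficients (with $a_4=0$ unless stated): $T=C_2$ (parameters $a,b,d$): $a_1=a_3=0$, $a_2=2a$, $a_4=a^2-b^2d$. $T=C_3^0$ (parameter $a$): $a_1=a_2=0$, $a_3=a$, i.e. $y^2+ay=x^3$. $T=C_3$: $a_1=a$, $a_2=0$, $a_3=a^2b$. $T=C_4$: $a_1=a$, $a_2=-ab$, $a_3=-a^2b$. $T=C_5$: $a_1=a-b$, $a_2=-ab$, $a_3=-a^2b$. $T=C_6$: $a_1=a-b$, $a_2=-ab-b^2$, $a_3=-a^2b-ab^2$. $T=C_7$: $a_1=a^2+ab-b^2$, $a_2=a^2b^2-ab^3$, $a_3=a^4b^2-a^3b^3$.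 $T=C_8$: $a_1=-a^2+4ab-2b^2$, $a_2=-a^2b^2+3ab^3-2b^4$, $a_3=-a^3b^3+3a^2b^4-2ab^5$. $T=C_9$: $a_1=a^3+ab^2-b^3$, $a_2=a^4b^2-2a^3b^3+2a^2b^4-ab^5$, $a_3=a^3a_2$. $T=C_{10}$: $a_1=a^3-2a^2b-2ab^2+2b^3$, $a_2=-a^3b^3+3a^2b^4-2ab^5$, $a_3=(a^3-3a^2b+ab^2)a_2$. $T=C_{12}$: $a_1=-a^4+2a^3b+2a^2b^2-8ab^3+6b^4$, $a_2=b(a-2b)(a-b)^2(a^2-3ab+3b^2)(a^2-2ab+2b^2)$, $a_3=a(b-a)^3a_2$. $T=C_2\times C_2$ (parameters $a,b,d$): $a_1=a_3=0$, $a_2=ad+bd$, $a_4=abd^2$. $T=C_2\times C_4$: $a_1=a$, $a_2=-ab-4b^2$, $a_3=-a^2b-4ab^2$. $T=C_2\times C_6$: $a_1=-19a^2+2ab+b^2$, $a_2=-10a^4+22a^3b-14a^2b^2+2ab^3$, $a_3=90a^6-198a^5b+116a^4b^2+4a^3b^3-14a^2b^4+2ab^5$. $T=C_2\times C_8$: $a_1=-a^4-8a^3b-24a^2b^2+64b^4$, $a_2=-4ab^2(a+2b)(a+4b)^2(a^2+4ab+8b^2)$, $a_3=-2b(a+4b)(a^2-8b^2)a_2$. $\gamma_T$ denotes the discriminant of this Weierstrass model (a polynomial in the parameters). Parameter conditions (P): all parameters are integers, chosen so that $\gamma_T\neq 0$; for $T\in\{C_3,C_4,\dots,C_{12},C_2\times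 C_4,C_2\times C_6,C_2\times C_8\}$: $\gcd(a,b)=1$ and $a>0$; for $T=C_2$: $b\neq 0$, $d\neq 1$, $d$ squarefree and $\gcd(a,b)$ squarefree; for $T=C_3^0$: $a$ a positive cubefree integer; for $T=C_2\times C_2$: $\gcd(a,b)=1$, $a$ even, $d$ a positive squarefree integer. $v_p$ is the $p$-adic valuation; the minimal discriminant of a rational elliptic curve is the discriminant of a global minimal Weierstrass model. -}

module Defs where

open import Data.Nat as ℕ using (ℕ)
import Data.Nat.Divisibility as ℕD
open import Data.Nat.Primality using (Prime)
open import Data.Integer as Int using (ℤ; +_; ∣_∣)
open import Data.Integer.Divisibility using (_∣_)
open import Data.Integer.GCD using (gcd)
open import Data.Rational as Q using (ℚ)
open import Data.Product using (Σ; ∃; ∃-syntax; _×_; _,_)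
open import Data.Sum using (_⊎_)
open import Relation.Nullary using (¬_)
open import Relation.Binary.PropositionalEquality using (_≡_; _≢_)

-- Integral Weierstrass models  y² + a1 xy + a3 y = x³ + a2 x² + a4 x + a6

record WModel : Set where
  constructor wm
  field
    a1 a2 a3 a4 a6 : ℤ
open WModel public


-- Isomorphism over ℚ: E' is obtained from E by the change of variables
-- x = u² x' + r , y = u³ y' + u² s x' + t  (u ∈ ℚ*, r s t ∈ ℚ)
-- (Silverman, Table 3.1).

ι : ℤ → ℚ
ι z = z Q./ 1

module _ where
  open Q using (_+_; _*_; _-_)

  IsoQ : WModel → WModel → Set
  IsoQ E E' = Σ ℚ λ u → Σ ℚ λ r → Σ ℚ λ s → Σ ℚ λ t →
      (u ≢ Q.0ℚ)
    × (u * ι (a1 E') ≡ ι (a1 E) + ι (+ 2) * s)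
    × (u * u * ι (a2 E') ≡ ι (a2 E) - s * ι (a1 E) + ι (+ 3) * r - s * s)
    × (u * u * u * ι (a3 E') ≡ ι (a3 E) + r * ι (a1 E) + ι (+ 2) * t)
    × (u * u * u * u * ι (a4 E') ≡ ι (a4 E) - s * ι (a3 E) + ι (+ 2) * r * ι (a2 E)
                                   - (t + r * s) * ι (a1 E) + ι (+ 3) * r * r - ι (+ 2) * s * t)
    × (u * u * u * u * u * u * ι (a6 E') ≡ ι (a6 E) + r * ι (a4 E) + r * r * ι (a2 E)
                                   + r * r * r - t * ι (a3 E) - t * t - r * t * ι (a1 E))

open Int using (_+_; _*_; _-_; -_)

b2 b4 b6 b8 disc : WModel → ℤ
b2 E = a1 E * a1 E + + 4 * a2 E
b4 E = + 2 * a4 E + a1 E * a3 E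
b6 E = a3 E * a3 E + + 4 * a6 E
b8 E = a1 E * a1 E * a6 E + + 4 * a2 E * a6 E - a1 E * a3 E * a4 E
       + a2 E * a3 E * a3 E - a4 E * a4 E
disc E = - (b2 E * b2 E * b8 E) - + 8 * (b4 E * b4 E * b4 E)
         - + 27 * (b6 E * b6 E) + + 9 * b2 E * b4 E * b6 E


-- v_p(x) ≤ v_p(y), for nonzero integers x, y: every prime power dividing x divides y
ValLE : ℕ → ℤ → ℤ → Set
ValLE p x y = ∀ k → (p ℕ.^ k) ℕD.∣ ∣ x ∣ → (p ℕ.^ k) ℕD.∣ ∣ y ∣

GlobalMinimal : WModel → WModel → Set
GlobalMinimal E M = IsoQ E M ×
  (∀ (E'' : WModel) → IsoQ E E'' → ∀ p → Prime p → ValLE p (disc M) (disc E''))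

MinDisc : WModel → ℤ → Set
MinDisc E D = ∃[ M ] (GlobalMinimal E M × disc M ≡ D)

-- v₂(x) ≥ k  (with v₂(0) = ∞)
v₂≥ : ℕ → ℤ → Set
v₂≥ k x = (+ (2 ℕ.^ k)) ∣ x
v₂≤ : ℕ → ℤ → Set
v₂≤ k x = ¬ v₂≥ (ℕ.suc k) x
v₂≡ : ℕ → ℤ → Set
v₂≡ k x = v₂≥ k x × v₂≤ k x

infix 4 _≡_[mod_]
_≡_[mod_] : ℤ → ℤ → ℕ → Set
x ≡ r [mod m ] = (+ m) ∣ (x - r)

Squarefree : ℤ → Set
Squarefree x = ∀ p → Prime p → ¬ ((p ℕ.* p) ℕD.∣ ∣ x ∣)

Cubefree : ℤ → Set
Cubefree x = ∀ p → Prime p → ¬ ((p ℕ.* p ℕ.* p) ℕD.∣ ∣ x ∣)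

Coprime : ℤ → ℤ → Set
Coprime a b = gcd a b ≡ + 1

data Tors : Set where
  C2 C3⁰ C3 C4 C5 C6 C7 C8 C9 C10 C12 C2×C2 C2×C4 C2×C6 C2×C8 : Tors

Params : Tors → Set
Params C2 = ℤ × ℤ × ℤ
Params C2×C2 = ℤ × ℤ × ℤ
Params C3⁰ = ℤ
Params _ = ℤ × ℤ

m3 : ℤ → ℤ → ℤ → WModel
m3 x y z = wm x y z (+ 0) (+ 0)

ET : (T : Tors) → Params T → WModel
ET C2 (a , b , d) = wm (+ 0) (+ 2 * a) (+ 0) (a * a - b * b * d) (+ 0)
ET C3⁰ a = m3 (+ 0) (+ 0) a
ET C3 (a , b) = m3 a (+ 0) (a * a * b)
ET C4 (a , b) = m3 a (- (a * b)) (- (a * a * b))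
ET C5 (a , b) = m3 (a - b) (- (a * b)) (- (a * a * b))
ET C6 (a , b) = m3 (a - b) (- (a * b) - b * b) (- (a * a * b) - a * b * b)
ET C7 (a , b) = m3 (a * a + a * b - b * b) (a * a * b * b - a * b * b * b)
                   (a * a * a * a * b * b - a * a * a * b * b * b)
ET C8 (a , b) = m3 (- (a * a) + + 4 * a * b - + 2 * b * b)
                   (- (a * a * b * b) + + 3 * a * b * b * b - + 2 * b * b * b * b)
                   (- (a * a * a * b * b * b) + + 3 * a * a * b * b * b * b - + 2 * a * b * b * b * b * b)
ET C9 (a , b) = m3 (a * a * a + a * b * b - b * b * b) A2 (a * a * a * A2)
  where A2 = a * a * a * a * b * b - + 2 * a * a * a * b * b * b + + 2 * a * a * b * b * b * b
             - a * b * b * b * b * b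
ET C10 (a , b) = m3 (a * a * a - + 2 * a * a * b - + 2 * a * b * b + + 2 * b * b * b) A2
                    ((a * a * a - + 3 * a * a * b + a * b * b) * A2)
  where A2 = - (a * a * a * b * b * b) + + 3 * a * a * b * b * b * b - + 2 * a * b * b * b * b * b
ET C12 (a , b) = m3 (- (a * a * a * a) + + 2 * a * a * a * b + + 2 * a * a * b * b
                     - + 8 * a * b * b * b + + 6 * b * b * b * b) A2
                    (a * ((b - a) * (b - a) * (b - a)) * A2)
  where A2 = b * (a - + 2 * b) * ((a - b) * (a - b)) * (a * a - + 3 * a * b + + 3 * b * b)
             * (a * a - + 2 * a * b + + 2 * b * b)
ET C2×C2 (a , b , d) = wm (+ 0) (a * d + b * d) (+ 0) (a * b * d * d) (+ 0)
ET C2×C4 (a , b) = m3 a (- (a * b) - + 4 * b * b) (- (a * a * b) - + 4 * a * b * b)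
ET C2×C6 (a , b) = m3 (- (+ 19 * a * a) + + 2 * a * b + b * b)
                      (- (+ 10 * a * a * a * a) + + 22 * a * a * a * b - + 14 * a * a * b * b
                       + + 2 * a * b * b * b)
                      (+ 90 * a * a * a * a * a * a - + 198 * a * a * a * a * a * b
                       + + 116 * a * a * a * a * b * b + + 4 * a * a * a * b * b * b
                       - + 14 * a * a * b * b * b * b + + 2 * a * b * b * b * b * b)
ET C2×C8 (a , b) = m3 (- (a * a * a * a) - + 8 * a * a * a * b - + 24 * a * a * b * b + + 64 * b * b * b * b)
                      A2 (- (+ 2 * b * (a + + 4 * b) * (a * a - + 8 * b * b)) * A2)
  where A2 = - (+ 4 * a * b * b * (a + + 2 * b) * ((a + + 4 * b) * (a + + 4 * b))
                * (a * a + + 4 * a * b + + 8 * b * b))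

γ : (T : Tors) → Params T → ℤ
γ T p = disc (ET T p)

P : (T : Tors) → Params T → Set
P C2 (a , b , d) = (b ≢ + 0) × (d ≢ + 1) × Squarefree d × Squarefree (gcd a b)
                   × (γ C2 (a , b , d) ≢ + 0)
P C3⁰ a = (+ 0 Int.< a) × Cubefree a × (γ C3⁰ a ≢ + 0)
P C2×C2 (a , b , d) = Coprime a b × v₂≥ 1 a × (+ 0 Int.< d) × Squarefree d
                      × (γ C2×C2 (a , b , d) ≢ + 0)
P C3 (a , b) = Coprime a b × (+ 0 Int.< a) × (γ C3 (a , b) ≢ + 0)
P C4 (a , b) = Coprime a b × (+ 0 Int.< a) × (γ C4 (a , b) ≢ + 0)
P C5 (a , b) = Coprime a b × (+ 0 Int.< a) × (γ C5 (a , b) ≢ + 0)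
P C6 (a , b) = Coprime a b × (+ 0 Int.< a) × (γ C6 (a , b) ≢ + 0)
P C7 (a , b) = Coprime a b × (+ 0 Int.< a) × (γ C7 (a , b) ≢ + 0)
P C8 (a , b) = Coprime a b × (+ 0 Int.< a) × (γ C8 (a , b) ≢ + 0)
P C9 (a , b) = Coprime a b × (+ 0 Int.< a) × (γ C9 (a , b) ≢ + 0)
P C10 (a , b) = Coprime a b × (+ 0 Int.< a) × (γ C10 (a , b) ≢ + 0)
P C12 (a , b) = Coprime a b × (+ 0 Int.< a) × (γ C12 (a , b) ≢ + 0)
P C2×C4 (a , b) = Coprime a b × (+ 0 Int.< a) × (γ C2×C4 (a , b) ≢ + 0)
P C2×C6 (a , b) = Coprime a b × (+ 0 Int.< a) × (γ C2×C6 (a , b) ≢ + 0)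
P C2×C8 (a , b) = Coprime a b × (+ 0 Int.< a) × (γ C2×C8 (a , b) ≢ + 0)

-- The scaling factor: U T p u  means "u_T = u" according to the theorem.

module _ where
  C2-4 C2-2 : ℤ → ℤ → ℤ → Set
  C2-4 a b d = v₂≥ 8 (b * b * d - a * a) × v₂≡ 1 a × v₂≡ 1 b × (a ≡ + 2 [mod 8 ])
  C2-2 a b d = (v₂≥ 8 (b * b * d - a * a) × v₂≡ 1 a × v₂≡ 1 b × (a ≡ + 6 [mod 8 ]))
             ⊎ (v₂≥ 4 (b * b * d - a * a) × v₂≤ 7 (b * b * d - a * a) × v₂≡ 1 a × v₂≡ 1 b)
             ⊎ (v₂≥ 3 b × (a ≡ + 3 [mod 4 ]))

U : (T : Tors) → Params T → ℕ → Set
U C5 _ u = u ≡ 1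
U C7 _ u = u ≡ 1
U C9 _ u = u ≡ 1
U C3⁰ _ u = u ≡ 1
U C3 (a , _) u = ∀ (c d e : ℕ) → 0 ℕ.< c → Squarefree (+ d) → Squarefree (+ e)
  → Coprime (+ d) (+ e) → a ≡ + (c ℕ.^ 3 ℕ.* d ℕ.^ 2 ℕ.* e) → u ≡ c ℕ.^ 2 ℕ.* d
U C4 (a , b) u = ∀ (c : ℕ) (d : ℤ) → 0 ℕ.< c → Squarefree d → a ≡ + (c ℕ.* c) * d →
    ((∃[ k ] v₂≡ (8 ℕ.+ 2 ℕ.* k) a) × (b * d ≡ + 3 [mod 4 ]) × u ≡ 2 ℕ.* c)
  ⊎ ((v₂≤ 7 a ⊎ ¬ (b * d ≡ + 3 [mod 4 ])) × u ≡ c)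
U C2 (a , b , d) u = (C2-4 a b d × u ≡ 4) ⊎ (C2-2 a b d × u ≡ 2)
                   ⊎ (¬ C2-4 a b d × ¬ C2-2 a b d × u ≡ 1)
U C6 (a , b) u = (v₂≥ 3 (a + b) × u ≡ 2) ⊎ (¬ v₂≥ 3 (a + b) × u ≡ 1)
U C8 (a , b) u = (v₂≡ 1 a × u ≡ 2) ⊎ (¬ v₂≡ 1 a × u ≡ 1)
U C10 (a , b) u = (v₂≥ 1 a × u ≡ 2) ⊎ (¬ v₂≥ 1 a × u ≡ 1)
U C12 (a , b) u = (v₂≥ 1 a × u ≡ 2) ⊎ (¬ v₂≥ 1 a × u ≡ 1)
U C2×C2 (a , b , d) u = (v₂≥ 4 a × (b * d ≡ + 1 [mod 4 ]) × u ≡ 2)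
                      ⊎ ((v₂≤ 3 a ⊎ ¬ (b * d ≡ + 1 [mod 4 ])) × u ≡ 1)
U C2×C4 (a , b) u = (v₂≡ 2 a × v₂≥ 4 (a + + 4 * b) × u ≡ 4)
                  ⊎ (v₂≥ 2 a × v₂≤ 3 (a + + 4 * b) × u ≡ 2)
                  ⊎ (v₂≤ 1 a × u ≡ 1)
U C2×C6 (a , b) u = (v₂≡ 1 (a + b) × u ≡ 16) ⊎ (v₂≥ 2 (a + b) × u ≡ 4)
                  ⊎ (v₂≡ 0 (a + b) × u ≡ 1)
U C2×C8 (a , b) u = (v₂≥ 2 a × u ≡ 64) ⊎ (v₂≡ 1 a × u ≡ 16) ⊎ (v₂≡ 0 a × u ≡ 1)

{-# OPTIONS --safe #-}
-- Any integral model isomorphic to M over ℚ arises from M by a scaling factor m / n in lowest terms, and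
-- then m⁴ c₄′ = n⁴ c₄, m⁶ c₆′ = n⁶ c₆, m¹² Δ′ = n¹² Δ. So M is minimal unless some prime p satisfies p⁴ ∣ c₄,
-- p⁶ ∣ c₆ and p¹² ∣ Δ and, if p = 2, the quotients of c₄ and c₆ satisfy Kraus's conditions. For each family
-- an explicit change of variables divides E_T by u_T, and these divisibilities are refuted for the result.
-- In a family homogeneous in coprime a and b, a prime dividing c₄ and Δ divides c₄ and one of the factors
-- of Δ, hence the resultant of the two, which leaves finitely many primes; those are excluded by
-- a₁ being odd, by the valuation of Δ, or by computing with residues. The families whose parameters
-- are restricted by squarefreeness are treated by comparing valuations of the parameters.
module Submission where

open import Defs
open import Algebra.Bundles using (CommutativeRing)
open import Algebra.Structures using (IsCommutativeRing)
open import Data.Bool using (Bool; true; false; T; not; _∧_; _∨_; if_then_else_)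
open import Data.Bool.Properties using (T-∧)
open import Data.Empty using (⊥; ⊥-elim)
open import Data.Fin using (Fin; zero; suc)
open import Data.Fin.Patterns using (0F; 1F; 2F; 3F; 4F; 5F; 6F; 7F; 8F; 9F)
open import Data.Integer using (ℤ; +_; _+_; _*_; _-_; -_; _^_; +<+) renaming (∣_∣ to abs)
import Data.Integer.Base as ℤ
import Data.Integer.DivMod as ℤ
open import Data.Integer.Divisibility.Signed
import Data.Integer.GCD as ℤ
import Data.Integer.Properties as ℤ
open import Data.List using (List; []; _∷_; reverse; length)
open import Data.List.Relation.Unary.All using (All; []; _∷_; all?)
open import Data.Nat as ℕ using (ℕ; zero; suc; NonZero)
import Data.Nat.Coprimality as Coprimality
import Data.Nat.Divisibility as ℕ
import Data.Nat.GCD as ℕ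
import Data.Nat.ListAction as ℕ
open import Data.Nat.Primality
  using (Prime; euclidsLemma; prime⇒nonZero; prime⇒nonTrivial; prime⇒irreducible; prime?)
open import Data.Nat.Primality.Factorisation using (factorise)
import Data.Nat.Properties as ℕ
open import Data.Nat.Solver using () renaming (module +-*-Solver to ℕ*)
open import Data.Product using (Σ; ∃-syntax; _×_; _,_; proj₁; proj₂)
import Data.Rational as ℚ
import Data.Rational.Properties as ℚ
import Data.Rational.Unnormalised as ℚᵘ
import Data.Rational.Unnormalised.Properties as ℚᵘ
open import Data.Sum using (_⊎_; inj₁; inj₂; [_,_]′)
open import Data.Unit using (tt)
open import Data.Vec as Vec using (Vec; []; _∷_; lookup; tabulate)
open import Data.Vec.N-ary using (N-ary; _$ⁿ_; curryⁿ; ∀ⁿ)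
import Data.Vec.Properties as Vec
open import Function using (it; _∘_; Equivalence)
open import Relation.Binary.PropositionalEquality
open import Relation.Nullary using (¬_; yes; no; Dec; does)
open import Relation.Nullary.Decidable using (⌊_⌋; toWitness; True)

-- Reflection for polynomial identities

-- Only the necessary direction of Kraus's criterion is used: every integral model obeys congruences
-- on c₄ and c₆, so a model smaller than M would leave a trace on the invariants of M, and that
-- trace is refuted. The translations r, s, t of a rational change of variables have uncontrolled
-- denominators; c₄ and c₆ do not see them, and Δ is recovered from c₄³ - c₆² = 1728 Δ. The size of
-- the polynomials shapes the rest. Discriminants reach degree 48 in a and b, so identities are
-- verified by evaluating normal forms during type checking, quotients come from an unverified long
-- division and are multiplied back, and what remains at a fixed prime becomes a search over
-- residues whose modulus has to stay small. A hypothesis such as v₂(a) = 1 is turned into a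
-- substitution like a = 4 j + 2 b with b odd. Divisibility of the coefficients by powers of 2 can
-- then be read off coefficient by coefficient. In most families the change of variables is a pure
-- scaling; only C₂, C₄ and C₂ × C₂ require a shift, with s chosen so that the new a₁ becomes odd.

infixl 6 _⊕_ _⊖_
infixl 7 _⊗_
infix  8 ⊝_

data Expr (n : ℕ) : Set where
  var         : Fin n → Expr n
  con         : ℤ → Expr n
  _⊕_ _⊗_ _⊖_ : Expr n → Expr n → Expr n
  ⊝_          : Expr n → Expr n

-- A polynomial in suc n variables is the list of its coefficients, constant term first, as a
-- polynomial in variable 0; trailing zeros are allowed.
Poly : ℕ → Set
Poly zero    = ℤ
Poly (suc n) = List (Poly n)

isZero : ∀ n → Poly n → Bool
isZero zero    (+ 0) = true
isZero zero    _     = false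
isZero (suc n) []    = true
isZero (suc n) (c ∷ p) = isZero n c ∧ isZero (suc n) p

constant : ∀ n → ℤ → Poly n
constant zero    c = c
constant (suc n) c = constant n c ∷ []

variable′ : ∀ n → Fin n → Poly n
variable′ (suc n) zero    = constant n (+ 0) ∷ constant n (+ 1) ∷ []
variable′ (suc n) (suc i) = variable′ n i ∷ []

add : ∀ n → Poly n → Poly n → Poly n
add zero    c d = c + d
add (suc n) []      q       = q
add (suc n) (c ∷ p) []      = c ∷ p
add (suc n) (c ∷ p) (d ∷ q) = add n c d ∷ add (suc n) p q

neg : ∀ n → Poly n → Poly n
neg zero    c       = - c
neg (suc n) []      = []
neg (suc n) (c ∷ p) = neg n c ∷ neg (suc n) p

-- In this dense representation powers of a variable consist mostly of zero coefficients. Skipping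
-- them keeps products affordable when the type checker evaluates them.
mul : ∀ n → Poly n → Poly n → Poly n
scale : ∀ n → Poly n → Poly (suc n) → Poly (suc n)
shift : ∀ n → Poly (suc n) → Poly (suc n)

mul zero    c d = c * d
mul (suc n) []      q = []
mul (suc n) (c ∷ p) q =
  if isZero n c then shift n (mul (suc n) p q)
                else add (suc n) (scale n c q) (shift n (mul (suc n) p q))

scale n c []      = []
scale n c (d ∷ q) = mul n c d ∷ scale n c q

shift n []      = []
shift n (c ∷ p) = constant n (+ 0) ∷ c ∷ p

norm : ∀ {n} → Expr n → Poly n
norm {n} (var i) = variable′ n i
norm {n} (con c) = constant n c
norm {n} (d ⊕ e) = add n (norm d) (norm e)
norm {n} (d ⊗ e) = mul n (norm d) (norm e)
norm {n} (d ⊖ e) = add n (norm d) (neg n (norm e))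
norm {n} (⊝ e)   = neg n (norm e)

-- Symbolic Weierstrass models and their invariants.

record Model (n : ℕ) : Set where
  constructor model
  field
    α1 α2 α3 α4 α6 : Expr n


module _ {n : ℕ} where
  infix 9 #_
  #_ : ℕ → Expr n
  # k = con (+ k)

  infixr 8 _↑_
  _↑_ : Expr n → ℕ → Expr n
  e ↑ zero  = # 1
  e ↑ suc k = e ⊗ e ↑ k

  β2 β4 β6 β8 γ4 γ6 δ : Model n → Expr n
  β2 (model a1 a2 a3 a4 a6) = a1 ⊗ a1 ⊕ # 4 ⊗ a2
  β4 (model a1 a2 a3 a4 a6) = # 2 ⊗ a4 ⊕ a1 ⊗ a3
  β6 (model a1 a2 a3 a4 a6) = a3 ⊗ a3 ⊕ # 4 ⊗ a6
  β8 (model a1 a2 a3 a4 a6) = a1 ⊗ a1 ⊗ a6 ⊕ # 4 ⊗ a2 ⊗ a6 ⊖ a1 ⊗ a3 ⊗ a4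
    ⊕ a2 ⊗ a3 ⊗ a3 ⊖ a4 ⊗ a4
  γ4 M = β2 M ⊗ β2 M ⊖ # 24 ⊗ β4 M
  γ6 M = ⊝ (β2 M ⊗ β2 M ⊗ β2 M) ⊕ # 36 ⊗ β2 M ⊗ β4 M ⊖ # 216 ⊗ β6 M
  δ M = ⊝ (β2 M ⊗ β2 M ⊗ β8 M) ⊖ # 8 ⊗ (β4 M ⊗ β4 M ⊗ β4 M)
    ⊖ # 27 ⊗ (β6 M ⊗ β6 M) ⊕ # 9 ⊗ β2 M ⊗ β4 M ⊗ β6 M

general : ∀ {n} → Model (5 ℕ.+ n)
general = model (var 0F) (var 1F) (var 2F) (var 3F) (var 4F)

infix 4 _:=_
_:=_ : ∀ {n} → Expr n → Expr n → Expr n × Expr n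
_:=_ = _,_

-- Normal forms have integer coefficients, and the ring R enters only when they are evaluated
-- through φ. The same normalisation therefore serves identities over ℤ and over ℚ.
module Reflection
  {R : Set} {_+ᴿ_ _*ᴿ_ : R → R → R} { -ᴿ_ : R → R} {0ᴿ 1ᴿ : R}
  (isCommutativeRing : IsCommutativeRing _≡_ _+ᴿ_ _*ᴿ_ -ᴿ_ 0ᴿ 1ᴿ)
  (φ : ℤ → R)
  (φ-0 : φ (+ 0) ≡ 0ᴿ) (φ-1 : φ (+ 1) ≡ 1ᴿ)
  (φ-+ : ∀ x y → φ (x + y) ≡ φ x +ᴿ φ y)
  (φ-* : ∀ x y → φ (x * y) ≡ φ x *ᴿ φ y)
  (φ-neg : ∀ x → φ (- x) ≡ -ᴿ φ x)
  where

  private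
    ring : CommutativeRing _ _
    ring = record { isCommutativeRing = isCommutativeRing }
    open CommutativeRing ring
      using (+-assoc; +-comm; +-identityˡ; +-identityʳ; -‿inverseˡ; -‿inverseʳ; *-assoc; *-comm;
             *-identityʳ; zeroˡ; zeroʳ; distribˡ; distribʳ; +-commutativeMonoid; *-commutativeMonoid)
      renaming (ring to ringᴿ)
    open import Algebra.Bundles using (module CommutativeMonoid)
    open import Algebra.Properties.CommutativeSemigroup
      (CommutativeMonoid.commutativeSemigroup +-commutativeMonoid) using (interchange)
    open import Algebra.Properties.CommutativeSemigroup
      (CommutativeMonoid.commutativeSemigroup *-commutativeMonoid) using (x∙yz≈y∙xz)
    open import Algebra.Properties.Ring ringᴿ using (-‿distribʳ-*; -0#≈0#; -‿+-comm)

  ⟦_⟧ : ∀ {n} → Expr n → Vec R n → R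
  ⟦ var i ⟧ ρ = lookup ρ i
  ⟦ con c ⟧ ρ = φ c
  ⟦ d ⊕ e ⟧ ρ = ⟦ d ⟧ ρ +ᴿ ⟦ e ⟧ ρ
  ⟦ d ⊗ e ⟧ ρ = ⟦ d ⟧ ρ *ᴿ ⟦ e ⟧ ρ
  ⟦ d ⊖ e ⟧ ρ = ⟦ d ⟧ ρ +ᴿ (-ᴿ ⟦ e ⟧ ρ)
  ⟦ ⊝ e ⟧ ρ   = -ᴿ ⟦ e ⟧ ρ

  eval : ∀ n → Poly n → Vec R n → R
  eval zero    c       []      = φ c
  eval (suc n) []      (x ∷ ρ) = 0ᴿ
  eval (suc n) (c ∷ p) (x ∷ ρ) = eval n c ρ +ᴿ (x *ᴿ eval (suc n) p (x ∷ ρ))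

  eval-zero : ∀ n p ρ → T (isZero n p) → eval n p ρ ≡ 0ᴿ
  eval-zero zero (+ 0) [] _ = φ-0
  eval-zero (suc n) [] (x ∷ ρ) _ = refl
  eval-zero (suc n) (c ∷ p) (x ∷ ρ) z with Equivalence.to (T-∧ {isZero n c}) z
  ... | zc , zp rewrite eval-zero n c ρ zc | eval-zero (suc n) p (x ∷ ρ) zp =
    trans (+-identityˡ _) (zeroʳ x)

  eval-constant : ∀ n c ρ → eval n (constant n c) ρ ≡ φ c
  eval-constant zero c [] = refl
  eval-constant (suc n) c (x ∷ ρ) rewrite eval-constant n c ρ =
    trans (cong (φ c +ᴿ_) (zeroʳ x)) (+-identityʳ _)

  eval-variable : ∀ n i ρ → eval n (variable′ n i) ρ ≡ lookup ρ i
  eval-variable (suc n) zero (x ∷ ρ) = trans (cong₂ _+ᴿ_ (trans (eval-constant n (+ 0) ρ) φ-0)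
    (cong (x *ᴿ_) (trans (cong₂ _+ᴿ_ (trans (eval-constant n (+ 1) ρ) φ-1) (zeroʳ x)) (+-identityʳ 1ᴿ))))
    (trans (+-identityˡ _) (*-identityʳ x))
  eval-variable (suc n) (suc i) (x ∷ ρ) rewrite eval-variable n i ρ | zeroʳ x = +-identityʳ _

  eval-add : ∀ n p q ρ → eval n (add n p q) ρ ≡ eval n p ρ +ᴿ eval n q ρ
  eval-add zero c d [] = φ-+ c d
  eval-add (suc n) [] q (x ∷ ρ) = sym (+-identityˡ _)
  eval-add (suc n) (c ∷ p) [] (x ∷ ρ) = sym (+-identityʳ _)
  eval-add (suc n) (c ∷ p) (d ∷ q) (x ∷ ρ)
    rewrite eval-add n c d ρ | eval-add (suc n) p q (x ∷ ρ)
          | distribˡ x (eval (suc n) p (x ∷ ρ)) (eval (suc n) q (x ∷ ρ)) = interchange _ _ _ _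

  eval-neg : ∀ n p ρ → eval n (neg n p) ρ ≡ -ᴿ eval n p ρ
  eval-neg zero c [] = φ-neg c
  eval-neg (suc n) [] (x ∷ ρ) = sym -0#≈0#
  eval-neg (suc n) (c ∷ p) (x ∷ ρ) rewrite eval-neg n c ρ | eval-neg (suc n) p (x ∷ ρ) =
    trans (cong ((-ᴿ eval n c ρ) +ᴿ_) (sym (-‿distribʳ-* x _))) (-‿+-comm _ _)

  eval-shift : ∀ n p x ρ → eval (suc n) (shift n p) (x ∷ ρ) ≡ x *ᴿ eval (suc n) p (x ∷ ρ)
  eval-shift n [] x ρ = sym (zeroʳ x)
  eval-shift n (c ∷ p) x ρ =
    trans (cong (_+ᴿ (x *ᴿ eval (suc n) (c ∷ p) (x ∷ ρ))) (trans (eval-constant n (+ 0) ρ) φ-0))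
      (+-identityˡ _)

  eval-mul : ∀ n p q ρ → eval n (mul n p q) ρ ≡ eval n p ρ *ᴿ eval n q ρ
  eval-scale : ∀ n c q x ρ → eval (suc n) (scale n c q) (x ∷ ρ) ≡ eval n c ρ *ᴿ eval (suc n) q (x ∷ ρ)

  eval-mul zero c d [] = φ-* c d
  eval-mul (suc n) [] q (x ∷ ρ) = sym (zeroˡ _)
  eval-mul (suc n) (c ∷ p) q (x ∷ ρ) with isZero n c in eq
  ... | true rewrite eval-shift n (mul (suc n) p q) x ρ | eval-mul (suc n) p q (x ∷ ρ)
                   | eval-zero n c ρ (subst T (sym eq) tt)
                   | +-identityˡ (x *ᴿ eval (suc n) p (x ∷ ρ)) = sym (*-assoc _ _ _)
  ... | false rewrite eval-add (suc n) (scale n c q) (shift n (mul (suc n) p q)) (x ∷ ρ)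
                    | eval-shift n (mul (suc n) p q) x ρ | eval-mul (suc n) p q (x ∷ ρ)
                    | eval-scale n c q x ρ =
    trans (cong ((eval n c ρ *ᴿ eval (suc n) q (x ∷ ρ)) +ᴿ_) (sym (*-assoc _ _ _))) (sym (distribʳ _ _ _))

  eval-scale n c [] x ρ = sym (zeroʳ _)
  eval-scale n c (d ∷ q) x ρ rewrite eval-mul n c d ρ | eval-scale n c q x ρ =
    trans (cong ((eval n c ρ *ᴿ eval n d ρ) +ᴿ_) (x∙yz≈y∙xz _ _ _)) (sym (distribˡ _ _ _))

  eval-norm : ∀ {n} (e : Expr n) ρ → eval n (norm e) ρ ≡ ⟦ e ⟧ ρ
  eval-norm (var i) ρ = eval-variable _ i ρ
  eval-norm (con c) ρ = eval-constant _ c ρ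
  eval-norm (d ⊕ e) ρ rewrite eval-add _ (norm d) (norm e) ρ | eval-norm d ρ | eval-norm e ρ = refl
  eval-norm (d ⊗ e) ρ rewrite eval-mul _ (norm d) (norm e) ρ | eval-norm d ρ | eval-norm e ρ = refl
  eval-norm (d ⊖ e) ρ rewrite eval-add _ (norm d) (neg _ (norm e)) ρ | eval-neg _ (norm e) ρ
                            | eval-norm d ρ | eval-norm e ρ = refl
  eval-norm (⊝ e) ρ rewrite eval-neg _ (norm e) ρ | eval-norm e ρ = refl

  prove : ∀ {n} (d e : Expr n) {_ : T (isZero n (norm (d ⊖ e)))} → ∀ ρ → ⟦ d ⟧ ρ ≡ ⟦ e ⟧ ρ
  prove {n} d e {z} ρ = begin
    ⟦ d ⟧ ρ                                  ≡⟨ +-identityʳ _ ⟨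
    ⟦ d ⟧ ρ +ᴿ 0ᴿ                            ≡⟨ cong (⟦ d ⟧ ρ +ᴿ_) (-‿inverseˡ _) ⟨
    ⟦ d ⟧ ρ +ᴿ ((-ᴿ ⟦ e ⟧ ρ) +ᴿ ⟦ e ⟧ ρ)     ≡⟨ +-assoc _ _ _ ⟨
    ⟦ d ⊖ e ⟧ ρ +ᴿ ⟦ e ⟧ ρ                   ≡⟨ cong (_+ᴿ ⟦ e ⟧ ρ) (eval-norm (d ⊖ e) ρ) ⟨
    eval n (norm (d ⊖ e)) ρ +ᴿ ⟦ e ⟧ ρ       ≡⟨ cong (_+ᴿ ⟦ e ⟧ ρ) (eval-zero n (norm (d ⊖ e)) ρ z) ⟩
    0ᴿ +ᴿ ⟦ e ⟧ ρ                            ≡⟨ +-identityˡ _ ⟩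
    ⟦ e ⟧ ρ                                  ∎
    where open ≡-Reasoning

  private
    curry∀ : ∀ n {P : Vec R n → Set} → (∀ ρ → P ρ) → ∀ⁿ n (curryⁿ P)
    curry∀ zero    p = p []
    curry∀ (suc n) p = λ x → curry∀ n (λ ρ → p (x ∷ ρ))

  close : ∀ {A : Set} n → N-ary n (Expr n) A → A
  close n f = f $ⁿ tabulate var

  solve : ∀ n (f : N-ary n (Expr n) (Expr n × Expr n)) →
    let d , e = close n f in
    {_ : T (isZero n (norm (d ⊖ e)))} → ∀ⁿ n (curryⁿ (λ ρ → ⟦ d ⟧ ρ ≡ ⟦ e ⟧ ρ))
  solve n f {z} = curry∀ n (prove (proj₁ (close n f)) (proj₂ (close n f)) {z})

  -- Transformation laws of the invariants.

  module _ {u r s t a1 a2 a3 a4 a6 a1′ a2′ a3′ a4′ a6′ : R}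
    (eq1 : u *ᴿ a1′ ≡ a1 +ᴿ (φ (+ 2) *ᴿ s))
    (eq2 : (u *ᴿ u) *ᴿ a2′ ≡ ((a2 +ᴿ (-ᴿ (s *ᴿ a1))) +ᴿ (φ (+ 3) *ᴿ r)) +ᴿ (-ᴿ (s *ᴿ s)))
    (eq3 : ((u *ᴿ u) *ᴿ u) *ᴿ a3′ ≡ (a3 +ᴿ (r *ᴿ a1)) +ᴿ (φ (+ 2) *ᴿ t))
    (eq4 : (((u *ᴿ u) *ᴿ u) *ᴿ u) *ᴿ a4′ ≡
      ((((a4 +ᴿ (-ᴿ (s *ᴿ a3))) +ᴿ ((φ (+ 2) *ᴿ r) *ᴿ a2)) +ᴿ (-ᴿ ((t +ᴿ (r *ᴿ s)) *ᴿ a1)))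
        +ᴿ ((φ (+ 3) *ᴿ r) *ᴿ r)) +ᴿ (-ᴿ ((φ (+ 2) *ᴿ s) *ᴿ t)))
    (eq6 : (((((u *ᴿ u) *ᴿ u) *ᴿ u) *ᴿ u) *ᴿ u) *ᴿ a6′ ≡
      (((((a6 +ᴿ (r *ᴿ a4)) +ᴿ ((r *ᴿ r) *ᴿ a2)) +ᴿ ((r *ᴿ r) *ᴿ r)) +ᴿ (-ᴿ (t *ᴿ a3)))
        +ᴿ (-ᴿ (t *ᴿ t))) +ᴿ (-ᴿ ((r *ᴿ t) *ᴿ a1)))
    where

    private
      x x′ : Vec R 5
      x  = a1 ∷ a2 ∷ a3 ∷ a4 ∷ a6 ∷ []
      x′ = a1′ ∷ a2′ ∷ a3′ ∷ a4′ ∷ a6′ ∷ []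

      transformed : Model 8
      transformed =
        let a1 = var 0F ; a2 = var 1F ; a3 = var 2F ; a4 = var 3F ; a6 = var 4F
            r = var 5F ; s = var 6F ; t = var 7F
        in model (a1 ⊕ # 2 ⊗ s) (a2 ⊖ s ⊗ a1 ⊕ # 3 ⊗ r ⊖ s ⊗ s) (a3 ⊕ r ⊗ a1 ⊕ # 2 ⊗ t)
             (a4 ⊖ s ⊗ a3 ⊕ # 2 ⊗ r ⊗ a2 ⊖ (t ⊕ r ⊗ s) ⊗ a1 ⊕ # 3 ⊗ r ⊗ r ⊖ # 2 ⊗ s ⊗ t)
             (a6 ⊕ r ⊗ a4 ⊕ r ⊗ r ⊗ a2 ⊕ r ⊗ r ⊗ r ⊖ t ⊗ a3 ⊖ t ⊗ t ⊖ r ⊗ t ⊗ a1)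

      scaled : Model 6
      scaled = let u = var 5F in
        model (u ⊗ var 0F) (u ⊗ u ⊗ var 1F) (u ⊗ u ⊗ u ⊗ var 2F) (u ⊗ u ⊗ u ⊗ u ⊗ var 3F)
              (u ⊗ u ⊗ u ⊗ u ⊗ u ⊗ u ⊗ var 4F)

      y : Vec R 8
      y = a1 ∷ a2 ∷ a3 ∷ a4 ∷ a6 ∷ r ∷ s ∷ t ∷ []
      y′ : Vec R 6
      y′ = a1′ ∷ a2′ ∷ a3′ ∷ a4′ ∷ a6′ ∷ u ∷ []

      u₆ : Expr 6
      u₆ = var 5F
      r₈ : Expr 8
      r₈ = var 5F

      B2 B4 B6 B2′ B4′ B6′ : R
      B2 = ⟦ β2 general ⟧ x
      B4 = ⟦ β4 general ⟧ x
      B6 = ⟦ β6 general ⟧ x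
      B2′ = ⟦ β2 general ⟧ x′
      B4′ = ⟦ β4 general ⟧ x′
      B6′ = ⟦ β6 general ⟧ x′

      β-cong : (β : Model 5 → Expr 5) → ∀ {p1 q1 p2 q2 p3 q3 p4 q4 p6 q6} →
        p1 ≡ q1 → p2 ≡ q2 → p3 ≡ q3 → p4 ≡ q4 → p6 ≡ q6 →
        ⟦ β general ⟧ (p1 ∷ p2 ∷ p3 ∷ p4 ∷ p6 ∷ []) ≡ ⟦ β general ⟧ (q1 ∷ q2 ∷ q3 ∷ q4 ∷ q6 ∷ [])
      β-cong β e1 e2 e3 e4 e6 =
        cong₂ (λ v w → ⟦ β general ⟧ (v ∷ w)) e1
          (cong₂ _∷_ e2 (cong₂ _∷_ e3 (cong₂ _∷_ e4 (cong (_∷ []) e6))))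

      -- The b-invariants depend on u and r alone, so s and t disappear at this stage. The
      -- hypotheses are substituted for whole scaled coefficients, which leaves two identities in
      -- few variables.
      b2-transform : (u *ᴿ u) *ᴿ B2′ ≡ B2 +ᴿ (φ (+ 12) *ᴿ r)
      b2-transform =
        trans (prove (u₆ ⊗ u₆ ⊗ β2 general) (β2 scaled) y′)
          (trans (β-cong β2 eq1 eq2 eq3 eq4 eq6)
            (prove (β2 transformed) (β2 general ⊕ # 12 ⊗ r₈) y))

      b4-transform : (((u *ᴿ u) *ᴿ u) *ᴿ u) *ᴿ B4′ ≡ (B4 +ᴿ (r *ᴿ B2)) +ᴿ ((φ (+ 6) *ᴿ r) *ᴿ r)
      b4-transform =
        trans (prove (u₆ ⊗ u₆ ⊗ u₆ ⊗ u₆ ⊗ β4 general) (β4 scaled) y′)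
          (trans (β-cong β4 eq1 eq2 eq3 eq4 eq6)
            (prove (β4 transformed) (β4 general ⊕ r₈ ⊗ β2 general ⊕ # 6 ⊗ r₈ ⊗ r₈) y))

      b6-transform : (((((u *ᴿ u) *ᴿ u) *ᴿ u) *ᴿ u) *ᴿ u) *ᴿ B6′ ≡
        ((B6 +ᴿ ((φ (+ 2) *ᴿ r) *ᴿ B4)) +ᴿ ((r *ᴿ r) *ᴿ B2)) +ᴿ (((φ (+ 4) *ᴿ r) *ᴿ r) *ᴿ r)
      b6-transform =
        trans (prove (u₆ ⊗ u₆ ⊗ u₆ ⊗ u₆ ⊗ u₆ ⊗ u₆ ⊗ β6 general) (β6 scaled) y′)
          (trans (β-cong β6 eq1 eq2 eq3 eq4 eq6)
            (prove (β6 transformed)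
              (β6 general ⊕ # 2 ⊗ r₈ ⊗ β4 general ⊕ r₈ ⊗ r₈ ⊗ β2 general ⊕ # 4 ⊗ r₈ ⊗ r₈ ⊗ r₈) y))

    -- After substituting the laws for b₂ and b₄ into b₂² - 24 b₄, all terms in r cancel. Working
    -- with the b's instead of the a's leaves identities in three variables.
    c4-transform : (((u *ᴿ u) *ᴿ u) *ᴿ u) *ᴿ ⟦ γ4 general ⟧ x′ ≡ ⟦ γ4 general ⟧ x
    c4-transform =
      trans (solve 3 (λ u b2 b4 → u ⊗ u ⊗ u ⊗ u ⊗ (b2 ⊗ b2 ⊖ # 24 ⊗ b4)
              := (u ⊗ u ⊗ b2) ⊗ (u ⊗ u ⊗ b2) ⊖ # 24 ⊗ (u ⊗ u ⊗ u ⊗ u ⊗ b4)) u B2′ B4′)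
        (trans (cong₂ (λ p q → (p *ᴿ p) +ᴿ (-ᴿ (φ (+ 24) *ᴿ q))) b2-transform b4-transform)
          (solve 3 (λ r b2 b4 → (b2 ⊕ # 12 ⊗ r) ⊗ (b2 ⊕ # 12 ⊗ r)
              ⊖ # 24 ⊗ (b4 ⊕ r ⊗ b2 ⊕ # 6 ⊗ r ⊗ r) := b2 ⊗ b2 ⊖ # 24 ⊗ b4) r B2 B4))

    c6-transform : (((((u *ᴿ u) *ᴿ u) *ᴿ u) *ᴿ u) *ᴿ u) *ᴿ ⟦ γ6 general ⟧ x′ ≡ ⟦ γ6 general ⟧ x
    c6-transform =
      trans (solve 4 (λ u b2 b4 b6 →
              u ⊗ u ⊗ u ⊗ u ⊗ u ⊗ u ⊗ (⊝ (b2 ⊗ b2 ⊗ b2) ⊕ # 36 ⊗ b2 ⊗ b4 ⊖ # 216 ⊗ b6)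
              := c6-form (u ⊗ u ⊗ b2) (u ⊗ u ⊗ u ⊗ u ⊗ b4) (u ⊗ u ⊗ u ⊗ u ⊗ u ⊗ u ⊗ b6)) u B2′ B4′ B6′)
        (trans (cong₂ (λ p (q , q′) → ((-ᴿ ((p *ᴿ p) *ᴿ p)) +ᴿ ((φ (+ 36) *ᴿ p) *ᴿ q)) +ᴿ (-ᴿ (φ (+ 216) *ᴿ q′)))
                 b2-transform (cong₂ _,_ b4-transform b6-transform))
          (solve 4 (λ r b2 b4 b6 →
              c6-form (b2 ⊕ # 12 ⊗ r) (b4 ⊕ r ⊗ b2 ⊕ # 6 ⊗ r ⊗ r)
                      (b6 ⊕ # 2 ⊗ r ⊗ b4 ⊕ r ⊗ r ⊗ b2 ⊕ # 4 ⊗ r ⊗ r ⊗ r)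
              := c6-form b2 b4 b6) r B2 B4 B6))
      where
      c6-form : ∀ {n} → Expr n → Expr n → Expr n → Expr n
      c6-form b2 b4 b6 = ⊝ (b2 ⊗ b2 ⊗ b2) ⊕ # 36 ⊗ b2 ⊗ b4 ⊖ # 216 ⊗ b6

  -- With b₈ as an independent variable, c₄³ - c₆² = 1728 Δ fails by a multiple of 4 b₈ - (b₂ b₆ -
  -- b₄²). Recording this multiple avoids expanding the identity in the coefficients of the model.
  c4³-c6²-syzygy : ∀ b2 b4 b6 b8 →
    let c4 = (b2 *ᴿ b2) +ᴿ (-ᴿ (φ (+ 24) *ᴿ b4))
        c6 = ((-ᴿ ((b2 *ᴿ b2) *ᴿ b2)) +ᴿ ((φ (+ 36) *ᴿ b2) *ᴿ b4)) +ᴿ (-ᴿ (φ (+ 216) *ᴿ b6))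
        Δ  = (((-ᴿ ((b2 *ᴿ b2) *ᴿ b8)) +ᴿ (-ᴿ (φ (+ 8) *ᴿ ((b4 *ᴿ b4) *ᴿ b4))))
              +ᴿ (-ᴿ (φ (+ 27) *ᴿ (b6 *ᴿ b6)))) +ᴿ (((φ (+ 9) *ᴿ b2) *ᴿ b4) *ᴿ b6)
    in ((c4 *ᴿ c4) *ᴿ c4) +ᴿ (-ᴿ (c6 *ᴿ c6)) ≡ (φ (+ 1728) *ᴿ Δ)
      +ᴿ (((φ (+ 432) *ᴿ b2) *ᴿ b2) *ᴿ ((φ (+ 4) *ᴿ b8) +ᴿ (-ᴿ ((b2 *ᴿ b6) +ᴿ (-ᴿ (b4 *ᴿ b4))))))
  c4³-c6²-syzygy = solve 4 λ b2 b4 b6 b8 →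
    let c4 = b2 ⊗ b2 ⊖ # 24 ⊗ b4
        c6 = ⊝ (b2 ⊗ b2 ⊗ b2) ⊕ # 36 ⊗ b2 ⊗ b4 ⊖ # 216 ⊗ b6
    in c4 ⊗ c4 ⊗ c4 ⊖ c6 ⊗ c6 :=
      # 1728 ⊗ (⊝ (b2 ⊗ b2 ⊗ b8) ⊖ # 8 ⊗ (b4 ⊗ b4 ⊗ b4) ⊖ # 27 ⊗ (b6 ⊗ b6) ⊕ # 9 ⊗ b2 ⊗ b4 ⊗ b6)
      ⊕ # 432 ⊗ b2 ⊗ b2 ⊗ (# 4 ⊗ b8 ⊖ (b2 ⊗ b6 ⊖ b4 ⊗ b4))

  -- Here w v is the ratio of two scaling factors. If n is its denominator, then m is its numerator,
  -- so the conclusion relates integers once c and c′ are integers.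
  rescale₄ : ∀ {u v w c c′} n → u *ᴿ v ≡ 1ᴿ →
    (((w *ᴿ w) *ᴿ w) *ᴿ w) *ᴿ c′ ≡ (((u *ᴿ u) *ᴿ u) *ᴿ u) *ᴿ c →
    let m = (w *ᴿ v) *ᴿ n in
    (m *ᴿ (m *ᴿ (m *ᴿ (m *ᴿ φ (+ 1))))) *ᴿ c′ ≡ (n *ᴿ (n *ᴿ (n *ᴿ (n *ᴿ φ (+ 1))))) *ᴿ c
  rescale₄ {u} {v} {w} {c} {c′} n uv≡1 eq =
    trans (solve 4 (λ v w n c → (w ⊗ v ⊗ n) ↑ 4 ⊗ c := (v ⊗ n) ↑ 4 ⊗ (w ⊗ w ⊗ w ⊗ w ⊗ c)) v w n c′)
      (trans (cong (λ z → ⟦ (var 0F ⊗ var 1F) ↑ 4 ⊗ var 2F ⟧ (v ∷ n ∷ z ∷ [])) eq)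
        (trans (solve 4 (λ u v n c → (v ⊗ n) ↑ 4 ⊗ (u ⊗ u ⊗ u ⊗ u ⊗ c) := (u ⊗ v) ↑ 4 ⊗ (n ↑ 4 ⊗ c)) u v n c)
          (trans (cong (λ z → ⟦ var 0F ↑ 4 ⊗ (var 1F ↑ 4 ⊗ var 2F) ⟧ (z ∷ n ∷ c ∷ [])) (trans uv≡1 (sym φ-1)))
            (solve 2 (λ n c → # 1 ↑ 4 ⊗ (n ↑ 4 ⊗ c) := n ↑ 4 ⊗ c) n c))))

  rescale₆ : ∀ {u v w c c′} n → u *ᴿ v ≡ 1ᴿ →
    (((((w *ᴿ w) *ᴿ w) *ᴿ w) *ᴿ w) *ᴿ w) *ᴿ c′ ≡ (((((u *ᴿ u) *ᴿ u) *ᴿ u) *ᴿ u) *ᴿ u) *ᴿ c →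
    let m = (w *ᴿ v) *ᴿ n in
    (m *ᴿ (m *ᴿ (m *ᴿ (m *ᴿ (m *ᴿ (m *ᴿ φ (+ 1))))))) *ᴿ c′
      ≡ (n *ᴿ (n *ᴿ (n *ᴿ (n *ᴿ (n *ᴿ (n *ᴿ φ (+ 1))))))) *ᴿ c
  rescale₆ {u} {v} {w} {c} {c′} n uv≡1 eq =
    trans (solve 4 (λ v w n c → (w ⊗ v ⊗ n) ↑ 6 ⊗ c := (v ⊗ n) ↑ 6 ⊗ (w ⊗ w ⊗ w ⊗ w ⊗ w ⊗ w ⊗ c)) v w n c′)
      (trans (cong (λ z → ⟦ (var 0F ⊗ var 1F) ↑ 6 ⊗ var 2F ⟧ (v ∷ n ∷ z ∷ [])) eq)
        (trans (solve 4 (λ u v n c →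
                 (v ⊗ n) ↑ 6 ⊗ (u ⊗ u ⊗ u ⊗ u ⊗ u ⊗ u ⊗ c) := (u ⊗ v) ↑ 6 ⊗ (n ↑ 6 ⊗ c)) u v n c)
          (trans (cong (λ z → ⟦ var 0F ↑ 6 ⊗ (var 1F ↑ 6 ⊗ var 2F) ⟧ (z ∷ n ∷ c ∷ [])) (trans uv≡1 (sym φ-1)))
            (solve 2 (λ n c → # 1 ↑ 6 ⊗ (n ↑ 6 ⊗ c) := n ↑ 6 ⊗ c) n c))))

  -- The 4th, 6th and 12th powers of a scaling factor enter as opaque elements related by two
  -- equations, so that they are never expanded.
  weight-12 : ∀ {p4 p6 p12 c4 c6 d} → (p4 *ᴿ p4) *ᴿ p4 ≡ p12 → p6 *ᴿ p6 ≡ p12 →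
    ((c4 *ᴿ c4) *ᴿ c4) +ᴿ (-ᴿ (c6 *ᴿ c6)) ≡ φ (+ 1728) *ᴿ d →
    (((p4 *ᴿ c4) *ᴿ (p4 *ᴿ c4)) *ᴿ (p4 *ᴿ c4)) +ᴿ (-ᴿ ((p6 *ᴿ c6) *ᴿ (p6 *ᴿ c6)))
      ≡ φ (+ 1728) *ᴿ (p12 *ᴿ d)
  weight-12 {p4} {p6} {p12} {c4} {c6} {d} e4 e6 eq =
    trans (solve 4 (λ p4 p6 c4 c6 → let x = p4 ⊗ c4 ; y = p6 ⊗ c6 in
            x ⊗ x ⊗ x ⊖ y ⊗ y := (p4 ⊗ p4 ⊗ p4) ⊗ (c4 ⊗ c4 ⊗ c4) ⊖ (p6 ⊗ p6) ⊗ (c6 ⊗ c6)) p4 p6 c4 c6)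
      (trans (cong₂ (λ v w → (v *ᴿ ((c4 *ᴿ c4) *ᴿ c4)) +ᴿ (-ᴿ (w *ᴿ (c6 *ᴿ c6)))) e4 e6)
        (trans (solve 3 (λ p c d → p ⊗ c ⊖ p ⊗ d := p ⊗ (c ⊖ d)) p12 ((c4 *ᴿ c4) *ᴿ c4) (c6 *ᴿ c6))
          (trans (cong (p12 *ᴿ_) eq)
            (solve 2 (λ p d → p ⊗ (# 1728 ⊗ d) := # 1728 ⊗ (p ⊗ d)) p12 d))))

  +0-cancel : ∀ x y {z} → z ≡ φ (+ 0) → x +ᴿ (y *ᴿ z) ≡ x
  +0-cancel x y refl = solve 2 (λ x y → x ⊕ y ⊗ # 0 := x) x y

open Reflection ℤ.+-*-isCommutativeRing (λ x → x) refl refl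
  (λ _ _ → refl) (λ _ _ → refl) (λ _ → refl)

⟦_⟧ᴹ : ∀ {n} → Model n → Vec ℤ n → WModel
⟦ model a1 a2 a3 a4 a6 ⟧ᴹ ρ = wm (⟦ a1 ⟧ ρ) (⟦ a2 ⟧ ρ) (⟦ a3 ⟧ ρ) (⟦ a4 ⟧ ρ) (⟦ a6 ⟧ ρ)

c4 c6 : WModel → ℤ
c4 E = b2 E * b2 E - + 24 * b4 E
c6 E = - (b2 E * b2 E * b2 E) + + 36 * b2 E * b4 E - + 216 * b6 E

4b8 : ∀ E → + 4 * b8 E - (b2 E * b6 E - b4 E * b4 E) ≡ + 0
4b8 (wm a1 a2 a3 a4 a6) =
  prove (# 4 ⊗ β8 general ⊖ (β2 general ⊗ β6 general ⊖ β4 general ⊗ β4 general)) (# 0)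
    (a1 ∷ a2 ∷ a3 ∷ a4 ∷ a6 ∷ [])

c4³-c6² : ∀ E → c4 E * c4 E * c4 E - c6 E * c6 E ≡ + 1728 * disc E
c4³-c6² E = trans (c4³-c6²-syzygy (b2 E) (b4 E) (b6 E) (b8 E))
  (+0-cancel (+ 1728 * disc E) (+ 432 * b2 E * b2 E) (4b8 E))

-- Divisibility of polynomial values

divisible : ℕ → ∀ n → Poly n → Bool
divisible m zero    c       = ⌊ + m ∣? c ⌋
divisible m (suc n) []      = true
divisible m (suc n) (c ∷ p) = divisible m n c ∧ divisible m (suc n) p

divisible-sound : ∀ m n p ρ → T (divisible m n p) → + m ∣ eval n p ρ
divisible-sound m zero c [] h = toWitness {a? = + m ∣? c} h
divisible-sound m (suc n) [] (x ∷ ρ) h = divides (+ 0) refl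
divisible-sound m (suc n) (c ∷ p) (x ∷ ρ) h with Equivalence.to (T-∧ {divisible m n c}) h
... | hc , hp = ∣m∣n⇒∣m+n (divisible-sound m n c ρ hc)
                  (∣n⇒∣m*n x (divisible-sound m (suc n) p (x ∷ ρ) hp))

∣-by-coefficients : ∀ m {n} (e : Expr n) {_ : T (divisible m n (norm e))} ρ → + m ∣ ⟦ e ⟧ ρ
∣-by-coefficients m e {h} ρ = subst (+ m ∣_) (eval-norm e ρ) (divisible-sound m _ (norm e) ρ h)

dropZeros : ∀ n → List (Poly n) → List (Poly n)
dropZeros n [] = []
dropZeros n (c ∷ p) = if isZero n c then dropZeros n p else c ∷ p

-- Long division, leading coefficients first; the divisor is given without its leading
-- coefficient 1.
divideMonic : ∀ n → ℕ → List (Poly n) → List (Poly n) → List (Poly n)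
divideMonic n zero    f g = []
divideMonic n (suc k) f [] = []
divideMonic n (suc k) f (c ∷ g) =
  if length g ℕ.<ᵇ length f then []
    else c ∷ divideMonic n k f (add (suc n) g (neg (suc n) (scale n c f)))

monicQuotient : ∀ n → Poly (suc n) → Poly (suc n) → Poly (suc n)
monicQuotient n f g with dropZeros n (reverse f)
... | []     = []
... | _ ∷ f′ = reverse (divideMonic n (length g) f′ (reverse g))

-- The computed quotient is untrusted: the implicit argument checks that multiplying it by f gives
-- back g. Long division itself thus needs no correctness proof.
∣-by-division : ∀ {n} (f g : Expr (suc n)) →
  {_ : T (isZero (suc n) (add (suc n) (norm g)
         (neg (suc n) (mul (suc n) (monicQuotient n (norm f) (norm g)) (norm f)))))} →
  ∀ ρ → ⟦ f ⟧ ρ ∣ ⟦ g ⟧ ρ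
∣-by-division {n} f g {h} ρ = divides (eval (suc n) q ρ) (begin
  ⟦ g ⟧ ρ                                   ≡⟨ eval-norm g ρ ⟨
  eval (suc n) (norm g) ρ                   ≡⟨ ℤ.i-j≡0⇒i≡j _ _ difference ⟩
  eval (suc n) (mul (suc n) q (norm f)) ρ   ≡⟨ eval-mul (suc n) q (norm f) ρ ⟩
  eval (suc n) q ρ * eval (suc n) (norm f) ρ ≡⟨ cong (eval (suc n) q ρ *_) (eval-norm f ρ) ⟩
  eval (suc n) q ρ * ⟦ f ⟧ ρ                ∎)
  where
  open ≡-Reasoning
  q = monicQuotient n (norm f) (norm g)
  difference : eval (suc n) (norm g) ρ - eval (suc n) (mul (suc n) q (norm f)) ρ ≡ + 0
  difference = begin
    eval (suc n) (norm g) ρ - eval (suc n) (mul (suc n) q (norm f)) ρ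
      ≡⟨ cong (λ z → eval (suc n) (norm g) ρ + z) (eval-neg (suc n) (mul (suc n) q (norm f)) ρ) ⟨
    eval (suc n) (norm g) ρ + eval (suc n) (neg (suc n) (mul (suc n) q (norm f))) ρ
      ≡⟨ eval-add (suc n) (norm g) _ ρ ⟨
    eval (suc n) (add (suc n) (norm g) (neg (suc n) (mul (suc n) q (norm f)))) ρ
      ≡⟨ eval-zero (suc n) (add (suc n) (norm g) (neg (suc n) (mul (suc n) q (norm f)))) ρ h ⟩
    + 0 ∎

-- Congruences refuted by exhausting residues.

∣-difference : ∀ {m x y} → m ∣ x - y → m ∣ y → m ∣ x
∣-difference {m} {x} {y} h k =
  subst (m ∣_) (solve 2 (λ x y → x ⊖ y ⊕ y := x) x y) (∣m∣n⇒∣m+n h k)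

⟦⟧-cong-mod : ∀ {m n} (e : Expr n) {ρ σ} → (∀ i → m ∣ lookup ρ i - lookup σ i) → m ∣ ⟦ e ⟧ ρ - ⟦ e ⟧ σ
⟦⟧-cong-mod (var i) h = h i
⟦⟧-cong-mod (con c) h = divides (+ 0) (ℤ.+-inverseʳ c)
⟦⟧-cong-mod {m} (d ⊕ e) {ρ} {σ} h = subst (m ∣_)
  (solve 4 (λ x y x′ y′ → (x ⊖ x′) ⊕ (y ⊖ y′) := (x ⊕ y) ⊖ (x′ ⊕ y′))
    (⟦ d ⟧ ρ) (⟦ e ⟧ ρ) (⟦ d ⟧ σ) (⟦ e ⟧ σ))
  (∣m∣n⇒∣m+n (⟦⟧-cong-mod d {ρ} {σ} h) (⟦⟧-cong-mod e {ρ} {σ} h))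
⟦⟧-cong-mod {m} (d ⊖ e) {ρ} {σ} h = subst (m ∣_)
  (solve 4 (λ x y x′ y′ → (x ⊖ x′) ⊖ (y ⊖ y′) := (x ⊖ y) ⊖ (x′ ⊖ y′))
    (⟦ d ⟧ ρ) (⟦ e ⟧ ρ) (⟦ d ⟧ σ) (⟦ e ⟧ σ))
  (∣m∣n⇒∣m-n (⟦⟧-cong-mod d {ρ} {σ} h) (⟦⟧-cong-mod e {ρ} {σ} h))
⟦⟧-cong-mod {m} (d ⊗ e) {ρ} {σ} h = subst (m ∣_)
  (solve 4 (λ x y x′ y′ → x ⊗ (y ⊖ y′) ⊕ y′ ⊗ (x ⊖ x′) := x ⊗ y ⊖ x′ ⊗ y′)
    (⟦ d ⟧ ρ) (⟦ e ⟧ ρ) (⟦ d ⟧ σ) (⟦ e ⟧ σ))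
  (∣m∣n⇒∣m+n (∣n⇒∣m*n (⟦ d ⟧ ρ) (⟦⟧-cong-mod e {ρ} {σ} h))
             (∣n⇒∣m*n (⟦ e ⟧ σ) (⟦⟧-cong-mod d {ρ} {σ} h)))
⟦⟧-cong-mod {m} (⊝ e) {ρ} {σ} h = subst (m ∣_)
  (solve 2 (λ x x′ → ⊝ (x ⊖ x′) := ⊝ x ⊖ ⊝ x′) (⟦ e ⟧ ρ) (⟦ e ⟧ σ))
  (∣m⇒∣-m (⟦⟧-cong-mod e {ρ} {σ} h))

infix 5.5 _∣ᴱ_ _∤ᴱ_
data Constraint (n : ℕ) : Set where
  _∣ᴱ_ _∤ᴱ_ : ℕ → Expr n → Constraint n

Holds : ∀ {n} → Vec ℤ n → Constraint n → Set
Holds ρ (d ∣ᴱ e) = + d ∣ ⟦ e ⟧ ρ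
Holds ρ (d ∤ᴱ e) = ¬ + d ∣ ⟦ e ⟧ ρ

modulus : ∀ {n} → Constraint n → ℕ
modulus (d ∣ᴱ _) = d
modulus (d ∤ᴱ _) = d

holds? : ∀ {n} (ρ : Vec ℤ n) c → Dec (Holds ρ c)
holds? ρ (d ∣ᴱ e) = + d ∣? ⟦ e ⟧ ρ
holds? ρ (d ∤ᴱ e) with + d ∣? ⟦ e ⟧ ρ
... | yes h = no (λ k → k h)
... | no h  = yes h

fails : ∀ {n} → List (Constraint n) → Vec ℤ n → Bool
fails []       ρ = false
fails (c ∷ cs) ρ = not (does (holds? ρ c)) ∨ fails cs ρ

allBelow : ℕ → (ℕ → Bool) → Bool
allBelow zero    f = true
allBelow (suc k) f = f k ∧ allBelow k f

allResidues : ℕ → ∀ n → (Vec ℤ n → Bool) → Bool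
allResidues m zero    f = f []
allResidues m (suc n) f = allBelow m (λ r → allResidues m n (λ σ → f (+ r ∷ σ)))

allBelow-sound : ∀ k f → T (allBelow k f) → ∀ r → r ℕ.< k → T (f r)
allBelow-sound (suc k) f h r r<k with Equivalence.to (T-∧ {f k}) h | ℕ.m≤n⇒m<n∨m≡n (ℕ.≤-pred r<k)
... | _ , h′ | inj₁ r<k′ = allBelow-sound k f h′ r r<k′
... | h′ , _ | inj₂ refl = h′

module _ (m : ℕ) .{{_ : NonZero m}} where

  residue : ∀ {n} → Vec ℤ n → Vec ℤ n
  residue []      = []
  residue (x ∷ ρ) = + (x ℤ.%ℕ m) ∷ residue ρ

  residue-≡ : ∀ {n} (ρ : Vec ℤ n) i → + m ∣ lookup ρ i - lookup (residue ρ) i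
  residue-≡ (x ∷ ρ) zero = divides (x ℤ./ℕ m) (begin
    x - r                     ≡⟨ cong (_- r) (ℤ.a≡a%ℕn+[a/ℕn]*n x m) ⟩
    r + (x ℤ./ℕ m) * + m - r  ≡⟨ solve 2 (λ r q → r ⊕ q ⊖ r := q) r ((x ℤ./ℕ m) * + m) ⟩
    (x ℤ./ℕ m) * + m          ∎)
    where
    open ≡-Reasoning
    r = + (x ℤ.%ℕ m)
  residue-≡ (x ∷ ρ) (suc i) = residue-≡ ρ i

  allResidues-sound : ∀ n f → T (allResidues m n f) → (ρ : Vec ℤ n) → T (f (residue ρ))
  allResidues-sound zero f h [] = h
  allResidues-sound (suc n) f h (x ∷ ρ) = allResidues-sound n _
    (allBelow-sound m _ h (x ℤ.%ℕ m) (ℤ.n%ℕd<d x m)) ρ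

  residue-holds : ∀ {n} (ρ : Vec ℤ n) c → modulus c ℕ.∣ m → Holds ρ c → Holds (residue ρ) c
  residue-holds ρ (d ∣ᴱ e) d∣m h = ∣m+n∣m⇒∣n (subst (+ d ∣_)
      (solve 2 (λ x y → x := (x ⊖ y) ⊕ y) (⟦ e ⟧ ρ) (⟦ e ⟧ (residue ρ))) h)
    (∣-trans (∣ᵤ⇒∣ d∣m) (⟦⟧-cong-mod e (residue-≡ ρ)))
  residue-holds ρ (d ∤ᴱ e) d∣m h k =
    h (∣-difference (∣-trans (∣ᵤ⇒∣ d∣m) (⟦⟧-cong-mod e (residue-≡ ρ))) k)

  fails-sound : ∀ {n} cs (ρ : Vec ℤ n) → T (fails cs ρ) → ¬ All (Holds ρ) cs
  fails-sound (c ∷ cs) ρ f (h ∷ hs) with holds? ρ c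
  ... | yes _ = fails-sound cs ρ f hs
  ... | no ¬h = ¬h h

  -- Each constraint has a modulus dividing m, so it depends only on residues modulo m and finitely
  -- many tuples remain. The search stops at the first violated constraint of a tuple, hence cheap
  -- constraints are listed first.
  no-residue : ∀ {n} (cs : List (Constraint n)) → {_ : T (allResidues m n (fails cs))} →
    {_ : True (all? (λ c → modulus c ℕ.∣? m) cs)} → ∀ ρ → ¬ All (Holds ρ) cs
  no-residue cs {check} {moduli} ρ hs = fails-sound cs (residue ρ)
    (allResidues-sound _ (fails cs) check ρ)
    (transfer hs (toWitness moduli))
    where
    transfer : ∀ {cs} → All (Holds ρ) cs → All (λ c → modulus c ℕ.∣ m) cs → All (Holds (residue ρ)) cs
    transfer [] [] = []
    transfer {c ∷ _} (h ∷ hs) (d∣m ∷ ds) = residue-holds ρ c d∣m h ∷ transfer hs ds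

-- Prime divisors

∣-^ : ∀ {x y} k → x ∣ y → x ^ k ∣ y ^ k
∣-^ zero    h = ∣-refl
∣-^ {x} {y} (suc k) h = ∣-trans (*-monoʳ-∣ x (∣-^ k h)) (*-monoˡ-∣ (y ^ k) h)

^-monoʳ-∣ : ∀ x {j k} → j ℕ.≤ k → x ^ j ∣ x ^ k
^-monoʳ-∣ x {k = k} ℕ.z≤n = ∣ᵤ⇒∣ (ℕ.1∣ _)
^-monoʳ-∣ x (ℕ.s≤s h) = *-monoʳ-∣ x (^-monoʳ-∣ x h)

^-nonZero : ∀ x .{{_ : ℤ.NonZero x}} k → ℤ.NonZero (x ^ k)
^-nonZero x zero    = _
^-nonZero x (suc k) = ℤ.i*j≢0 x (x ^ k) {{it}} {{^-nonZero x k}}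

^-distrib-* : ∀ x y k → (x * y) ^ k ≡ x ^ k * y ^ k
^-distrib-* x y zero    = refl
^-distrib-* x y (suc k) = trans (cong (x * y *_) (^-distrib-* x y k))
  (solve 4 (λ x y v w → x ⊗ y ⊗ (v ⊗ w) := x ⊗ v ⊗ (y ⊗ w)) x y (x ^ k) (y ^ k))

pos-^ : ∀ p k → + (p ℕ.^ k) ≡ (+ p) ^ k
pos-^ p zero    = refl
pos-^ p (suc k) = trans (ℤ.pos-* p (p ℕ.^ k)) (cong (+ p *_) (pos-^ p k))

module _ {p : ℕ} (pr : Prime p) where
  private instance
    p≢0 : NonZero p
    p≢0 = prime⇒nonZero pr

  euclid : ∀ x y → + p ∣ x * y → + p ∣ x ⊎ + p ∣ y
  euclid x y h with euclidsLemma (abs x) (abs y) pr (subst (p ℕ.∣_) (ℤ.abs-* x y) (∣⇒∣ᵤ h))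
  ... | inj₁ k = inj₁ (∣ᵤ⇒∣ k)
  ... | inj₂ k = inj₂ (∣ᵤ⇒∣ k)

  prime∤1 : ¬ + p ∣ + 1
  prime∤1 h = ℕ.nonTrivial⇒≢1 {{prime⇒nonTrivial pr}} (ℕ.∣1⇒≡1 (∣⇒∣ᵤ h))

  euclid-^ : ∀ x k → + p ∣ x ^ k → + p ∣ x
  euclid-^ x zero    h = ⊥-elim (prime∤1 h)
  euclid-^ x (suc k) h with euclid x (x ^ k) h
  ... | inj₁ k = k
  ... | inj₂ h = euclid-^ x k h

  cancel-∤ : ∀ k {x} y → ¬ + p ∣ x → (+ p) ^ k ∣ x * y → (+ p) ^ k ∣ y
  cancel-∤ zero    y p∤x h = ∣ᵤ⇒∣ (ℕ.1∣ _)
  cancel-∤ (suc k) {x} y p∤x h with euclid x y (∣-trans (∣m⇒∣m*n ((+ p) ^ k) ∣-refl) h)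
  ... | inj₁ p∣x = ⊥-elim (p∤x p∣x)
  ... | inj₂ (divides y′ refl) = subst ((+ p) ^ suc k ∣_) (ℤ.*-comm (+ p) y′)
    (*-monoʳ-∣ (+ p) (cancel-∤ k y′ p∤x (*-cancelˡ-∣ (+ p) (subst ((+ p) ^ suc k ∣_)
      (solve 3 (λ x y p → x ⊗ (y ⊗ p) := p ⊗ (x ⊗ y)) x y′ (+ p)) h))))

  prime∤coprime : ∀ {x y} → Coprime x y → + p ∣ x → ¬ + p ∣ y
  prime∤coprime {x} {y} cop h k = prime∤1 (subst (+ p ∣_) cop
    (∣ᵤ⇒∣ (ℤ.gcd-greatest {x} {y} {+ p} (∣⇒∣ᵤ h) (∣⇒∣ᵤ k))))

-- Minimality

-- Kraus's condition c₆ ≡ 0, 8 mod 32 in the second case is weakened to 8 ∣ c₆, which suffices here.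
Kraus : ℤ → ℤ → Set
Kraus x y = + 4 ∣ y - + 3 ⊎ (+ 16 ∣ x × + 8 ∣ y)

-- The conditions are those a rescaling by p would force on M. Being necessary conditions, they
-- yield minimality when refuted. In `kraus`, x and y are what c₄ and c₆ would become after division
-- by 2.
record Reducible (p : ℕ) (M : WModel) : Set where
  constructor reducible
  field
    ∣c4   : (+ p) ^ 4 ∣ c4 M
    ∣c6   : (+ p) ^ 6 ∣ c6 M
    ∣disc : (+ p) ^ 12 ∣ disc M
    kraus : p ≡ 2 → ∃[ x ] ∃[ y ] (c4 M ≡ + 16 * x × c6 M ≡ + 64 * y × Kraus x y)

even⊎odd : ∀ x → (∃[ k ] x ≡ + 2 * k) ⊎ (∃[ k ] x ≡ + 2 * k + + 1)
even⊎odd x with x ℤ.%ℕ 2 | ℤ.n%ℕd<d x 2 | ℤ.a≡a%ℕn+[a/ℕn]*n x 2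
... | 0 | _ | eq = inj₁ (x ℤ./ℕ 2 , trans eq (solve 1 (λ q → # 0 ⊕ q ⊗ # 2 := # 2 ⊗ q) (x ℤ./ℕ 2)))
... | 1 | _ | eq = inj₂ (x ℤ./ℕ 2 , trans eq (solve 1 (λ q → # 1 ⊕ q ⊗ # 2 := # 2 ⊗ q ⊕ # 1) (x ℤ./ℕ 2)))
... | suc (suc _) | ℕ.s≤s (ℕ.s≤s ()) | _

c4-γ4 : ∀ {n} (M : Model n) ρ → c4 (⟦ M ⟧ᴹ ρ) ≡ ⟦ γ4 M ⟧ ρ
c4-γ4 M ρ = refl

c6-γ6 : ∀ {n} (M : Model n) ρ → c6 (⟦ M ⟧ᴹ ρ) ≡ ⟦ γ6 M ⟧ ρ
c6-γ6 M ρ = refl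

disc-δ : ∀ {n} (M : Model n) ρ → disc (⟦ M ⟧ᴹ ρ) ≡ ⟦ δ M ⟧ ρ
disc-δ M ρ = refl

-- If a₁ is even, then 4 divides b₂ and 2 divides b₄, which gives the second alternative. If a₁ is
-- odd, then b₂ ≡ 1 mod 4 and c₆ ≡ -b₂³ ≡ 3 mod 4.
kraus-integral : ∀ E → Kraus (c4 E) (c6 E)
kraus-integral (wm a1 a2 a3 a4 a6) with even⊎odd a1
... | inj₁ (k , refl) = inj₂
    ( subst (+ 16 ∣_) (sym (c4-γ4 M ρ)) (∣-by-coefficients 16 (γ4 M) ρ)
    , subst (+ 8 ∣_) (sym (c6-γ6 M ρ)) (∣-by-coefficients 8 (γ6 M) ρ))
  where
  ρ = k ∷ a2 ∷ a3 ∷ a4 ∷ a6 ∷ []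
  M : Model 5
  M = model (# 2 ⊗ var 0F) (var 1F) (var 2F) (var 3F) (var 4F)
... | inj₂ (k , refl) = inj₁
    (subst (λ z → + 4 ∣ z - + 3) (sym (c6-γ6 M ρ)) (∣-by-coefficients 4 (γ6 M ⊖ # 3) ρ))
  where
  ρ = k ∷ a2 ∷ a3 ∷ a4 ∷ a6 ∷ []
  M : Model 5
  M = model (# 2 ⊗ var 0F ⊕ # 1) (var 1F) (var 2F) (var 3F) (var 4F)

-- Changes of variables

-- The arithmetic of ℚ normalises fractions, which does not compute on variables. The laws of `ι`
-- are therefore proved on unnormalised fractions.
toℚᵘ-ι : ∀ x → ℚ.toℚᵘ (ι x) ℚᵘ.≃ ℚᵘ.mkℚᵘ x 0
toℚᵘ-ι x = ℚ.toℚᵘ-fromℚᵘ (ℚᵘ.mkℚᵘ x 0)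

ι-injective : ∀ {x y} → ι x ≡ ι y → x ≡ y
ι-injective {x} {y} eq = ℤ.*-cancelʳ-≡ x y (+ 1) (ℚᵘ.drop-*≡*
  (ℚᵘ.≃-trans (ℚᵘ.≃-sym (toℚᵘ-ι x)) (ℚᵘ.≃-trans (ℚ.toℚᵘ-cong eq) (toℚᵘ-ι y))))

ι-+ : ∀ x y → ι (x + y) ≡ ι x ℚ.+ ι y
ι-+ x y = ℚ.toℚᵘ-injective (begin
  ℚ.toℚᵘ (ι (x + y))                     ≈⟨ toℚᵘ-ι (x + y) ⟩
  ℚᵘ.mkℚᵘ (x + y) 0                      ≈⟨ ℚᵘ.*≡* (solve 2 (λ x y →
                                              (x ⊕ y) ⊗ # 1 := (x ⊗ # 1 ⊕ y ⊗ # 1) ⊗ # 1) x y) ⟩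
  ℚᵘ.mkℚᵘ x 0 ℚᵘ.+ ℚᵘ.mkℚᵘ y 0           ≈⟨ ℚᵘ.+-cong (toℚᵘ-ι x) (toℚᵘ-ι y) ⟨
  ℚ.toℚᵘ (ι x) ℚᵘ.+ ℚ.toℚᵘ (ι y)         ≈⟨ ℚ.toℚᵘ-homo-+ (ι x) (ι y) ⟨
  ℚ.toℚᵘ (ι x ℚ.+ ι y)                   ∎)
  where open ℚᵘ.≃-Reasoning

ι-* : ∀ x y → ι (x * y) ≡ ι x ℚ.* ι y
ι-* x y = ℚ.toℚᵘ-injective (begin
  ℚ.toℚᵘ (ι (x * y))                     ≈⟨ toℚᵘ-ι (x * y) ⟩
  ℚᵘ.mkℚᵘ (x * y) 0                      ≈⟨ ℚᵘ.*-cong (toℚᵘ-ι x) (toℚᵘ-ι y) ⟨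
  ℚ.toℚᵘ (ι x) ℚᵘ.* ℚ.toℚᵘ (ι y)         ≈⟨ ℚ.toℚᵘ-homo-* (ι x) (ι y) ⟨
  ℚ.toℚᵘ (ι x ℚ.* ι y)                   ∎)
  where open ℚᵘ.≃-Reasoning

ι-neg : ∀ x → ι (- x) ≡ ℚ.- ι x
ι-neg x = ℚ.toℚᵘ-injective (begin
  ℚ.toℚᵘ (ι (- x))          ≈⟨ toℚᵘ-ι (- x) ⟩
  ℚᵘ.- ℚᵘ.mkℚᵘ x 0          ≈⟨ ℚᵘ.-‿cong (toℚᵘ-ι x) ⟨
  ℚᵘ.- ℚ.toℚᵘ (ι x)         ≈⟨ ℚ.toℚᵘ-homo‿- (ι x) ⟨
  ℚ.toℚᵘ (ℚ.- ι x)          ∎)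
  where open ℚᵘ.≃-Reasoning

*-denominator : ∀ q → q ℚ.* ι (ℚ.↧ q) ≡ ι (ℚ.↥ q)
*-denominator q@(ℚ.mkℚ n d _) = ℚ.toℚᵘ-injective (begin
  ℚ.toℚᵘ (q ℚ.* ι (ℚ.↧ q))                    ≈⟨ ℚ.toℚᵘ-homo-* q (ι (ℚ.↧ q)) ⟩
  ℚᵘ.mkℚᵘ n d ℚᵘ.* ℚ.toℚᵘ (ι (ℚ.↧ q))         ≈⟨ ℚᵘ.*-congˡ {ℚᵘ.mkℚᵘ n d} (toℚᵘ-ι (ℚ.↧ q)) ⟩
  ℚᵘ.mkℚᵘ n d ℚᵘ.* ℚᵘ.mkℚᵘ (+ suc d) 0        ≈⟨ ℚᵘ.*≡* (trans (ℤ.*-identityʳ _)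
                                                   (cong (λ k → n * + k) (sym (ℕ.*-identityʳ (suc d))))) ⟩
  ℚᵘ.mkℚᵘ n 0                                 ≈⟨ toℚᵘ-ι n ⟨
  ℚ.toℚᵘ (ι n)                                ∎)
  where open ℚᵘ.≃-Reasoning

module ℚ-Reflection = Reflection ℚ.+-*-isCommutativeRing ι refl refl ι-+ ι-* ι-neg

ι-⟦⟧ : ∀ {n} (e : Expr n) ρ → ι (⟦ e ⟧ ρ) ≡ ℚ-Reflection.⟦ e ⟧ (Vec.map ι ρ)
ι-⟦⟧ (var i) ρ = sym (Vec.lookup-map i ι ρ)
ι-⟦⟧ (con c) ρ = refl
ι-⟦⟧ (d ⊕ e) ρ = trans (ι-+ (⟦ d ⟧ ρ) (⟦ e ⟧ ρ)) (cong₂ ℚ._+_ (ι-⟦⟧ d ρ) (ι-⟦⟧ e ρ))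
ι-⟦⟧ (d ⊗ e) ρ = trans (ι-* (⟦ d ⟧ ρ) (⟦ e ⟧ ρ)) (cong₂ ℚ._*_ (ι-⟦⟧ d ρ) (ι-⟦⟧ e ρ))
ι-⟦⟧ (d ⊖ e) ρ = trans (ι-+ (⟦ d ⟧ ρ) (- ⟦ e ⟧ ρ))
  (cong₂ ℚ._+_ (ι-⟦⟧ d ρ) (trans (ι-neg (⟦ e ⟧ ρ)) (cong ℚ.-_ (ι-⟦⟧ e ρ))))
ι-⟦⟧ (⊝ e) ρ = trans (ι-neg (⟦ e ⟧ ρ)) (cong ℚ.-_ (ι-⟦⟧ e ρ))

cube-square : ℤ → ℤ → ℤ
cube-square x y = x * x * x - y * y

weighted-cube-square : ∀ m E → cube-square (m ^ 4 * c4 E) (m ^ 6 * c6 E) ≡ + 1728 * (m ^ 12 * disc E)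
weighted-cube-square m E = weight-12 {p4 = m ^ 4} {m ^ 6} {m ^ 12} {c4 E} {c6 E} {disc E}
  (solve 1 (λ m → m ↑ 4 ⊗ m ↑ 4 ⊗ m ↑ 4 := m ↑ 12) m) (solve 1 (λ m → m ↑ 6 ⊗ m ↑ 6 := m ↑ 12) m)
  (c4³-c6² E)

-- Comparison of two integral models of one curve.

record Rescaling (M M′ : WModel) : Set where
  field
    m n     : ℤ
    coprime : Coprime m n
    c4-eq   : m ^ 4 * c4 M′ ≡ n ^ 4 * c4 M
    c6-eq   : m ^ 6 * c6 M′ ≡ n ^ 6 * c6 M

  disc-eq : m ^ 12 * disc M′ ≡ n ^ 12 * disc M
  disc-eq = ℤ.*-cancelˡ-≡ (+ 1728) (m ^ 12 * disc M′) (n ^ 12 * disc M)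
    (trans (sym (weighted-cube-square m M′))
      (trans (cong₂ cube-square c4-eq c6-eq) (weighted-cube-square n M)))

lowest-terms : ∀ q → Coprime (ℚ.↥ q) (ℚ.↧ q)
lowest-terms (ℚ.mkℚ _ _ c) = cong +_ (Coprimality.coprime⇒gcd≡1 (Coprimality.recompute c))

coefficients : WModel → Vec ℤ 5
coefficients E = a1 E ∷ a2 E ∷ a3 E ∷ a4 E ∷ a6 E ∷ []

ι-c4 : ∀ E → ι (c4 E) ≡ ℚ-Reflection.⟦ γ4 general ⟧ (Vec.map ι (coefficients E))
ι-c4 E = trans (cong ι (c4-γ4 general (coefficients E))) (ι-⟦⟧ (γ4 general) (coefficients E))

ι-c6 : ∀ E → ι (c6 E) ≡ ℚ-Reflection.⟦ γ6 general ⟧ (Vec.map ι (coefficients E))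
ι-c6 E = trans (cong ι (c6-γ6 general (coefficients E))) (ι-⟦⟧ (γ6 general) (coefficients E))

monomial : ∀ k → Expr 2
monomial k = var 0F ↑ k ⊗ var 1F

ι-monomial : ∀ k m c {e} → ι c ≡ e → ι (m ^ k * c) ≡ ℚ-Reflection.⟦ monomial k ⟧ (ι m ∷ e ∷ [])
ι-monomial k m c {e} eq = trans (ι-* (m ^ k) c) (cong₂ ℚ._*_ (power k) eq)
  where
  power : ∀ k → ι (m ^ k) ≡ ℚ-Reflection.⟦ var 0F ↑ k ⟧ (ι m ∷ e ∷ [])
  power zero    = refl
  power (suc k) = trans (ι-* m (m ^ k)) (cong (ι m ℚ.*_) (power k))

monomial-injective : ∀ k m n c c′ {e e′} → ι c ≡ e → ι c′ ≡ e′ →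
  ℚ-Reflection.⟦ monomial k ⟧ (ι m ∷ e ∷ []) ≡ ℚ-Reflection.⟦ monomial k ⟧ (ι n ∷ e′ ∷ []) →
  m ^ k * c ≡ n ^ k * c′
monomial-injective k m n c c′ p q eq = ι-injective {m ^ k * c} {n ^ k * c′}
  (trans (ι-monomial k m c p) (trans eq (sym (ι-monomial k n c′ q))))

γ4ℚ γ6ℚ : WModel → ℚ.ℚ
γ4ℚ E = ℚ-Reflection.⟦ γ4 general ⟧ (Vec.map ι (coefficients E))
γ6ℚ E = ℚ-Reflection.⟦ γ6 general ⟧ (Vec.map ι (coefficients E))

isoQ-γ4 : ∀ {E M} (iso : IsoQ E M) → let u = proj₁ iso in u ℚ.* u ℚ.* u ℚ.* u ℚ.* γ4ℚ M ≡ γ4ℚ E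
isoQ-γ4 {E} {M} (u , r , s , t , _ , e1 , e2 , e3 , e4 , e6) = ℚ-Reflection.c4-transform
  {u} {r} {s} {t} {ι (a1 E)} {ι (a2 E)} {ι (a3 E)} {ι (a4 E)} {ι (a6 E)}
  {ι (a1 M)} {ι (a2 M)} {ι (a3 M)} {ι (a4 M)} {ι (a6 M)} e1 e2 e3 e4 e6

isoQ-γ6 : ∀ {E M} (iso : IsoQ E M) → let u = proj₁ iso in
  u ℚ.* u ℚ.* u ℚ.* u ℚ.* u ℚ.* u ℚ.* γ6ℚ M ≡ γ6ℚ E
isoQ-γ6 {E} {M} (u , r , s , t , _ , e1 , e2 , e3 , e4 , e6) = ℚ-Reflection.c6-transform
  {u} {r} {s} {t} {ι (a1 E)} {ι (a2 E)} {ι (a3 E)} {ι (a4 E)} {ι (a6 E)}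
  {ι (a1 M)} {ι (a2 M)} {ι (a3 M)} {ι (a4 M)} {ι (a6 M)} e1 e2 e3 e4 e6

-- Both u⁴ c₄(M) and w⁴ c₄(M′) equal c₄(E), and similarly for c₆. The fraction w / u in lowest terms
-- is thus the required m / n, without composing or inverting changes of variables.
isoQ⇒rescaling : ∀ {E M M′} → IsoQ E M → IsoQ E M′ → Rescaling M M′
isoQ⇒rescaling {E} {M} {M′} iso@(u , _ , _ , _ , u≢0 , _) iso′@(w , _) = record
  { m = ℚ.↥ x ; n = ℚ.↧ x
  ; coprime = lowest-terms x
  ; c4-eq = monomial-injective 4 (ℚ.↥ x) (ℚ.↧ x) (c4 M′) (c4 M) (ι-c4 M′) (ι-c4 M)
      (subst (λ z → ℚ-Reflection.⟦ monomial 4 ⟧ (z ∷ γ4ℚ M′ ∷ [])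
                  ≡ ℚ-Reflection.⟦ monomial 4 ⟧ (ι (ℚ.↧ x) ∷ γ4ℚ M ∷ [])) (*-denominator x)
        (ℚ-Reflection.rescale₄ {u} {ℚ.1/ u} {w} {γ4ℚ M} {γ4ℚ M′} (ι (ℚ.↧ x)) (ℚ.*-inverseʳ u)
          (trans (isoQ-γ4 {E} {M′} iso′) (sym (isoQ-γ4 {E} {M} iso)))))
  ; c6-eq = monomial-injective 6 (ℚ.↥ x) (ℚ.↧ x) (c6 M′) (c6 M) (ι-c6 M′) (ι-c6 M)
      (subst (λ z → ℚ-Reflection.⟦ monomial 6 ⟧ (z ∷ γ6ℚ M′ ∷ [])
                  ≡ ℚ-Reflection.⟦ monomial 6 ⟧ (ι (ℚ.↧ x) ∷ γ6ℚ M ∷ [])) (*-denominator x)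
        (ℚ-Reflection.rescale₆ {u} {ℚ.1/ u} {w} {γ6ℚ M} {γ6ℚ M′} (ι (ℚ.↧ x)) (ℚ.*-inverseʳ u)
          (trans (isoQ-γ6 {E} {M′} iso′) (sym (isoQ-γ6 {E} {M} iso)))))
  }
  where
  instance _ = ℚ.≢-nonZero u≢0
  x = w ℚ.* (ℚ.1/ u)

-- For k = 4 and k = 6 this compares M′ with the hypothetical model obtained from M by dividing by
-- 2; the numerator of the scaling factor drops from m to h = m / 2.
halve : ∀ k {m n h z z′ q} → m ≡ h * + 2 → z ≡ q * (+ 2) ^ k → m ^ k * z′ ≡ n ^ k * z →
  h ^ k * z′ ≡ n ^ k * q
halve k {n = n} {h} {z′ = z′} {q} refl refl eq =
  ℤ.*-cancelʳ-≡ (h ^ k * z′) (n ^ k * q) ((+ 2) ^ k) {{^-nonZero (+ 2) k}} (begin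
    h ^ k * z′ * (+ 2) ^ k      ≡⟨ solve 3 (λ h z t → h ⊗ z ⊗ t := h ⊗ t ⊗ z) (h ^ k) z′ ((+ 2) ^ k) ⟩
    h ^ k * (+ 2) ^ k * z′      ≡⟨ cong (_* z′) (^-distrib-* h (+ 2) k) ⟨
    (h * + 2) ^ k * z′          ≡⟨ eq ⟩
    n ^ k * (q * (+ 2) ^ k)     ≡⟨ ℤ.*-assoc (n ^ k) q ((+ 2) ^ k) ⟨
    n ^ k * q * (+ 2) ^ k       ∎)
  where open ≡-Reasoning

2-prime : Prime 2
2-prime = toWitness {a? = prime? 2} tt

-- As n is odd, it can be cancelled from powers of 2. If h is even, then 16 ∣ h⁴ and 8 ∣ h⁶ give the
-- second alternative; if h is odd, the sixth powers are 1 modulo 4 and y ≡ y′.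
kraus-rescale : ∀ h n x y x′ y′ → ¬ + 2 ∣ n → h ^ 4 * x′ ≡ n ^ 4 * x → h ^ 6 * y′ ≡ n ^ 6 * y →
  Kraus x′ y′ → Kraus x y
kraus-rescale h n x y x′ y′ 2∤n 4-eq 6-eq = conditions
  where
  cancel : ∀ k j z → (+ 2) ^ k ∣ n ^ j * z → (+ 2) ^ k ∣ z
  cancel k j z = cancel-∤ 2-prime k z (λ d → 2∤n (euclid-^ 2-prime n j d))
  conditions : Kraus x′ y′ → Kraus x y
  conditions (inj₂ (16∣ , 8∣)) = inj₂
    ( cancel 4 4 x (subst (+ 16 ∣_) 4-eq (∣n⇒∣m*n (h ^ 4) 16∣))
    , cancel 3 6 y (subst (+ 8 ∣_) 6-eq (∣n⇒∣m*n (h ^ 6) 8∣)))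
  conditions (inj₁ 4∣) with + 2 ∣? h
  ... | yes 2∣h = inj₂
    ( cancel 4 4 x (subst (+ 16 ∣_) 4-eq (∣m⇒∣m*n x′ (∣-^ 4 2∣h)))
    , cancel 3 6 y (subst (+ 8 ∣_) 6-eq (∣m⇒∣m*n y′
        (∣-trans (^-monoʳ-∣ (+ 2) {3} {6} (ℕ.s≤s (ℕ.s≤s (ℕ.s≤s ℕ.z≤n)))) (∣-^ 6 2∣h)))))
  ... | no 2∤h with + 4 ∣? y - + 3
  ...   | yes 4∣y = inj₁ 4∣y
  ...   | no 4∤y = ⊥-elim (no-residue 4
          ( 4 ∣ᴱ var 1F ⊖ # 3 ∷ 2 ∤ᴱ var 0F ∷ 2 ∤ᴱ var 2F ∷ 4 ∤ᴱ var 3F ⊖ # 3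
          ∷ 4 ∣ᴱ var 0F ↑ 6 ⊗ var 1F ⊖ var 2F ↑ 6 ⊗ var 3F ∷ [])
          (h ∷ y′ ∷ n ∷ y ∷ [])
          (4∣ ∷ 2∤h ∷ 2∤n ∷ 4∤y ∷ divides (+ 0) (trans (cong (_- n ^ 6 * y) 6-eq) (ℤ.+-inverseʳ (n ^ 6 * y))) ∷ []))

rescaling⇒reducible : ∀ {p M M′} → Prime p → (R : Rescaling M M′) → + p ∣ Rescaling.m R → Reducible p M
rescaling⇒reducible {p} {M} {M′} pr R p∣m = reducible
  (divisor 4 (c4 M) (c4 M′) c4-eq) (divisor 6 (c6 M) (c6 M′) c6-eq)
  (divisor 12 (disc M) (disc M′) disc-eq) kraus
  where
  open Rescaling R
  p∤n : ¬ + p ∣ n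
  p∤n = prime∤coprime pr {m} {n} coprime p∣m

  p∤n^ : ∀ k → ¬ + p ∣ n ^ k
  p∤n^ k h = p∤n (euclid-^ pr n k h)

  divisor : ∀ k x x′ → m ^ k * x′ ≡ n ^ k * x → (+ p) ^ k ∣ x
  divisor k x x′ eq = cancel-∤ pr k x (p∤n^ k)
    (subst ((+ p) ^ k ∣_) eq (∣m⇒∣m*n x′ (∣-^ k p∣m)))

  module _ (p≡2 : p ≡ 2) where
    private
      2∣m : + 2 ∣ m
      2∣m = subst (λ q → + q ∣ m) p≡2 p∣m
      2∤n : ¬ + 2 ∣ n
      2∤n h = p∤n (subst (λ q → + q ∣ n) (sym p≡2) h)

    open _∣_ 2∣m using () renaming (quotient to h; equality to m≡h*2)
    open _∣_ (subst (λ q → (+ q) ^ 4 ∣ c4 M) p≡2 (divisor 4 (c4 M) (c4 M′) c4-eq))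
      using () renaming (quotient to x; equality to c4≡)
    open _∣_ (subst (λ q → (+ q) ^ 6 ∣ c6 M) p≡2 (divisor 6 (c6 M) (c6 M′) c6-eq))
      using () renaming (quotient to y; equality to c6≡)

    kraus : ∃[ x ] ∃[ y ] (c4 M ≡ + 16 * x × c6 M ≡ + 64 * y × Kraus x y)
    kraus = x , y , trans c4≡ (ℤ.*-comm x (+ 16)) , trans c6≡ (ℤ.*-comm y (+ 64)) ,
      kraus-rescale h n x y (c4 M′) (c6 M′) 2∤n
        (halve 4 {m} {n} {h} {c4 M} {c4 M′} {x} m≡h*2 c4≡ c4-eq)
        (halve 6 {m} {n} {h} {c6 M} {c6 M′} {y} m≡h*2 c6≡ c6-eq)
        (kraus-integral M′)

-- A prime dividing m is excluded by the hypothesis. For any other p, the equation m¹² Δ(M′) = n¹²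
-- Δ(M) carries every power of p from Δ(M) to Δ(M′).
minimal : ∀ {E M} → IsoQ E M → (∀ p → Prime p → ¬ Reducible p M) → GlobalMinimal E M
minimal {E} {M} iso irreducible = iso , λ M′ iso′ p pr → valuation M′ pr (isoQ⇒rescaling {E} {M} {M′} iso iso′)
  where
  valuation : ∀ M′ {p} → Prime p → Rescaling M M′ → ValLE p (disc M) (disc M′)
  valuation M′ {p} pr R k h = ∣⇒∣ᵤ (subst (_∣ disc M′) (sym (pos-^ p k))
    (cancel-∤ pr k (disc M′) p∤m^ (subst ((+ p) ^ k ∣_) (sym disc-eq)
      (∣n⇒∣m*n (n ^ 12) (subst (_∣ disc M) (pos-^ p k) (∣ᵤ⇒∣ h))))))
    where
    open Rescaling R
    p∤m^ : ¬ + p ∣ m ^ 12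
    p∤m^ d = irreducible p pr (rescaling⇒reducible pr R (euclid-^ pr m 12 d))

record Transform (u : ℤ) (E M : WModel) : Set where
  constructor transform
  field
    r s t : ℤ
    u≢0 : u ≢ + 0
    eq1 : u * a1 M ≡ a1 E + + 2 * s
    eq2 : u * u * a2 M ≡ a2 E - s * a1 E + + 3 * r - s * s
    eq3 : u * u * u * a3 M ≡ a3 E + r * a1 E + + 2 * t
    eq4 : u * u * u * u * a4 M ≡ a4 E - s * a3 E + + 2 * r * a2 E - (t + r * s) * a1 E + + 3 * r * r
            - + 2 * s * t
    eq6 : u * u * u * u * u * u * a6 M ≡ a6 E + r * a4 E + r * r * a2 E + r * r * r - t * a3 E - t * t
            - r * t * a1 E

ι-equation : ∀ {n} (d e : Expr n) ρ → ⟦ d ⟧ ρ ≡ ⟦ e ⟧ ρ →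
  ℚ-Reflection.⟦ d ⟧ (Vec.map ι ρ) ≡ ℚ-Reflection.⟦ e ⟧ (Vec.map ι ρ)
ι-equation d e ρ eq = trans (sym (ι-⟦⟧ d ρ)) (trans (cong ι eq) (ι-⟦⟧ e ρ))

transform⇒isoQ : ∀ {u E M} → Transform u E M → IsoQ E M
transform⇒isoQ {u} {E} {M} τ =
  ι u , ι r , ι s , ι t , (λ eq → u≢0 (ι-injective {u} {+ 0} eq))
  , ι-equation (v ⊗ y) (x1 ⊕ # 2 ⊗ s′) (a1 M ∷ ρ) eq1
  , ι-equation (v ⊗ v ⊗ y) (x2 ⊖ s′ ⊗ x1 ⊕ # 3 ⊗ r′ ⊖ s′ ⊗ s′) (a2 M ∷ ρ) eq2
  , ι-equation (v ⊗ v ⊗ v ⊗ y) (x3 ⊕ r′ ⊗ x1 ⊕ # 2 ⊗ t′) (a3 M ∷ ρ) eq3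
  , ι-equation (v ⊗ v ⊗ v ⊗ v ⊗ y)
      (x4 ⊖ s′ ⊗ x3 ⊕ # 2 ⊗ r′ ⊗ x2 ⊖ (t′ ⊕ r′ ⊗ s′) ⊗ x1 ⊕ # 3 ⊗ r′ ⊗ r′ ⊖ # 2 ⊗ s′ ⊗ t′) (a4 M ∷ ρ) eq4
  , ι-equation (v ⊗ v ⊗ v ⊗ v ⊗ v ⊗ v ⊗ y)
      (x6 ⊕ r′ ⊗ x4 ⊕ r′ ⊗ r′ ⊗ x2 ⊕ r′ ⊗ r′ ⊗ r′ ⊖ t′ ⊗ x3 ⊖ t′ ⊗ t′ ⊖ r′ ⊗ t′ ⊗ x1) (a6 M ∷ ρ) eq6
  where
  open Transform τ
  ρ = a1 E ∷ a2 E ∷ a3 E ∷ a4 E ∷ a6 E ∷ u ∷ r ∷ s ∷ t ∷ []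
  y x1 x2 x3 x4 x6 v r′ s′ t′ : Expr 10
  y = var 0F
  x1 = var 1F
  x2 = var 2F
  x3 = var 3F
  x4 = var 4F
  x6 = var 5F
  v = var 6F
  r′ = var 7F
  s′ = var 8F
  t′ = var 9F

module _ {u E M} (τ : Transform u E M) where
  open Transform τ

  transform-c4 : u * u * u * u * c4 M ≡ c4 E
  transform-c4 = c4-transform {u} {r} {s} {t} {a1 E} {a2 E} {a3 E} {a4 E} {a6 E}
    {a1 M} {a2 M} {a3 M} {a4 M} {a6 M} eq1 eq2 eq3 eq4 eq6

  transform-c6 : u * u * u * u * u * u * c6 M ≡ c6 E
  transform-c6 = c6-transform {u} {r} {s} {t} {a1 E} {a2 E} {a3 E} {a4 E} {a6 E}
    {a1 M} {a2 M} {a3 M} {a4 M} {a6 M} eq1 eq2 eq3 eq4 eq6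

  transform-disc : u ^ 12 * disc M ≡ disc E
  transform-disc = ℤ.*-cancelˡ-≡ (+ 1728) (u ^ 12 * disc M) (disc E)
    (trans (sym (weighted-cube-square u M))
      (trans (cong₂ cube-square
          (trans (solve 2 (λ u c → u ↑ 4 ⊗ c := u ⊗ u ⊗ u ⊗ u ⊗ c) u (c4 M)) transform-c4)
          (trans (solve 2 (λ u c → u ↑ 6 ⊗ c := u ⊗ u ⊗ u ⊗ u ⊗ u ⊗ u ⊗ c) u (c6 M)) transform-c6))
        (c4³-c6² E)))

-- The record lets E and u be inferred by unification while the discriminants stay unevaluated.
record Result (E : WModel) (u : ℕ) : Set where
  constructor result
  field minimal-discriminant : Σ ℤ (λ D → MinDisc E D × D * (+ u) ^ 12 ≡ disc E)

conclude : ∀ {E M u} → Transform (+ u) E M → (∀ p → Prime p → ¬ Reducible p M) → Result E u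
conclude {E} {M} {u} τ irreducible = result (disc M ,
  (M , minimal {E} {M} (transform⇒isoQ τ) irreducible , refl) ,
  trans (ℤ.*-comm (disc M) ((+ u) ^ 12)) (transform-disc τ))

scaling : ∀ {u E M} → u ≢ + 0 → u * a1 M ≡ a1 E → u * u * a2 M ≡ a2 E → u * u * u * a3 M ≡ a3 E →
  u * u * u * u * a4 M ≡ a4 E → u * u * u * u * u * u * a6 M ≡ a6 E → Transform u E M
scaling {u} {E} u≢0 e1 e2 e3 e4 e6 = transform (+ 0) (+ 0) (+ 0) u≢0
  (trans e1 (solve 1 (λ x → x := x ⊕ # 2 ⊗ # 0) (a1 E)))
  (trans e2 (solve 2 (λ x y → y := y ⊖ # 0 ⊗ x ⊕ # 3 ⊗ # 0 ⊖ # 0 ⊗ # 0) (a1 E) (a2 E)))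
  (trans e3 (solve 2 (λ x y → y := y ⊕ # 0 ⊗ x ⊕ # 2 ⊗ # 0) (a1 E) (a3 E)))
  (trans e4 (solve 4 (λ x y z w → w := w ⊖ # 0 ⊗ z ⊕ # 2 ⊗ # 0 ⊗ y ⊖ (# 0 ⊕ # 0 ⊗ # 0) ⊗ x
    ⊕ # 3 ⊗ # 0 ⊗ # 0 ⊖ # 2 ⊗ # 0 ⊗ # 0) (a1 E) (a2 E) (a3 E) (a4 E)))
  (trans e6 (solve 5 (λ x y z w v → v := v ⊕ # 0 ⊗ w ⊕ # 0 ⊗ # 0 ⊗ y ⊕ # 0 ⊗ # 0 ⊗ # 0 ⊖ # 0 ⊗ z
    ⊖ # 0 ⊗ # 0 ⊖ # 0 ⊗ # 0 ⊗ x) (a1 E) (a2 E) (a3 E) (a4 E) (a6 E)))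

identity : ∀ E → Transform (+ 1) E E
identity E = scaling (λ ())
  (solve 1 (λ x → # 1 ⊗ x := x) (a1 E)) (solve 1 (λ x → # 1 ⊗ # 1 ⊗ x := x) (a2 E))
  (solve 1 (λ x → # 1 ⊗ # 1 ⊗ # 1 ⊗ x := x) (a3 E))
  (solve 1 (λ x → # 1 ⊗ # 1 ⊗ # 1 ⊗ # 1 ⊗ x := x) (a4 E))
  (solve 1 (λ x → # 1 ⊗ # 1 ⊗ # 1 ⊗ # 1 ⊗ # 1 ⊗ # 1 ⊗ x := x) (a6 E))

-- The equation for a₁ is returned as well, because the parity of the new a₁ is what decides the
-- prime 2.
scale-down : ∀ u E .{{_ : NonZero u}} → + u ∣ a1 E → (+ u) ^ 2 ∣ a2 E → (+ u) ^ 3 ∣ a3 E →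
  (+ u) ^ 4 ∣ a4 E → (+ u) ^ 6 ∣ a6 E → ∃[ M ] (Transform (+ u) E M × + u * a1 M ≡ a1 E)
scale-down u@(suc _) E (divides q1 e1) (divides q2 e2) (divides q3 e3) (divides q4 e4) (divides q6 e6) =
  wm q1 q2 q3 q4 q6 , scaling (λ ())
  (trans (ℤ.*-comm (+ u) q1) (sym e1))
  (trans (solve 2 (λ u q → u ⊗ u ⊗ q := q ⊗ u ↑ 2) (+ u) q2) (sym e2))
  (trans (solve 2 (λ u q → u ⊗ u ⊗ u ⊗ q := q ⊗ u ↑ 3) (+ u) q3) (sym e3))
  (trans (solve 2 (λ u q → u ⊗ u ⊗ u ⊗ u ⊗ q := q ⊗ u ↑ 4) (+ u) q4) (sym e4))
  (trans (solve 2 (λ u q → u ⊗ u ⊗ u ⊗ u ⊗ u ⊗ u ⊗ q := q ⊗ u ↑ 6) (+ u) q6) (sym e6)) ,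
  trans (ℤ.*-comm (+ u) q1) (sym e1)

module _ {u E M} (τ : Transform u E M) {d : ℤ} where
  ∣-transform-c4 : d ∣ c4 M → d ∣ c4 E
  ∣-transform-c4 h = subst (d ∣_) (transform-c4 τ) (∣n⇒∣m*n (u * u * u * u) h)

  ∣-transform-c6 : d ∣ c6 M → d ∣ c6 E
  ∣-transform-c6 h = subst (d ∣_) (transform-c6 τ) (∣n⇒∣m*n (u * u * u * u * u * u) h)

  ∣-transform-disc : d ∣ disc M → d ∣ disc E
  ∣-transform-disc h = subst (d ∣_) (transform-disc τ) (∣n⇒∣m*n (u ^ 12) h)

-- Modulo 2 one has c₄ ≡ b₂² ≡ a₁⁴.
2∣c4⇒2∣a1 : ∀ E → + 2 ∣ c4 E → + 2 ∣ a1 E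
2∣c4⇒2∣a1 E@(wm a1 a2 a3 a4 a6) h with + 2 ∣? a1
... | yes 2∣a1 = 2∣a1
... | no 2∤a1 = ⊥-elim (no-residue 2 (2 ∤ᴱ var 0F ∷ 2 ∣ᴱ γ4 (general {0}) ∷ []) (coefficients E)
  (2∤a1 ∷ h ∷ []))

-- Bad primes of a binary family

prime-∣-prime : ∀ {p q} → Prime p → Prime q → + p ∣ + q → p ≡ q
prime-∣-prime pr qr h with prime⇒irreducible qr (∣⇒∣ᵤ h)
... | inj₁ refl = ⊥-elim (prime∤1 pr ∣-refl)
... | inj₂ p≡q  = p≡q

prime-∣-power : ∀ {p} → Prime p → ∀ K R m → K ℕ.∣ R ℕ.^ m → + p ∣ + K → + p ∣ + R
prime-∣-power {p} pr K R m K∣R^m h = euclid-^ pr (+ R) m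
  (subst (+ p ∣_) (pos-^ R m) (∣-trans h (∣ᵤ⇒∣ K∣R^m)))

∣-subtrahend : ∀ {d} v w → d ∣ v → d ∣ v - w → d ∣ w
∣-subtrahend {d} v w h k = subst (d ∣_) (solve 2 (λ v w → v ⊖ (v ⊖ w) := w) v w) (∣m∣n⇒∣m-n h k)

X Y : Expr 2
X = var 0F
Y = var 1F

⟦↑⟧ : ∀ {m} (e : Expr m) n ρ → ⟦ e ↑ n ⟧ ρ ≡ ⟦ e ⟧ ρ ^ n
⟦↑⟧ e zero    ρ = refl
⟦↑⟧ e (suc n) ρ = cong (⟦ e ⟧ ρ *_) (⟦↑⟧ e n ρ)

-- A multiple B c of c is congruent to K Yⁿ modulo f, so a common prime divisor of c and f divides K or y.
-- In the instances B and K come from inverting c₄ modulo f, and R is the radical of the constants K.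
record BadAt (R : ℕ) (c f : Expr 2) : Set where
  constructor bad-at
  field common-divisor : ∀ {p} → Prime p → ∀ ρ → + p ∣ ⟦ c ⟧ ρ → + p ∣ ⟦ f ⟧ ρ → (+ p ∣ + R) ⊎ (+ p ∣ lookup ρ 1F)

-- Long division by f, which is monic in X, certifies that f divides B c - K Yⁿ. The exponent e
-- witnesses that every prime of K divides R, so K is never factored.
badAt : ∀ {R c} f B K e n {_ : T (isZero 2 (add 2 (norm (B ⊗ c ⊖ # K ⊗ Y ↑ n))
    (neg 2 (mul 2 (monicQuotient 1 (norm f) (norm (B ⊗ c ⊖ # K ⊗ Y ↑ n))) (norm f)))))} →
  {_ : True (K ℕ.∣? R ℕ.^ e)} → BadAt R c f
badAt {R} {c} f B K e n {division} {K∣R^} = bad-at λ { {p} pr ρ@(x ∷ y ∷ []) p∣c p∣f →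
  [ (λ p∣K → inj₁ (prime-∣-power pr K R e (toWitness {a? = K ℕ.∣? R ℕ.^ e} K∣R^) p∣K))
  , (λ p∣y^n → inj₂ (euclid-^ pr y n (subst (+ p ∣_) (⟦↑⟧ Y n ρ) p∣y^n)))
  ]′ (euclid pr (+ K) (⟦ Y ↑ n ⟧ ρ) (∣-subtrahend (⟦ B ⟧ ρ * ⟦ c ⟧ ρ) (+ K * ⟦ Y ↑ n ⟧ ρ)
       (∣n⇒∣m*n (⟦ B ⟧ ρ) p∣c) (∣-trans p∣f (∣-by-division f (B ⊗ c ⊖ # K ⊗ Y ↑ n) {division} ρ)))) }

data Factors (R : ℕ) (c : Expr 2) : Set where
  []  : Factors R c
  _^ᶠ_∷_ : ∀ {f} → BadAt R c f → ℕ → Factors R c → Factors R c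

infixr 5 _^ᶠ_∷_

product : ∀ {R c} → Factors R c → Expr 2
product [] = # 1
product (_^ᶠ_∷_ {f} _ e fs) = f ↑ e ⊗ product fs

factor-divides : ∀ {R c p} → Prime p → (fs : Factors R c) → ∀ ρ → + p ∣ ⟦ c ⟧ ρ →
  + p ∣ ⟦ product fs ⟧ ρ → (+ p ∣ + R) ⊎ (+ p ∣ lookup ρ 1F)
factor-divides pr [] ρ p∣c h = ⊥-elim (prime∤1 pr h)
factor-divides {p = p} pr (_^ᶠ_∷_ {f} bad e fs) ρ p∣c h
  with euclid pr (⟦ f ↑ e ⟧ ρ) (⟦ product fs ⟧ ρ) h
... | inj₂ p∣rest = factor-divides pr fs ρ p∣c p∣rest
... | inj₁ p∣f^e = BadAt.common-divisor bad pr ρ p∣c (euclid-^ pr (⟦ f ⟧ ρ) e (subst (+ p ∣_) (⟦↑⟧ f e ρ) p∣f^e))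

-- Polymorphism in n allows the same family to be taken with its two parameters exchanged or
-- replaced by expressions.
Family : Set
Family = ∀ {n} → Expr n → Expr n → Model n

member : Family → ℤ → ℤ → WModel
member F x y = ⟦ F X Y ⟧ᴹ (x ∷ y ∷ [])

-- This is the part of `Reducible` that passes from a scaled model back to the original one, since
-- scaling up only adds divisors. Odd primes can thus be excluded once per family, whatever u is.
record Additive (p : ℕ) (E : WModel) : Set where
  constructor mkAdditive
  field
    ∣c4   : (+ p) ^ 4 ∣ c4 E
    ∣c6   : (+ p) ^ 6 ∣ c6 E
    ∣disc : (+ p) ^ 12 ∣ disc E

^∣⇒∣ : ∀ p k {x} → (+ p) ^ suc k ∣ x → + p ∣ x
^∣⇒∣ p k h = ∣-trans (∣m⇒∣m*n ((+ p) ^ k) ∣-refl) h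

record BadPrimes (F : Family) (R : ℕ) : Set where
  field
    c4-mod-y  : ∀ {p} → Prime p → ∀ x y → + p ∣ c4 (member F x y) → + p ∣ y → + p ∣ x
    dividing  : ∀ {p} → Prime p → ∀ x y → + p ∣ c4 (member F x y) → + p ∣ disc (member F x y) →
                (+ p ∣ + R) ⊎ (+ p ∣ y)

  coprime⇒∤ : ∀ {p} → Prime p → ∀ {x y} → ¬ (+ p ∣ x × + p ∣ y) → + p ∣ c4 (member F x y) → ¬ + p ∣ y
  coprime⇒∤ pr {x} {y} cop h p∣y = cop (c4-mod-y pr x y h p∣y , p∣y)

  additive : ∀ {p} → Prime p → ∀ {x y} → ¬ (+ p ∣ x × + p ∣ y) → Additive p (member F x y) → + p ∣ + R
  additive {p} pr {x} {y} cop (mkAdditive h4 _ h12) =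
    [ (λ p∣R → p∣R) , (λ p∣y → ⊥-elim (coprime⇒∤ pr {x} {y} cop p∣c4 p∣y)) ]′ (dividing pr x y p∣c4 p∣disc)
    where
    p∣c4 : + p ∣ c4 (member F x y)
    p∣c4 = ^∣⇒∣ p 3 h4
    p∣disc : + p ∣ disc (member F x y)
    p∣disc = ^∣⇒∣ p 11 h12

-- Two facts are certified: c₄ ≡ xᴺ modulo y, so a prime dividing c₄ and y divides x; and Δ = ± κ yᵐ
-- times the product of the listed factors, with σ the sign. Division acts on variable 0, so
-- reducing modulo y requires the family with exchanged parameters, which `swap` identifies with the
-- original.
badPrimes : (F : Family) (R κ k m : ℕ) (σ : Expr 2) (N : ℕ) (fs : Factors R (γ4 (F X Y)))
  (swap : ∀ x y → ⟦ F Y X ⟧ᴹ (y ∷ x ∷ []) ≡ ⟦ F X Y ⟧ᴹ (x ∷ y ∷ []))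
  {_ : T (isZero 2 (add 2 (norm (γ4 (F Y X) ⊖ Y ↑ N))
    (neg 2 (mul 2 (monicQuotient 1 (norm X) (norm (γ4 (F Y X) ⊖ Y ↑ N))) (norm X)))))} →
  {_ : T (isZero 2 (norm (δ (F X Y) ⊖ σ ⊗ (# κ ⊗ Y ↑ m ⊗ product fs))))} →
  {_ : True (κ ℕ.∣? R ℕ.^ k)} → {_ : T (isZero 2 (norm (σ ⊗ σ ⊖ # 1)))} → BadPrimes F R
badPrimes F R κ k m σ N fs swap {division} {factorisation} {κ∣R^} {unit} = record
  { c4-mod-y = λ {p} pr x y p∣c p∣y → euclid-^ pr x N (subst (+ p ∣_) (⟦↑⟧ Y N (y ∷ x ∷ []))
      (∣-subtrahend (c4 (member F x y)) (⟦ Y ↑ N ⟧ (y ∷ x ∷ [])) p∣c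
        (∣-trans p∣y (subst (λ z → y ∣ z - ⟦ Y ↑ N ⟧ (y ∷ x ∷ []))
          (trans (sym (c4-γ4 (F Y X) (y ∷ x ∷ []))) (cong c4 (swap x y)))
          (∣-by-division X (γ4 (F Y X) ⊖ Y ↑ N) {division} (y ∷ x ∷ []))))))
  ; dividing = λ {p} pr x y p∣c p∣d → cases {p} pr x y p∣c p∣d
  }
  where
  cases : ∀ {p} → Prime p → ∀ x y → + p ∣ c4 (member F x y) → + p ∣ disc (member F x y) →
    (+ p ∣ + R) ⊎ (+ p ∣ y)
  cases {p} pr x y p∣c p∣d = split (euclid pr (⟦ # κ ⊗ Y ↑ m ⟧ ρ) (⟦ product fs ⟧ ρ) p∣product)
    where
    ρ = x ∷ y ∷ []
    p∣δ : + p ∣ ⟦ σ ⟧ ρ * (⟦ # κ ⊗ Y ↑ m ⊗ product fs ⟧ ρ)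
    p∣δ = subst (+ p ∣_) (trans (disc-δ (F X Y) ρ)
      (prove (δ (F X Y)) (σ ⊗ (# κ ⊗ Y ↑ m ⊗ product fs)) {factorisation} ρ)) p∣d
    p∣product : + p ∣ ⟦ # κ ⊗ Y ↑ m ⊗ product fs ⟧ ρ
    p∣product = subst (+ p ∣_) (trans (sym (ℤ.*-assoc (⟦ σ ⟧ ρ) (⟦ σ ⟧ ρ) (⟦ # κ ⊗ Y ↑ m ⊗ product fs ⟧ ρ)))
      (trans (cong (_* ⟦ # κ ⊗ Y ↑ m ⊗ product fs ⟧ ρ) (prove (σ ⊗ σ) (# 1) {unit} ρ))
        (ℤ.*-identityˡ _))) (∣n⇒∣m*n (⟦ σ ⟧ ρ) p∣δ)
    split : (+ p ∣ ⟦ # κ ⊗ Y ↑ m ⟧ ρ) ⊎ (+ p ∣ ⟦ product fs ⟧ ρ) → (+ p ∣ + R) ⊎ (+ p ∣ y)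
    split (inj₂ h) = factor-divides pr fs ρ (subst (+ p ∣_) (c4-γ4 (F X Y) ρ) p∣c) h
    split (inj₁ h) =
      [ (λ l → inj₁ (prime-∣-power pr κ R k (toWitness {a? = κ ℕ.∣? R ℕ.^ k} κ∣R^) l))
      , (λ l → inj₂ (euclid-^ pr y m (subst (+ p ∣_) (⟦↑⟧ Y m ρ) l)))
      ]′ (euclid pr (+ κ) (⟦ Y ↑ m ⟧ ρ) h)

-- Criteria for irreducibility at 2.

module _ {u p : ℕ} {E M : WModel} (τ : Transform (+ u) E M) (red : Reducible p M) where
  open Reducible red

  reducible⇒additive : Additive p E
  reducible⇒additive =
    mkAdditive (∣-transform-c4 τ ∣c4) (∣-transform-c6 τ ∣c6) (∣-transform-disc τ ∣disc)

conclude-odd : ∀ {E M u} → Transform (+ u) E M → (∀ {p} → Prime p → p ≢ 2 → ¬ Additive p E) →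
  ¬ Reducible 2 M → Result E u
conclude-odd {E} {M} {u} τ odd even = conclude τ irreducible
  where
  irreducible : ∀ p → Prime p → ¬ Reducible p M
  irreducible p pr red with p ℕ.≟ 2
  ... | yes refl = even red
  ... | no p≢2 = odd pr p≢2 (reducible⇒additive τ red)

-- W agrees with a₁ / u modulo 2; if it is odd, then so is c₄ of the model divided by u.
module _ {n} (u : ℕ) .{{_ : NonZero u}} (M : Model n)
  {h1 : T (divisible u n (norm (Model.α1 M)))}
  {h2 : T (divisible (u ℕ.^ 2) n (norm (Model.α2 M)))}
  {h3 : T (divisible (u ℕ.^ 3) n (norm (Model.α3 M)))}
  {h4 : T (divisible (u ℕ.^ 4) n (norm (Model.α4 M)))}
  {h6 : T (divisible (u ℕ.^ 6) n (norm (Model.α6 M)))}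
  (ρ : Vec ℤ n) where
  scaled : ∃[ N ] (Transform (+ u) (⟦ M ⟧ᴹ ρ) N × + u * a1 N ≡ ⟦ Model.α1 M ⟧ ρ)
  scaled = scale-down u (⟦ M ⟧ᴹ ρ)
    (∣-by-coefficients u (Model.α1 M) {h1} ρ)
    (subst (_∣ ⟦ Model.α2 M ⟧ ρ) (pos-^ u 2) (∣-by-coefficients (u ℕ.^ 2) (Model.α2 M) {h2} ρ))
    (subst (_∣ ⟦ Model.α3 M ⟧ ρ) (pos-^ u 3) (∣-by-coefficients (u ℕ.^ 3) (Model.α3 M) {h3} ρ))
    (subst (_∣ ⟦ Model.α4 M ⟧ ρ) (pos-^ u 4) (∣-by-coefficients (u ℕ.^ 4) (Model.α4 M) {h4} ρ))
    (subst (_∣ ⟦ Model.α6 M ⟧ ρ) (pos-^ u 6) (∣-by-coefficients (u ℕ.^ 6) (Model.α6 M) {h6} ρ))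

  semistable-at-2 : ∀ W {_ : T (divisible (u ℕ.* 2) n (norm (Model.α1 M ⊖ # u ⊗ W)))} →
    ¬ + 2 ∣ ⟦ W ⟧ ρ → (∀ {p} → Prime p → p ≢ 2 → ¬ Additive p (⟦ M ⟧ᴹ ρ)) → Result (⟦ M ⟧ᴹ ρ) u
  semistable-at-2 W {h} odd-W odd = conclude-odd (proj₁ (proj₂ scaled)) odd (λ red → odd-W (2∣W red))
    where
    N = proj₁ scaled
    2∣W : Reducible 2 N → + 2 ∣ ⟦ W ⟧ ρ
    2∣W red = ∣ᵤ⇒∣ (ℕ.*-cancelˡ-∣ u (subst (u ℕ.* 2 ℕ.∣_) (ℤ.abs-* (+ u) (⟦ W ⟧ ρ))
      (∣⇒∣ᵤ (∣-subtrahend (⟦ Model.α1 M ⟧ ρ) (+ u * ⟦ W ⟧ ρ) 2u∣a1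
        (∣-by-coefficients (u ℕ.* 2) (Model.α1 M ⊖ # u ⊗ W) {h} ρ)))))
      where
      2u∣a1 : + (u ℕ.* 2) ∣ ⟦ Model.α1 M ⟧ ρ
      2u∣a1 = subst₂ _∣_ (sym (ℤ.pos-* u 2)) (proj₂ (proj₂ scaled))
        (*-monoʳ-∣ (+ u) (2∣c4⇒2∣a1 N (^∣⇒∣ 2 3 (Reducible.∣c4 red))))

halves : ∀ j d .{{_ : NonZero j}} x → + (j ℕ.* d) ∣ + j * x → + d ∣ x
halves j d x h = ∣ᵤ⇒∣ (ℕ.*-cancelˡ-∣ j (subst (j ℕ.* d ℕ.∣_) (ℤ.abs-* (+ j) x) (∣⇒∣ᵤ h)))

reducible-disc : ∀ {n} u (M : Model n) ρ {N} → Transform (+ u) (⟦ M ⟧ᴹ ρ) N → Reducible 2 N →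
  + (4096 ℕ.* u ℕ.^ 12) ∣ ⟦ δ M ⟧ ρ
reducible-disc u M ρ τ red = subst₂ _∣_
  (trans (ℤ.*-comm ((+ u) ^ 12) (+ 4096)) (trans (cong (+ 4096 *_) (sym (pos-^ u 12))) (sym (ℤ.pos-* 4096 (u ℕ.^ 12)))))
  (trans (transform-disc τ) (disc-δ M ρ)) (*-monoʳ-∣ ((+ u) ^ 12) (Reducible.∣disc red))

-- An odd W fixes the 2-adic valuation of the discriminant of the given model as that of j. Since 2
-- j divides 2¹² u¹², it stays below 12 after division by u¹².
discriminant-at-2 : ∀ {n} u (M : Model n) (W : Expr n) j .{{_ : NonZero j}}
  {_ : True (j ℕ.* 2 ℕ.∣? 4096 ℕ.* u ℕ.^ 12)}
  {_ : T (divisible (j ℕ.* 2) n (norm (δ M ⊖ # j ⊗ W)))} ρ → ¬ + 2 ∣ ⟦ W ⟧ ρ →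
  ∀ {N} → Transform (+ u) (⟦ M ⟧ᴹ ρ) N → ¬ Reducible 2 N
discriminant-at-2 {n} u M W j {small} {h} ρ odd-W {N} τ red = odd-W (halves j 2 (⟦ W ⟧ ρ)
  (∣-subtrahend (⟦ δ M ⟧ ρ) (+ j * ⟦ W ⟧ ρ) 2j∣δ (∣-by-coefficients (j ℕ.* 2) (δ M ⊖ # j ⊗ W) {h} ρ)))
  where
  2j∣δ : + (j ℕ.* 2) ∣ ⟦ δ M ⟧ ρ
  2j∣δ = ∣-trans (∣ᵤ⇒∣ (toWitness {a? = j ℕ.* 2 ℕ.∣? 4096 ℕ.* u ℕ.^ 12} small)) (reducible-disc u M ρ τ red)

kraus-at-2 : ∀ {n} u e .{{_ : NonZero (16 ℕ.* u ℕ.^ 4)}} .{{_ : NonZero (64 ℕ.* u ℕ.^ 6)}}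
  (M : Model n) (V W : Expr n) {_ : True (e ℕ.∣? 16)}
  {_ : T (divisible (16 ℕ.* u ℕ.^ 4 ℕ.* e) n (norm (γ4 M ⊖ # (16 ℕ.* u ℕ.^ 4) ⊗ V)))}
  {_ : T (divisible (64 ℕ.* u ℕ.^ 6 ℕ.* 4) n (norm (γ6 M ⊖ # (64 ℕ.* u ℕ.^ 6) ⊗ W)))} ρ →
  ¬ + e ∣ ⟦ V ⟧ ρ →
  ∀ {N} → Transform (+ u) (⟦ M ⟧ᴹ ρ) N → Reducible 2 N → + 4 ∣ ⟦ W ⟧ ρ - + 3
kraus-at-2 {n} u e M V W {e∣16} {h4} {h6} ρ e∤V {N} τ red = condition (Reducible.kraus red refl)
  where
  j4 = 16 ℕ.* u ℕ.^ 4
  j6 = 64 ℕ.* u ℕ.^ 6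
  weight : ∀ c k x {y z} → y ≡ + c * x → (+ u) ^ k * y ≡ z → z ≡ + (c ℕ.* u ℕ.^ k) * x
  weight c k x refl refl = trans (solve 3 (λ u c x → u ⊗ (c ⊗ x) := c ⊗ u ⊗ x) ((+ u) ^ k) (+ c) x)
    (cong (_* x) (trans (cong (+ c *_) (sym (pos-^ u k))) (sym (ℤ.pos-* c (u ℕ.^ k)))))
  condition : (∃[ x ] ∃[ y ] (c4 N ≡ + 16 * x × c6 N ≡ + 64 * y × Kraus x y)) → + 4 ∣ ⟦ W ⟧ ρ - + 3
  condition (x , y , c4≡ , c6≡ , inj₂ (16∣x , _)) = ⊥-elim (e∤V (halves j4 e (⟦ V ⟧ ρ)
    (∣-subtrahend (⟦ γ4 M ⟧ ρ) (+ j4 * ⟦ V ⟧ ρ)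
      (subst₂ _∣_ (sym (ℤ.pos-* j4 e)) (sym γ4≡)
        (*-monoʳ-∣ (+ j4) (∣-trans (∣ᵤ⇒∣ {+ e} {+ 16} (toWitness {a? = e ℕ.∣? 16} e∣16)) 16∣x)))
      (∣-by-coefficients (j4 ℕ.* e) (γ4 M ⊖ # j4 ⊗ V) {h4} ρ))))
    where
    γ4≡ : ⟦ γ4 M ⟧ ρ ≡ + j4 * x
    γ4≡ = trans (sym (c4-γ4 M ρ)) (weight 16 4 x c4≡
      (trans (solve 2 (λ u c → u ↑ 4 ⊗ c := u ⊗ u ⊗ u ⊗ u ⊗ c) (+ u) (c4 N)) (transform-c4 τ)))
  condition (x , y , c4≡ , c6≡ , inj₁ 4∣y-3) = ∣-shift y (⟦ W ⟧ ρ) 4∣y-3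
    (halves j6 4 (y - ⟦ W ⟧ ρ) (subst (+ (j6 ℕ.* 4) ∣_) γ6-W
      (∣-by-coefficients (j6 ℕ.* 4) (γ6 M ⊖ # j6 ⊗ W) {h6} ρ)))
    where
    γ6≡ : ⟦ γ6 M ⟧ ρ ≡ + j6 * y
    γ6≡ = trans (sym (c6-γ6 M ρ)) (weight 64 6 y c6≡
      (trans (solve 2 (λ u c → u ↑ 6 ⊗ c := u ⊗ u ⊗ u ⊗ u ⊗ u ⊗ u ⊗ c) (+ u) (c6 N)) (transform-c6 τ)))
    γ6-W : ⟦ γ6 M ⟧ ρ - + j6 * ⟦ W ⟧ ρ ≡ + j6 * (y - ⟦ W ⟧ ρ)
    γ6-W = trans (cong (_- + j6 * ⟦ W ⟧ ρ) γ6≡) (factor-out (+ j6) y (⟦ W ⟧ ρ))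
      where
      factor-out : ∀ j y w → j * y - j * w ≡ j * (y - w)
      factor-out = solve 3 λ j y w → j ⊗ y ⊖ j ⊗ w := j ⊗ (y ⊖ w)
    ∣-shift : ∀ y w → + 4 ∣ y - + 3 → + 4 ∣ y - w → + 4 ∣ w - + 3
    ∣-shift y w h k = subst (+ 4 ∣_) (solve 2 (λ y w → (y ⊖ # 3) ⊖ (y ⊖ w) := w ⊖ # 3) y w) (∣m∣n⇒∣m-n h k)

coprime⇒∤both : ∀ {a b p} → Coprime a b → Prime p → ¬ (+ p ∣ a × + p ∣ b)
coprime⇒∤both {a} {b} cop pr (h , k) = prime∤coprime pr {a} {b} cop h k

lower : ∀ p {j k} {_ : True (j ℕ.≤? k)} {x} → (+ p) ^ k ∣ x → (+ p) ^ j ∣ x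
lower p {j} {k} {h} d = ∣-trans (^-monoʳ-∣ (+ p) (toWitness h)) d

3-prime : Prime 3
3-prime = toWitness {a? = prime? 3} tt

5-prime : Prime 5
5-prime = toWitness {a? = prime? 5} tt

7-prime : Prime 7
7-prime = toWitness {a? = prime? 7} tt

prime-∣-2 : ∀ {p} → Prime p → p ≢ 2 → ¬ + p ∣ + 2
prime-∣-2 pr p≢2 h = p≢2 (prime-∣-prime pr 2-prime h)

prime-∣-2q : ∀ {p q} → Prime p → p ≢ 2 → Prime q → + p ∣ + 2 * + q → p ≡ q
prime-∣-2q {p} {q} pr p≢2 qr h = [ (λ k → ⊥-elim (prime-∣-2 pr p≢2 k)) , prime-∣-prime pr qr ]′
  (euclid pr (+ 2) (+ q) h)

-- Symbolic copies of the families and their bad primes.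

module _ {n : ℕ} (a b : Expr n) where
  C5ᴹ C6ᴹ C7ᴹ C8ᴹ C9ᴹ C10ᴹ C12ᴹ C2×C4ᴹ C2×C6ᴹ C2×C8ᴹ : Model n
  private
    m3ᴹ : Expr n → Expr n → Expr n → Model n
    m3ᴹ x y z = model x y z (# 0) (# 0)
  C5ᴹ = m3ᴹ (a ⊖ b) (⊝ (a ⊗ b)) (⊝ (a ⊗ a ⊗ b))
  C6ᴹ = m3ᴹ (a ⊖ b) (⊝ (a ⊗ b) ⊖ b ⊗ b) (⊝ (a ⊗ a ⊗ b) ⊖ a ⊗ b ⊗ b)
  C7ᴹ = m3ᴹ (a ⊗ a ⊕ a ⊗ b ⊖ b ⊗ b) (a ⊗ a ⊗ b ⊗ b ⊖ a ⊗ b ⊗ b ⊗ b)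
            (a ⊗ a ⊗ a ⊗ a ⊗ b ⊗ b ⊖ a ⊗ a ⊗ a ⊗ b ⊗ b ⊗ b)
  C8ᴹ = m3ᴹ (⊝ (a ⊗ a) ⊕ # 4 ⊗ a ⊗ b ⊖ # 2 ⊗ b ⊗ b)
            (⊝ (a ⊗ a ⊗ b ⊗ b) ⊕ # 3 ⊗ a ⊗ b ⊗ b ⊗ b ⊖ # 2 ⊗ b ⊗ b ⊗ b ⊗ b)
            (⊝ (a ⊗ a ⊗ a ⊗ b ⊗ b ⊗ b) ⊕ # 3 ⊗ a ⊗ a ⊗ b ⊗ b ⊗ b ⊗ b ⊖ # 2 ⊗ a ⊗ b ⊗ b ⊗ b ⊗ b ⊗ b)
  C9ᴹ = m3ᴹ (a ⊗ a ⊗ a ⊕ a ⊗ b ⊗ b ⊖ b ⊗ b ⊗ b) A₂ (a ⊗ a ⊗ a ⊗ A₂)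
    where A₂ = a ⊗ a ⊗ a ⊗ a ⊗ b ⊗ b ⊖ # 2 ⊗ a ⊗ a ⊗ a ⊗ b ⊗ b ⊗ b
               ⊕ # 2 ⊗ a ⊗ a ⊗ b ⊗ b ⊗ b ⊗ b ⊖ a ⊗ b ⊗ b ⊗ b ⊗ b ⊗ b
  C10ᴹ = m3ᴹ (a ⊗ a ⊗ a ⊖ # 2 ⊗ a ⊗ a ⊗ b ⊖ # 2 ⊗ a ⊗ b ⊗ b ⊕ # 2 ⊗ b ⊗ b ⊗ b) A₂
             ((a ⊗ a ⊗ a ⊖ # 3 ⊗ a ⊗ a ⊗ b ⊕ a ⊗ b ⊗ b) ⊗ A₂)
    where A₂ = ⊝ (a ⊗ a ⊗ a ⊗ b ⊗ b ⊗ b) ⊕ # 3 ⊗ a ⊗ a ⊗ b ⊗ b ⊗ b ⊗ b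
               ⊖ # 2 ⊗ a ⊗ b ⊗ b ⊗ b ⊗ b ⊗ b
  C12ᴹ = m3ᴹ (⊝ (a ⊗ a ⊗ a ⊗ a) ⊕ # 2 ⊗ a ⊗ a ⊗ a ⊗ b ⊕ # 2 ⊗ a ⊗ a ⊗ b ⊗ b
              ⊖ # 8 ⊗ a ⊗ b ⊗ b ⊗ b ⊕ # 6 ⊗ b ⊗ b ⊗ b ⊗ b) A₂
             (a ⊗ ((b ⊖ a) ⊗ (b ⊖ a) ⊗ (b ⊖ a)) ⊗ A₂)
    where A₂ = b ⊗ (a ⊖ # 2 ⊗ b) ⊗ ((a ⊖ b) ⊗ (a ⊖ b)) ⊗ (a ⊗ a ⊖ # 3 ⊗ a ⊗ b ⊕ # 3 ⊗ b ⊗ b)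
               ⊗ (a ⊗ a ⊖ # 2 ⊗ a ⊗ b ⊕ # 2 ⊗ b ⊗ b)
  C2×C4ᴹ = m3ᴹ a (⊝ (a ⊗ b) ⊖ # 4 ⊗ b ⊗ b) (⊝ (a ⊗ a ⊗ b) ⊖ # 4 ⊗ a ⊗ b ⊗ b)
  C2×C6ᴹ = m3ᴹ (⊝ (# 19 ⊗ a ⊗ a) ⊕ # 2 ⊗ a ⊗ b ⊕ b ⊗ b)
               (⊝ (# 10 ⊗ a ⊗ a ⊗ a ⊗ a) ⊕ # 22 ⊗ a ⊗ a ⊗ a ⊗ b ⊖ # 14 ⊗ a ⊗ a ⊗ b ⊗ b
                ⊕ # 2 ⊗ a ⊗ b ⊗ b ⊗ b)
               (# 90 ⊗ a ⊗ a ⊗ a ⊗ a ⊗ a ⊗ a ⊖ # 198 ⊗ a ⊗ a ⊗ a ⊗ a ⊗ a ⊗ b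
                ⊕ # 116 ⊗ a ⊗ a ⊗ a ⊗ a ⊗ b ⊗ b ⊕ # 4 ⊗ a ⊗ a ⊗ a ⊗ b ⊗ b ⊗ b
                ⊖ # 14 ⊗ a ⊗ a ⊗ b ⊗ b ⊗ b ⊗ b ⊕ # 2 ⊗ a ⊗ b ⊗ b ⊗ b ⊗ b ⊗ b)
  C2×C8ᴹ = m3ᴹ (⊝ (a ⊗ a ⊗ a ⊗ a) ⊖ # 8 ⊗ a ⊗ a ⊗ a ⊗ b ⊖ # 24 ⊗ a ⊗ a ⊗ b ⊗ b ⊕ # 64 ⊗ b ⊗ b ⊗ b ⊗ b)
               A₂ (⊝ (# 2 ⊗ b ⊗ (a ⊕ # 4 ⊗ b) ⊗ (a ⊗ a ⊖ # 8 ⊗ b ⊗ b)) ⊗ A₂)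
    where A₂ = ⊝ (# 4 ⊗ a ⊗ b ⊗ b ⊗ (a ⊕ # 2 ⊗ b) ⊗ ((a ⊕ # 4 ⊗ b) ⊗ (a ⊕ # 4 ⊗ b))
                  ⊗ (a ⊗ a ⊕ # 4 ⊗ a ⊗ b ⊕ # 8 ⊗ b ⊗ b))

-- The prime 5 comes from the quadratic factor, which has discriminant 5³ and is (X - 2 Y)² modulo
-- 5.
C5-badPrimes : BadPrimes C5ᴹ 5
C5-badPrimes = badPrimes C5ᴹ 5 1 0 5 (⊝ # 1) 4
  ( badAt X (# 1) 1 0 4 ^ᶠ 5 ∷
    badAt (X ↑ 2 ⊕ # 11 ⊗ X ⊗ Y ⊖ Y ↑ 2) (# 11 ⊗ X ⊕ # 122 ⊗ Y) 5 1 5 ^ᶠ 1 ∷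
    [])
  (λ _ _ → refl)

C6-badPrimes : BadPrimes C6ᴹ 6
C6-badPrimes = badPrimes C6ᴹ 6 1 0 6 (# 1) 4
  ( badAt X (# 1) 9 2 4 ^ᶠ 2 ∷
    badAt (X ⊕ Y) (# 1) 16 4 4 ^ᶠ 3 ∷
    badAt (X ⊕ # 9 ⊗ Y) (# 1) 144 4 4 ^ᶠ 1 ∷
    [])
  (λ _ _ → refl)

C7-badPrimes : BadPrimes C7ᴹ 7
C7-badPrimes = badPrimes C7ᴹ 7 1 0 7 (⊝ # 1) 8
  ( badAt (X ⊖ Y) (# 1) 1 0 8 ^ᶠ 7 ∷
    badAt X (# 1) 1 0 8 ^ᶠ 7 ∷
    badAt (X ↑ 3 ⊕ # 5 ⊗ X ↑ 2 ⊗ Y ⊖ # 8 ⊗ X ⊗ Y ↑ 2 ⊕ Y ↑ 3) (⊝ (# 444 ⊗ X ↑ 2) ⊖ # 2117 ⊗ X ⊗ Y ⊕ # 4271 ⊗ Y ↑ 2) 49 2 10 ^ᶠ 1 ∷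
    [])
  (λ _ _ → refl)

C8-badPrimes : BadPrimes C8ᴹ 2
C8-badPrimes = badPrimes C8ᴹ 2 1 0 8 (# 1) 8
  ( badAt (X ⊖ # 2 ⊗ Y) (# 1) 16 4 8 ^ᶠ 4 ∷
    badAt (X ⊖ Y) (# 1) 1 0 8 ^ᶠ 8 ∷
    badAt X (# 1) 16 4 8 ^ᶠ 2 ∷
    badAt (X ↑ 2 ⊖ # 8 ⊗ X ⊗ Y ⊕ # 8 ⊗ Y ↑ 2) (⊝ (# 204 ⊗ X) ⊕ # 1393 ⊗ Y) 16 4 9 ^ᶠ 1 ∷
    [])
  (λ _ _ → refl)

C9-badPrimes : BadPrimes C9ᴹ 3
C9-badPrimes = badPrimes C9ᴹ 3 1 0 9 (⊝ # 1) 12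
  ( badAt (X ⊖ Y) (# 1) 1 0 12 ^ᶠ 9 ∷
    badAt X (# 1) 1 0 12 ^ᶠ 9 ∷
    badAt (X ↑ 2 ⊖ X ⊗ Y ⊕ Y ↑ 2) (X ⊖ Y) 9 2 13 ^ᶠ 3 ∷
    badAt (X ↑ 3 ⊕ # 3 ⊗ X ↑ 2 ⊗ Y ⊖ # 6 ⊗ X ⊗ Y ↑ 2 ⊕ Y ↑ 3) (⊝ (# 377 ⊗ X ↑ 2) ⊖ # 1171 ⊗ X ⊗ Y ⊕ # 2171 ⊗ Y ↑ 2) 9 2 14 ^ᶠ 1 ∷
    [])
  (λ _ _ → refl)

C10-badPrimes : BadPrimes C10ᴹ 10
C10-badPrimes = badPrimes C10ᴹ 10 1 0 10 (# 1) 12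
  ( badAt (X ⊖ # 2 ⊗ Y) (# 1) 16 4 12 ^ᶠ 5 ∷
    badAt (X ⊖ Y) (# 1) 1 0 12 ^ᶠ 10 ∷
    badAt X (# 1) 16 4 12 ^ᶠ 5 ∷
    badAt (X ↑ 2 ⊕ # 2 ⊗ X ⊗ Y ⊖ # 4 ⊗ Y ↑ 2) (# 1292 ⊗ X ⊕ # 4181 ⊗ Y) 80 4 13 ^ᶠ 1 ∷
    badAt (X ↑ 2 ⊖ # 3 ⊗ X ⊗ Y ⊕ Y ↑ 2) (⊝ (# 8 ⊗ X) ⊕ # 21 ⊗ Y) 5 1 13 ^ᶠ 2 ∷
    [])
  (λ _ _ → refl)

C12-badPrimes : BadPrimes C12ᴹ 6
C12-badPrimes = badPrimes C12ᴹ 6 1 0 12 (# 1) 16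
  ( badAt (X ⊖ # 2 ⊗ Y) (# 1) 16 4 16 ^ᶠ 6 ∷
    badAt (X ⊖ Y) (# 1) 1 0 16 ^ᶠ 12 ∷
    badAt X (# 1) 144 4 16 ^ᶠ 2 ∷
    badAt (X ↑ 2 ⊖ # 2 ⊗ X ⊗ Y ⊕ # 2 ⊗ Y ↑ 2) Y 16 4 17 ^ᶠ 3 ∷
    badAt (X ↑ 2 ⊖ # 3 ⊗ X ⊗ Y ⊕ # 3 ⊗ Y ↑ 2) (⊝ X ⊕ Y) 9 2 17 ^ᶠ 4 ∷
    badAt (X ↑ 2 ⊖ # 6 ⊗ X ⊗ Y ⊕ # 6 ⊗ Y ↑ 2) (⊝ (# 10864 ⊗ X) ⊕ # 51409 ⊗ Y) 144 4 17 ^ᶠ 1 ∷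
    [])
  (λ _ _ → refl)

C2×C4-badPrimes : BadPrimes C2×C4ᴹ 2
C2×C4-badPrimes = badPrimes C2×C4ᴹ 2 1 0 4 (# 1) 4
  ( badAt X (# 1) 256 8 4 ^ᶠ 2 ∷
    badAt (X ⊕ # 4 ⊗ Y) (# 1) 256 8 4 ^ᶠ 4 ∷
    badAt (X ⊕ # 8 ⊗ Y) (# 1) 256 8 4 ^ᶠ 2 ∷
    [])
  (λ _ _ → refl)

-- The factors of this discriminant are monic in b but not in a.
C2×C6-badPrimes : BadPrimes (λ b a → C2×C6ᴹ a b) 6
C2×C6-badPrimes = badPrimes (λ b a → C2×C6ᴹ a b) 6 64 6 6 (# 1) 8
  ( badAt (X ⊖ # 9 ⊗ Y) (# 1) 589824 16 8 ^ᶠ 2 ∷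
    badAt (X ⊖ # 5 ⊗ Y) (# 1) 65536 16 8 ^ᶠ 6 ∷
    badAt (X ⊖ # 3 ⊗ Y) (# 1) 2304 8 8 ^ᶠ 2 ∷
    badAt (X ⊖ Y) (# 1) 65536 16 8 ^ᶠ 6 ∷
    badAt (X ⊕ # 3 ⊗ Y) (# 1) 589824 16 8 ^ᶠ 2 ∷
    [])
  (λ _ _ → refl)

C2×C8-badPrimes : BadPrimes C2×C8ᴹ 2
C2×C8-badPrimes = badPrimes C2×C8ᴹ 2 256 8 8 (# 1) 16
  ( badAt X (# 1) 16777216 24 16 ^ᶠ 8 ∷
    badAt (X ⊕ # 2 ⊗ Y) (# 1) 65536 16 16 ^ᶠ 8 ∷
    badAt (X ⊕ # 4 ⊗ Y) (# 1) 16777216 24 16 ^ᶠ 8 ∷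
    badAt (X ↑ 2 ⊖ # 8 ⊗ Y ↑ 2) (⊝ (# 204 ⊗ X) ⊕ # 577 ⊗ Y) 16777216 24 17 ^ᶠ 2 ∷
    badAt (X ↑ 2 ⊕ # 4 ⊗ X ⊗ Y ⊕ # 8 ⊗ Y ↑ 2) Y 16777216 24 17 ^ᶠ 4 ∷
    badAt (X ↑ 2 ⊕ # 8 ⊗ X ⊗ Y ⊕ # 8 ⊗ Y ↑ 2) (# 204 ⊗ X ⊕ # 1393 ⊗ Y) 16777216 24 17 ^ᶠ 2 ∷
    [])
  (λ _ _ → refl)

-- The families with two parameters and torsion of order at least 5, and C₂ × C₄

module _ {F : Family} {R : ℕ} (bad : BadPrimes F R) (a b : ℤ) (cop : Coprime a b) where
  private
    both : ∀ {p} → Prime p → ¬ (+ p ∣ a × + p ∣ b)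
    both pr = coprime⇒∤both {a} {b} cop pr

  additive-∣ : ∀ {p} → Prime p → Additive p (member F a b) → + p ∣ + R
  additive-∣ pr = BadPrimes.additive bad pr {a} {b} (both pr)

  additive-∤ : ∀ {p} → Prime p → Additive p (member F a b) → ¬ + p ∣ b
  additive-∤ {p} pr add = BadPrimes.coprime⇒∤ bad pr {a} {b} (both pr) (^∣⇒∣ p 3 (Additive.∣c4 add))

module _ (F : Family) (a b : ℤ) where
  private
    ρ : Vec ℤ 2
    ρ = a ∷ b ∷ []

  additive-c4 : ∀ {p} → Additive p (member F a b) → ∀ k {_ : True (k ℕ.≤? 4)} →
    (+ p) ^ k ∣ ⟦ γ4 (F X Y) ⟧ ρ
  additive-c4 {p} add k {h} = subst ((+ p) ^ k ∣_) (c4-γ4 (F X Y) ρ) (lower p {k} {4} {h} (Additive.∣c4 add))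

  additive-c6 : ∀ {p} → Additive p (member F a b) → ∀ k {_ : True (k ℕ.≤? 6)} →
    (+ p) ^ k ∣ ⟦ γ6 (F X Y) ⟧ ρ
  additive-c6 {p} add k {h} = subst ((+ p) ^ k ∣_) (c6-γ6 (F X Y) ρ) (lower p {k} {6} {h} (Additive.∣c6 add))

  additive-disc : ∀ {p} → Additive p (member F a b) → ∀ k {_ : True (k ℕ.≤? 12)} →
    (+ p) ^ k ∣ ⟦ δ (F X Y) ⟧ ρ
  additive-disc {p} add k {h} =
    subst ((+ p) ^ k ∣_) (disc-δ (F X Y) ρ) (lower p {k} {12} {h} (Additive.∣disc add))


C5-additive : ∀ {a b} → Coprime a b → ∀ {p} → Prime p → ¬ Additive p (member C5ᴹ a b)
C5-additive {a} {b} cop pr add = at-5 pr (prime-∣-prime pr 5-prime (additive-∣ C5-badPrimes a b cop pr add)) add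
  where
  at-5 : ∀ {p} → Prime p → p ≡ 5 → ¬ Additive p (member C5ᴹ a b)
  at-5 pr refl add = no-residue 25 (5 ∤ᴱ Y ∷ 25 ∣ᴱ γ4 (C5ᴹ X Y) ∷ []) (a ∷ b ∷ [])
    (additive-∤ C5-badPrimes a b cop pr add ∷ additive-c4 C5ᴹ a b add 2 ∷ [])

-- At 3, c₄ ≡ a⁴ gives 3 ∣ a. Then 81 ∣ Δ = a² b⁶ (a + b)³ (a + 9 b) forces 9 ∣ a, and c₄ ≡ 9 b⁴
-- modulo 27 is a contradiction.
C6-additive : ∀ {a b} → Coprime a b → ∀ {p} → Prime p → p ≢ 2 → ¬ Additive p (member C6ᴹ a b)
C6-additive {a} {b} cop pr p≢2 add =
  at-3 pr (prime-∣-2q pr p≢2 3-prime (additive-∣ C6-badPrimes a b cop pr add)) add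
  where
  at-3 : ∀ {p} → Prime p → p ≡ 3 → ¬ Additive p (member C6ᴹ a b)
  at-3 pr refl add = no-residue 81
    (3 ∤ᴱ Y ∷ 3 ∣ᴱ X ∷ 81 ∣ᴱ γ4 (C6ᴹ X Y) ∷ 81 ∣ᴱ δ (C6ᴹ X Y) ∷ []) (a ∷ b ∷ [])
    (3∤b ∷ 3∣a ∷ additive-c4 C6ᴹ a b add 4 ∷ additive-disc C6ᴹ a b add 4 ∷ [])
    where
    3∤b = additive-∤ C6-badPrimes a b cop pr add
    3∣a : + 3 ∣ a
    3∣a with + 3 ∣? a
    ... | yes h = h
    ... | no h = ⊥-elim (no-residue 3 (3 ∤ᴱ Y ∷ 3 ∤ᴱ X ∷ 3 ∣ᴱ γ4 (C6ᴹ X Y) ∷ 3 ∣ᴱ δ (C6ᴹ X Y) ∷ []) (a ∷ b ∷ [])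
      (3∤b ∷ h ∷ additive-c4 C6ᴹ a b add 1 ∷ additive-disc C6ᴹ a b add 1 ∷ []))

C7-additive : ∀ {a b} → Coprime a b → ∀ {p} → Prime p → ¬ Additive p (member C7ᴹ a b)
C7-additive {a} {b} cop pr add = at-7 pr (prime-∣-prime pr 7-prime (additive-∣ C7-badPrimes a b cop pr add)) add
  where
  at-7 : ∀ {p} → Prime p → p ≡ 7 → ¬ Additive p (member C7ᴹ a b)
  at-7 pr refl add = no-residue 49 (7 ∤ᴱ Y ∷ 7 ∣ᴱ γ4 (C7ᴹ X Y) ∷ 49 ∣ᴱ γ6 (C7ᴹ X Y) ∷ []) (a ∷ b ∷ [])
    (additive-∤ C7-badPrimes a b cop pr add ∷ additive-c4 C7ᴹ a b add 1 ∷ additive-c6 C7ᴹ a b add 2 ∷ [])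

C8-additive : ∀ {a b} → Coprime a b → ∀ {p} → Prime p → p ≢ 2 → ¬ Additive p (member C8ᴹ a b)
C8-additive {a} {b} cop pr p≢2 add = prime-∣-2 pr p≢2 (additive-∣ C8-badPrimes a b cop pr add)

C9-additive : ∀ {a b} → Coprime a b → ∀ {p} → Prime p → ¬ Additive p (member C9ᴹ a b)
C9-additive {a} {b} cop pr add = at-3 pr (prime-∣-prime pr 3-prime (additive-∣ C9-badPrimes a b cop pr add)) add
  where
  at-3 : ∀ {p} → Prime p → p ≡ 3 → ¬ Additive p (member C9ᴹ a b)
  at-3 pr refl add = no-residue 27 (3 ∤ᴱ Y ∷ 27 ∣ᴱ γ4 (C9ᴹ X Y) ∷ []) (a ∷ b ∷ [])
    (additive-∤ C9-badPrimes a b cop pr add ∷ additive-c4 C9ᴹ a b add 3 ∷ [])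

C10-additive : ∀ {a b} → Coprime a b → ∀ {p} → Prime p → p ≢ 2 → ¬ Additive p (member C10ᴹ a b)
C10-additive {a} {b} cop pr p≢2 add =
  at-5 pr (prime-∣-2q pr p≢2 5-prime (additive-∣ C10-badPrimes a b cop pr add)) add
  where
  at-5 : ∀ {p} → Prime p → p ≡ 5 → ¬ Additive p (member C10ᴹ a b)
  at-5 pr refl add = no-residue 25 (5 ∤ᴱ Y ∷ 25 ∣ᴱ γ4 (C10ᴹ X Y) ∷ []) (a ∷ b ∷ [])
    (additive-∤ C10-badPrimes a b cop pr add ∷ additive-c4 C10ᴹ a b add 2 ∷ [])

C12-additive : ∀ {a b} → Coprime a b → ∀ {p} → Prime p → p ≢ 2 → ¬ Additive p (member C12ᴹ a b)
C12-additive {a} {b} cop pr p≢2 add =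
  at-3 pr (prime-∣-2q pr p≢2 3-prime (additive-∣ C12-badPrimes a b cop pr add)) add
  where
  at-3 : ∀ {p} → Prime p → p ≡ 3 → ¬ Additive p (member C12ᴹ a b)
  at-3 pr refl add = no-residue 27 (3 ∤ᴱ Y ∷ 27 ∣ᴱ γ4 (C12ᴹ X Y) ∷ []) (a ∷ b ∷ [])
    (additive-∤ C12-badPrimes a b cop pr add ∷ additive-c4 C12ᴹ a b add 3 ∷ [])

C2×C4-additive : ∀ {a b} → Coprime a b → ∀ {p} → Prime p → p ≢ 2 → ¬ Additive p (member C2×C4ᴹ a b)
C2×C4-additive {a} {b} cop pr p≢2 add = prime-∣-2 pr p≢2 (additive-∣ C2×C4-badPrimes a b cop pr add)

C2×C6-additive : ∀ {a b} → Coprime b a → ∀ {p} → Prime p → p ≢ 2 →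
  ¬ Additive p (member (λ b a → C2×C6ᴹ a b) b a)
C2×C6-additive {a} {b} cop pr p≢2 add =
  at-3 pr (prime-∣-2q pr p≢2 3-prime (additive-∣ C2×C6-badPrimes b a cop pr add)) add
  where
  at-3 : ∀ {p} → Prime p → p ≡ 3 → ¬ Additive p (member (λ b a → C2×C6ᴹ a b) b a)
  at-3 pr refl add = no-residue 27 (3 ∤ᴱ Y ∷ 27 ∣ᴱ γ4 (C2×C6ᴹ Y X) ∷ []) (b ∷ a ∷ [])
    (additive-∤ C2×C6-badPrimes b a cop pr add ∷ additive-c4 (λ b a → C2×C6ᴹ a b) b a add 3 ∷ [])

C2×C8-additive : ∀ {a b} → Coprime a b → ∀ {p} → Prime p → p ≢ 2 → ¬ Additive p (member C2×C8ᴹ a b)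
C2×C8-additive {a} {b} cop pr p≢2 add = prime-∣-2 pr p≢2 (additive-∣ C2×C8-badPrimes a b cop pr add)

-- An equation such as a + b ≡ 8 k cannot be matched with `refl`. Once solved for a, it is matched
-- here, and coprimality is restated for the new expression.
specialise : ∀ {a a′ b} (E : ℤ → WModel) {u} → a ≡ a′ → Coprime a b →
  (Coprime a′ b → Result (E a′) u) → Result (E a) u
specialise E refl cop f = f cop

by-quotient : ∀ {a k} → + k ∣ a → ∃[ q ] a ≡ + k * q
by-quotient {k = k} (divides q eq) = q , trans eq (ℤ.*-comm q (+ k))

sum≡⇒ : ∀ {a c d} → a + c ≡ d → a ≡ d - c
sum≡⇒ {a} {c} refl = solve 2 (λ a c → a := (a ⊕ c) ⊖ c) a c

difference≡⇒ : ∀ {a c d} → a - c ≡ d → a ≡ d + c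
difference≡⇒ {a} {c} refl = solve 2 (λ a c → a := (a ⊖ c) ⊕ c) a c

2∤^ : ∀ {n} (e : Expr n) k ρ → ¬ + 2 ∣ ⟦ e ⟧ ρ → ¬ + 2 ∣ ⟦ e ↑ k ⟧ ρ
2∤^ e k ρ odd h = odd (euclid-^ 2-prime (⟦ e ⟧ ρ) k (subst (+ 2 ∣_) (⟦↑⟧ e k ρ) h))

2∤* : ∀ x y → ¬ + 2 ∣ x → ¬ + 2 ∣ y → ¬ + 2 ∣ x * y
2∤* x y odd-x odd-y h = [ odd-x , odd-y ]′ (euclid 2-prime x y h)

even⇒odd : ∀ {a b} → Coprime a b → + 2 ∣ a → ¬ + 2 ∣ b
even⇒odd {a} {b} cop = prime∤coprime 2-prime {a} {b} cop

2∣ : ∀ k x → + 2 ∣ + (k ℕ.* 2) * x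
2∣ k x = ∣m⇒∣m*n x (subst (+ 2 ∣_) (sym (ℤ.pos-* k 2)) (∣n⇒∣m*n (+ k) ∣-refl))

-- When a + b is odd, so is a₁. When v₂(a + b) is 1 or 2, Δ = a² b⁶ (a + b)³ (a + 9 b) has valuation
-- 4 or 8. From 3 on, dividing by 2 makes a₁ odd.
C6-result : ∀ a b → Coprime a b → ∀ u → U C6 (a , b) u → Result (ET C6 (a , b)) u
C6-result a b cop u (inj₁ (8∣ , refl)) with by-quotient {a + b} {8} (∣ᵤ⇒∣ 8∣)
... | k , eq = specialise {b = b} (λ a → ET C6 (a , b)) (sum≡⇒ {a} {b} eq) cop λ cop′ →
  semistable-at-2 2 (C6ᴹ (# 8 ⊗ X ⊖ Y) Y) (k ∷ b ∷ []) Y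
    (λ h → even⇒odd {+ 8 * k - b} {b} cop′ (∣m∣n⇒∣m-n (2∣ 4 k) h) h) (C6-additive {+ 8 * k - b} {b} cop′)
C6-result a b cop u (inj₂ (8∤ , refl)) with + 2 ∣? a + b
... | no odd = semistable-at-2 1 (C6ᴹ X Y) (a ∷ b ∷ []) (X ⊕ Y) odd (C6-additive {a} {b} cop)
... | yes 2∣a+b with by-quotient {a + b} {2} 2∣a+b
...   | s , eq = specialise {b = b} (λ a → ET C6 (a , b)) (sum≡⇒ {a} {b} eq) cop λ cop′ → even s cop′
    (λ 4∣s → 8∤ (∣⇒∣ᵤ (subst (+ 8 ∣_) (sym eq) (*-monoʳ-∣ (+ 2) 4∣s))))
  where
  even : ∀ s → Coprime (+ 2 * s - b) b → ¬ + 4 ∣ s → Result (ET C6 (+ 2 * s - b , b)) 1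
  even s cop′ 4∤s with + 2 ∣? s
  ... | no odd-s = conclude-odd (identity _) (C6-additive {+ 2 * s - b} {b} cop′)
      (discriminant-at-2 1 (C6ᴹ (# 2 ⊗ X ⊖ Y) Y) (Y ↑ 8 ⊗ X ↑ 4) 16 ρ
        (2∤* (⟦ Y ↑ 8 ⟧ ρ) (⟦ X ↑ 4 ⟧ ρ) (2∤^ Y 8 ρ odd-b) (2∤^ X 4 ρ odd-s)) (identity _))
    where
    ρ : Vec ℤ 2
    ρ = s ∷ b ∷ []
    odd-b : ¬ + 2 ∣ b
    odd-b h = even⇒odd {+ 2 * s - b} {b} cop′ (∣m∣n⇒∣m-n (2∣ 1 s) h) h
  ... | yes 2∣s with by-quotient {s} {2} 2∣s
  ...   | t , refl = conclude-odd (identity _) (C6-additive {+ 2 * (+ 2 * t) - b} {b} cop′)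
      (discriminant-at-2 1 (C6ᴹ (# 2 ⊗ (# 2 ⊗ X) ⊖ Y) Y) (Y ↑ 8 ⊗ X ↑ 4) 256 ρ
        (2∤* (⟦ Y ↑ 8 ⟧ ρ) (⟦ X ↑ 4 ⟧ ρ) (2∤^ Y 8 ρ odd-b) (2∤^ X 4 ρ odd-t)) (identity _))
    where
    ρ : Vec ℤ 2
    ρ = t ∷ b ∷ []
    odd-b : ¬ + 2 ∣ b
    odd-b h = even⇒odd {+ 2 * (+ 2 * t) - b} {b} cop′ (∣m∣n⇒∣m-n (2∣ 1 (+ 2 * t)) h) h
    odd-t : ¬ + 2 ∣ t
    odd-t h = 4∤s (*-monoʳ-∣ (+ 2) h)

C5-result : ∀ a b → Coprime a b → Result (ET C5 (a , b)) 1
C5-result a b cop = conclude (identity _) λ p pr red →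
  C5-additive {a} {b} cop pr (reducible⇒additive (identity _) red)

C7-result : ∀ a b → Coprime a b → Result (ET C7 (a , b)) 1
C7-result a b cop = conclude (identity _) λ p pr red →
  C7-additive {a} {b} cop pr (reducible⇒additive (identity _) red)

C9-result : ∀ a b → Coprime a b → Result (ET C9 (a , b)) 1
C9-result a b cop = conclude (identity _) λ p pr red →
  C9-additive {a} {b} cop pr (reducible⇒additive (identity _) red)

-- If v₂(a) = 1, then a / 2 and b are both odd, which permits the substitution a = 4 j + 2 b. If 4 ∣
-- a, then c₄ / 16 is odd and c₆ / 64 ≡ b¹² ≡ 1 mod 4, against Kraus's condition.
C8-result : ∀ a b → Coprime a b → ∀ u → U C8 (a , b) u → Result (ET C8 (a , b)) u
C8-result a b cop u (inj₁ ((2∣ , 4∤) , refl)) with + 4 ∣? a - + 2 * b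
... | no 4∤a-2b = ⊥-elim (no-residue 4 (2 ∤ᴱ Y ∷ 2 ∣ᴱ X ∷ 4 ∤ᴱ X ∷ 4 ∤ᴱ X ⊖ # 2 ⊗ Y ∷ []) (a ∷ b ∷ [])
  (even⇒odd {a} {b} cop (∣ᵤ⇒∣ 2∣) ∷ ∣ᵤ⇒∣ 2∣ ∷ (λ h → 4∤ (∣⇒∣ᵤ h)) ∷ 4∤a-2b ∷ []))
... | yes 4∣a-2b with by-quotient {a - + 2 * b} {4} 4∣a-2b
...   | j , eq = specialise {b = b} (λ a → ET C8 (a , b)) (difference≡⇒ {a} {+ 2 * b} eq) cop λ cop′ →
  semistable-at-2 2 (C8ᴹ (# 4 ⊗ X ⊕ # 2 ⊗ Y) Y) (j ∷ b ∷ []) (Y ↑ 2)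
    (2∤^ Y 2 (j ∷ b ∷ []) (even⇒odd {a} {b} cop (∣ᵤ⇒∣ 2∣))) (C8-additive {+ 4 * j + + 2 * b} {b} cop′)
C8-result a b cop u (inj₂ (¬v , refl)) with + 2 ∣? a
... | no odd-a = semistable-at-2 1 (C8ᴹ X Y) (a ∷ b ∷ []) (X ↑ 2) (2∤^ X 2 (a ∷ b ∷ []) odd-a)
  (C8-additive {a} {b} cop)
... | yes 2∣a with + 4 ∣? a
...   | no 4∤a = ⊥-elim (¬v (∣⇒∣ᵤ 2∣a , λ h → 4∤a (∣ᵤ⇒∣ h)))
...   | yes 4∣a with by-quotient {a} {4} 4∣a
...     | k , refl = conclude-odd (identity _) (C8-additive {+ 4 * k} {b} cop)
  (λ red → no-residue 4 (2 ∤ᴱ Y ∷ 4 ∣ᴱ Y ↑ 12 ⊖ # 3 ∷ []) ρ (odd-b ∷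
    kraus-at-2 1 2 (C8ᴹ (# 4 ⊗ X) Y) (Y ↑ 8) (Y ↑ 12) ρ (2∤^ Y 8 ρ odd-b) (identity _) red ∷ []))
  where
  ρ : Vec ℤ 2
  ρ = k ∷ b ∷ []
  odd-b : ¬ + 2 ∣ b
  odd-b = even⇒odd {+ 4 * k} {b} cop 2∣a

C10-result : ∀ a b → Coprime a b → ∀ u → U C10 (a , b) u → Result (ET C10 (a , b)) u
C10-result a b cop u (inj₁ (2∣ , refl)) with by-quotient {a} {2} (∣ᵤ⇒∣ 2∣)
... | k , refl = semistable-at-2 2 (C10ᴹ (# 2 ⊗ X) Y) (k ∷ b ∷ []) (Y ↑ 3)
  (2∤^ Y 3 (k ∷ b ∷ []) (even⇒odd {+ 2 * k} {b} cop (∣ᵤ⇒∣ 2∣))) (C10-additive {+ 2 * k} {b} cop)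
C10-result a b cop u (inj₂ (2∤ , refl)) = semistable-at-2 1 (C10ᴹ X Y) (a ∷ b ∷ []) (X ↑ 3)
  (2∤^ X 3 (a ∷ b ∷ []) (λ h → 2∤ (∣⇒∣ᵤ h))) (C10-additive {a} {b} cop)

C12-result : ∀ a b → Coprime a b → ∀ u → U C12 (a , b) u → Result (ET C12 (a , b)) u
C12-result a b cop u (inj₁ (2∣ , refl)) with by-quotient {a} {2} (∣ᵤ⇒∣ 2∣)
... | k , refl = semistable-at-2 2 (C12ᴹ (# 2 ⊗ X) Y) (k ∷ b ∷ []) (Y ↑ 4)
  (2∤^ Y 4 (k ∷ b ∷ []) (even⇒odd {+ 2 * k} {b} cop (∣ᵤ⇒∣ 2∣))) (C12-additive {+ 2 * k} {b} cop)
C12-result a b cop u (inj₂ (2∤ , refl)) = semistable-at-2 1 (C12ᴹ X Y) (a ∷ b ∷ []) (X ↑ 4)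
  (2∤^ X 4 (a ∷ b ∷ []) (λ h → 2∤ (∣⇒∣ᵤ h))) (C12-additive {a} {b} cop)

-- The discriminant is a² b⁴ (a + 4 b)⁴ (a + 8 b)². For u = 2, put a = 4 k: an even k is settled by
-- c₆, an odd k by the valuation of Δ.
C2×C4-result : ∀ a b → Coprime a b → ∀ u → U C2×C4 (a , b) u → Result (ET C2×C4 (a , b)) u
C2×C4-result a b cop u (inj₁ ((4∣ , _) , 16∣ , refl)) with by-quotient {a + + 4 * b} {16} (∣ᵤ⇒∣ 16∣)
... | k , eq = specialise {b = b} (λ a → ET C2×C4 (a , b)) (sum≡⇒ {a} {+ 4 * b} eq) cop λ cop′ →
  semistable-at-2 4 (C2×C4ᴹ (# 16 ⊗ X ⊖ # 4 ⊗ Y) Y) (k ∷ b ∷ []) Y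
    (even⇒odd {a} {b} cop (∣-trans (divides (+ 2) refl) (∣ᵤ⇒∣ {+ 4} 4∣)))
    (C2×C4-additive {+ 16 * k - + 4 * b} {b} cop′)
C2×C4-result a b cop u (inj₂ (inj₁ (4∣ , 16∤ , refl))) with by-quotient {a} {4} (∣ᵤ⇒∣ 4∣)
... | k , refl = main (+ 2 ∣? k)
  where
  odd-b : ¬ + 2 ∣ b
  odd-b = even⇒odd {+ 4 * k} {b} cop (2∣ 2 k)

  even-k : ∀ j → Coprime (+ 4 * (+ 2 * j)) b → Result (ET C2×C4 (+ 4 * (+ 2 * j) , b)) 2
  even-k j cop′ = conclude-odd τ (C2×C4-additive {+ 4 * (+ 2 * j)} {b} cop′)
    (λ red → no-residue 4 (2 ∤ᴱ Y ∷ 4 ∣ᴱ W ⊖ # 3 ∷ []) ρ (odd-b ∷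
      kraus-at-2 2 2 (C2×C4ᴹ (# 4 ⊗ (# 2 ⊗ X)) Y) (Y ↑ 4) W ρ (2∤^ Y 4 ρ odd-b) τ red ∷ []))
    where
    ρ : Vec ℤ 2
    ρ = j ∷ b ∷ []
    -- For odd b this is 1 + 2 j (j + 1) ≡ 1 modulo 4, never 3.
    W : Expr 2
    W = Y ↑ 6 ⊕ # 2 ⊗ X ⊗ Y ↑ 5 ⊕ # 2 ⊗ X ↑ 2 ⊗ Y ↑ 4
    τ = proj₁ (proj₂ (scaled 2 (C2×C4ᴹ (# 4 ⊗ (# 2 ⊗ X)) Y) ρ))

  odd-k : ∀ l → + 4 * k ≡ + 4 * (+ 2 * l - b) → Coprime (+ 4 * (+ 2 * l - b)) b → Result (ET C2×C4 (+ 4 * (+ 2 * l - b) , b)) 2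
  odd-k l eq cop′ = conclude-odd τ (C2×C4-additive {+ 4 * (+ 2 * l - b)} {b} cop′)
    -- Here a + 4 b = 8 l with l odd, so Δ has valuation 4 + 12 + 4 = 20, below 12 + 12.
    (discriminant-at-2 2 (C2×C4ᴹ (# 4 ⊗ (# 2 ⊗ X ⊖ Y)) Y) (Y ↑ 8 ⊗ X ↑ 4) 1048576 ρ
      (2∤* (⟦ Y ↑ 8 ⟧ ρ) (⟦ X ↑ 4 ⟧ ρ) (2∤^ Y 8 ρ odd-b) (2∤^ X 4 ρ odd-l)) τ)
    where
    ρ : Vec ℤ 2
    ρ = l ∷ b ∷ []
    τ = proj₁ (proj₂ (scaled 2 (C2×C4ᴹ (# 4 ⊗ (# 2 ⊗ X ⊖ Y)) Y) ρ))
    odd-l : ¬ + 2 ∣ l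
    odd-l (divides m l≡) = 16∤ (∣⇒∣ᵤ {+ 16} (divides m (trans (cong (_+ + 4 * b) eq)
      (trans (cong (λ l → + 4 * (+ 2 * l - b) + + 4 * b) l≡)
        (solve 2 (λ m b → # 4 ⊗ (# 2 ⊗ (m ⊗ # 2) ⊖ b) ⊕ # 4 ⊗ b := m ⊗ # 16) m b)))))

  main : Dec (+ 2 ∣ k) → Result (ET C2×C4 (+ 4 * k , b)) 2
  main (yes 2∣k) with by-quotient {k} {2} 2∣k
  ... | j , eq = specialise {b = b} (λ a → ET C2×C4 (a , b)) (cong (+ 4 *_) eq) cop (even-k j)
  main (no odd-k′) with + 2 ∣? k + b
  ... | no odd = ⊥-elim (no-residue 2 (2 ∤ᴱ X ∷ 2 ∤ᴱ Y ∷ 2 ∤ᴱ X ⊕ Y ∷ []) (k ∷ b ∷ [])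
    (odd-k′ ∷ odd-b ∷ odd ∷ []))
  ... | yes 2∣k+b with by-quotient {k + b} {2} 2∣k+b
  ...   | l , eq = specialise {b = b} (λ a → ET C2×C4 (a , b)) eq′ cop (odd-k l eq′)
    where eq′ = cong (+ 4 *_) (sum≡⇒ {k} {b} eq)
C2×C4-result a b cop u (inj₂ (inj₂ (4∤ , refl))) with + 2 ∣? a
... | no odd-a = semistable-at-2 1 (C2×C4ᴹ X Y) (a ∷ b ∷ []) X odd-a (C2×C4-additive {a} {b} cop)
... | yes 2∣a with by-quotient {a} {2} 2∣a
...   | m , refl = conclude-odd (identity _) (C2×C4-additive {+ 2 * m} {b} cop)
  (discriminant-at-2 1 (C2×C4ᴹ (# 2 ⊗ X) Y) (X ↑ 8 ⊗ Y ↑ 4) 256 ρ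
    (2∤* (⟦ X ↑ 8 ⟧ ρ) (⟦ Y ↑ 4 ⟧ ρ)
      (2∤^ X 8 ρ (λ h → 4∤ (∣⇒∣ᵤ {+ 4} (*-monoʳ-∣ (+ 2) h))))
      (2∤^ Y 4 ρ (even⇒odd {+ 2 * m} {b} cop 2∣a))) (identity _))
  where
  ρ : Vec ℤ 2
  ρ = m ∷ b ∷ []

-- If v₂(a + b) = 1, then a and b are odd with a ≡ b mod 4, hence a = 8 j + b or a = 8 j + 5 b. Both
-- substitutions make a₁ equal to 16 times an odd number.
C2×C6-result : ∀ a b → Coprime a b → ∀ u → U C2×C6 (a , b) u → Result (ET C2×C6 (a , b)) u
C2×C6-result a b cop u U-a,b = go U-a,b
  where
  flip : ∀ a → Coprime a b → Coprime b a
  flip a c = trans (ℤ.gcd-comm b a) c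

  even⇒odd-b : + 2 ∣ a + b → ¬ + 2 ∣ b
  even⇒odd-b h k = coprime⇒∤both {a} {b} cop 2-prime (∣m+n∣n⇒∣m h k , k)

  go : U C2×C6 (a , b) u → Result (ET C2×C6 (a , b)) u
  go (inj₁ ((2∣ , 4∤) , refl)) = cases (+ 8 ∣? a - b) (+ 8 ∣? a - + 5 * b)
    where
    odd-b = even⇒odd-b (∣ᵤ⇒∣ 2∣)
    cases : Dec (+ 8 ∣ a - b) → Dec (+ 8 ∣ a - + 5 * b) → Result (ET C2×C6 (a , b)) 16
    cases (yes h) _ with by-quotient {a - b} {8} h
    ... | j , eq = specialise {b = b} (λ a → ET C2×C6 (a , b)) (difference≡⇒ {a} {b} eq) cop λ cop′ →
      semistable-at-2 16 (C2×C6ᴹ (# 8 ⊗ X ⊕ Y) Y) (j ∷ b ∷ []) (Y ↑ 2)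
        (2∤^ Y 2 (j ∷ b ∷ []) odd-b) (C2×C6-additive {+ 8 * j + b} {b} (flip (+ 8 * j + b) cop′))
    cases (no _) (yes h) with by-quotient {a - + 5 * b} {8} h
    ... | j , eq = specialise {b = b} (λ a → ET C2×C6 (a , b)) (difference≡⇒ {a} {+ 5 * b} eq) cop λ cop′ →
      semistable-at-2 16 (C2×C6ᴹ (# 8 ⊗ X ⊕ # 5 ⊗ Y) Y) (j ∷ b ∷ []) (Y ↑ 2)
        (2∤^ Y 2 (j ∷ b ∷ []) odd-b) (C2×C6-additive {+ 8 * j + + 5 * b} {b} (flip (+ 8 * j + + 5 * b) cop′))
    cases (no h) (no k) = ⊥-elim (no-residue 8
      (2 ∤ᴱ Y ∷ 2 ∣ᴱ X ⊕ Y ∷ 4 ∤ᴱ X ⊕ Y ∷ 8 ∤ᴱ X ⊖ Y ∷ 8 ∤ᴱ X ⊖ # 5 ⊗ Y ∷ []) (a ∷ b ∷ [])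
      (odd-b ∷ ∣ᵤ⇒∣ 2∣ ∷ (λ l → 4∤ (∣⇒∣ᵤ l)) ∷ h ∷ k ∷ []))
  go (inj₂ (inj₁ (4∣ , refl))) with by-quotient {a + b} {4} (∣ᵤ⇒∣ 4∣)
  ... | k , eq = specialise {b = b} (λ a → ET C2×C6 (a , b)) (sum≡⇒ {a} {b} eq) cop λ cop′ →
    semistable-at-2 4 (C2×C6ᴹ (# 4 ⊗ X ⊖ Y) Y) (k ∷ b ∷ []) (Y ↑ 2)
      (2∤^ Y 2 (k ∷ b ∷ []) (even⇒odd-b (∣-trans (divides (+ 2) refl) (∣ᵤ⇒∣ {+ 4} 4∣))))
      (C2×C6-additive {+ 4 * k - b} {b} (flip (+ 4 * k - b) cop′))
  go (inj₂ (inj₂ ((_ , 2∤) , refl))) =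
    semistable-at-2 1 (C2×C6ᴹ X Y) (a ∷ b ∷ []) ((X ⊕ Y) ↑ 2)
      (2∤^ (X ⊕ Y) 2 (a ∷ b ∷ []) (λ h → 2∤ (∣⇒∣ᵤ h))) (C2×C6-additive {a} {b} (flip a cop))

C2×C8-result : ∀ a b → Coprime a b → ∀ u → U C2×C8 (a , b) u → Result (ET C2×C8 (a , b)) u
C2×C8-result a b cop u (inj₁ (4∣ , refl)) with by-quotient {a} {4} (∣ᵤ⇒∣ 4∣)
... | k , refl = semistable-at-2 64 (C2×C8ᴹ (# 4 ⊗ X) Y) (k ∷ b ∷ []) (Y ↑ 4)
  (2∤^ Y 4 (k ∷ b ∷ []) (even⇒odd {+ 4 * k} {b} cop (2∣ 2 k))) (C2×C8-additive {+ 4 * k} {b} cop)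
C2×C8-result a b cop u (inj₂ (inj₁ ((2∣ , 4∤) , refl))) with by-quotient {a} {2} (∣ᵤ⇒∣ 2∣)
... | k , refl = semistable-at-2 16 (C2×C8ᴹ (# 2 ⊗ X) Y) (k ∷ b ∷ []) (X ↑ 4)
  (2∤^ X 4 (k ∷ b ∷ []) (λ h → 4∤ (∣⇒∣ᵤ {+ 4} (*-monoʳ-∣ (+ 2) h)))) (C2×C8-additive {+ 2 * k} {b} cop)
C2×C8-result a b cop u (inj₂ (inj₂ ((_ , 2∤) , refl))) =
  semistable-at-2 1 (C2×C8ᴹ X Y) (a ∷ b ∷ []) (X ↑ 4)
    (2∤^ X 4 (a ∷ b ∷ []) (λ h → 2∤ (∣⇒∣ᵤ h))) (C2×C8-additive {a} {b} cop)

-- Square-free decompositions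

module _ {p : ℕ} (pr : Prime p) where
  private instance
    p≢0′ : NonZero p
    p≢0′ = prime⇒nonZero pr

  -- The valuation v of x satisfies j v ≥ n j + 1, hence v > n. The recursion removes one factor p
  -- from x for each unit of n.
  valuation-root : ∀ n j x → (+ p) ^ suc (n ℕ.* j) ∣ x ^ j → (+ p) ^ suc n ∣ x
  valuation-root zero    j x h = subst (_∣ x) (sym (ℤ.*-identityʳ (+ p)))
    (euclid-^ pr x j (∣-trans (∣m⇒∣m*n (+ 1) ∣-refl) h))
  valuation-root (suc n) j x h with euclid-^ pr x j (∣-trans (∣m⇒∣m*n ((+ p) ^ (j ℕ.+ n ℕ.* j)) ∣-refl) h)
  ... | divides y refl = subst ((+ p) ^ suc (suc n) ∣_) (ℤ.*-comm (+ p) y)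
    (*-monoʳ-∣ (+ p) (valuation-root n j y (*-cancelˡ-∣ ((+ p) ^ j) {{^-nonZero (+ p) j}}
      (subst₂ _∣_ regroup (trans (^-distrib-* y (+ p) j) (ℤ.*-comm (y ^ j) ((+ p) ^ j))) h))))
    where
    regroup : (+ p) ^ suc (suc n ℕ.* j) ≡ (+ p) ^ j * (+ p) ^ suc (n ℕ.* j)
    regroup = trans (cong (+ p *_) (ℤ.^-distribˡ-+-* (+ p) j (n ℕ.* j)))
      (solve 3 (λ p v w → p ⊗ (v ⊗ w) := v ⊗ (p ⊗ w)) (+ p) ((+ p) ^ j) ((+ p) ^ (n ℕ.* j)))

  squarefree-∤ : ∀ x → Squarefree x → ¬ (+ p) ^ 2 ∣ x
  squarefree-∤ x sf h = sf p pr (∣⇒∣ᵤ (subst (_∣ x)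
    (trans (cong (+ p *_) (ℤ.*-identityʳ (+ p))) (sym (ℤ.pos-* p p))) h))

∤-squarefree : ∀ {x} → (∀ {p} → Prime p → ¬ (+ p) ^ 2 ∣ x) → Squarefree x
∤-squarefree {x} f p pr h = f pr (subst (_∣ x)
  (trans (ℤ.pos-* p p) (cong (+ p *_) (sym (ℤ.*-identityʳ (+ p))))) (∣ᵤ⇒∣ h))

module _ {q : ℕ} (qr : Prime q) where
  squarefree-* : ∀ d → Squarefree (+ d) → ¬ + q ∣ + d → Squarefree (+ (q ℕ.* d))
  squarefree-* d sf q∤d = ∤-squarefree {+ (q ℕ.* d)} λ {p} pr h → step pr
    (subst ((+ p) ^ 2 ∣_) (ℤ.pos-* q d) h)
    where
    step : ∀ {p} → Prime p → ¬ (+ p) ^ 2 ∣ + q * + d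
    step {p} pr h with + p ∣? + q
    ... | no p∤q = squarefree-∤ pr (+ d) sf (cancel-∤ pr 2 (+ d) p∤q h)
    ... | yes p∣q with prime-∣-prime pr qr p∣q
    ...   | refl = q∤d (*-cancelˡ-∣ (+ q) {{prime⇒nonZero qr}}
      (subst (_∣ + q * + d) (cong (+ q *_) (ℤ.*-identityʳ (+ q))) h))

NoCommonPrime : ℕ → ℕ → Set
NoCommonPrime d e = ∀ {p} → Prime p → + p ∣ + d → ¬ + p ∣ + e

noCommonPrime⇒coprime : ∀ d e → 0 ℕ.< d → NoCommonPrime d e → Coprime (+ d) (+ e)
noCommonPrime⇒coprime d e 0<d ncp = cong +_ (one (ℕ.gcd d e) refl)
  where
  one : ∀ g → ℕ.gcd d e ≡ g → g ≡ 1
  one zero eq = ⊥-elim (ℕ.<-irrefl (sym (ℕ.gcd[m,n]≡0⇒m≡0 eq)) 0<d)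
  one g@(suc _) eq with factorise g
  ... | record { factors = [] ; isFactorisation = g≡1 } = g≡1
  ... | record { factors = p ∷ ps ; isFactorisation = g≡ ; factorsPrime = pr ∷ _ } =
    ⊥-elim (ncp pr (∣ᵤ⇒∣ (ℕ.∣-trans p∣g (ℕ.gcd[m,n]∣m d e))) (∣ᵤ⇒∣ (ℕ.∣-trans p∣g (ℕ.gcd[m,n]∣n d e))))
    where
    p∣g : p ℕ.∣ ℕ.gcd d e
    p∣g = subst (p ℕ.∣_) (sym (trans eq g≡)) (ℕ.divides (ℕ.product ps) (ℕ.*-comm p (ℕ.product ps)))

-- `U C4` prescribes u for every decomposition of a, so one has to be exhibited before it applies.
-- Prime factors are added one by one: p joins d, or, if d already contains it, leaves d and enters
-- c.
squareDecomposition : ∀ n → 0 ℕ.< n → ∃[ c ] ∃[ d ] (0 ℕ.< c × Squarefree (+ d) × n ≡ c ℕ.* c ℕ.* d)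
squareDecomposition n@(suc _) _ with factorise n
... | record { factors = ps ; isFactorisation = n≡ ; factorsPrime = prs } with decompose ps prs
  where
  decompose : ∀ ps → All Prime ps → ∃[ c ] ∃[ d ] (0 ℕ.< c × Squarefree (+ d) × ℕ.product ps ≡ c ℕ.* c ℕ.* d)
  decompose [] [] = 1 , 1 , ℕ.s≤s ℕ.z≤n , ∤-squarefree {+ 1} (λ {p} pr h → prime∤1 pr (^∣⇒∣ p 1 h)) , refl
  decompose (p ∷ ps) (pr ∷ prs) with decompose ps prs
  ... | c , d , 0<c , sf , eq with + p ∣? + d
  ...   | no p∤d = c , p ℕ.* d , 0<c , squarefree-* pr d sf p∤d ,
    trans (cong (p ℕ.*_) eq) (ℕ*.solve 3 (λ p c d → p ℕ*.:* (c ℕ*.:* c ℕ*.:* d) ℕ*.:= c ℕ*.:* c ℕ*.:* (p ℕ*.:* d)) refl p c d)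
  ...   | yes p∣d with ∣⇒∣ᵤ p∣d
  ...     | ℕ.divides d′ refl = c ℕ.* p , d′ ,
    ℕ.*-mono-< 0<c (ℕ.>-nonZero⁻¹ p {{prime⇒nonZero pr}}) ,
    ∤-squarefree {+ d′} (λ {q} qr h → squarefree-∤ qr (+ (d′ ℕ.* p)) sf (∣-trans h (∣ᵤ⇒∣ (ℕ.divides p (ℕ.*-comm d′ p))))) ,
    trans (cong (p ℕ.*_) eq) (ℕ*.solve 3 (λ p c d → p ℕ*.:* (c ℕ*.:* c ℕ*.:* (d ℕ*.:* p))
      ℕ*.:= (c ℕ*.:* p) ℕ*.:* (c ℕ*.:* p) ℕ*.:* d) refl p c d′)
... | c , d , 0<c , sf , eq = c , d , 0<c , sf , trans n≡ eq

-- Each prime moves from e to d to c as its exponent is 1, 2 or 0 modulo 3. Positivity of d is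
-- carried along to exclude a zero gcd.
cubeDecomposition : ∀ n → 0 ℕ.< n → ∃[ c ] ∃[ d ] ∃[ e ]
  (0 ℕ.< c × Squarefree (+ d) × Squarefree (+ e) × Coprime (+ d) (+ e) × n ≡ c ℕ.^ 3 ℕ.* d ℕ.^ 2 ℕ.* e)
cubeDecomposition n@(suc _) _ with factorise n
... | record { factors = ps ; isFactorisation = n≡ ; factorsPrime = prs } with decompose ps prs
  where
  decompose : ∀ ps → All Prime ps → ∃[ c ] ∃[ d ] ∃[ e ] (0 ℕ.< c × 0 ℕ.< d × Squarefree (+ d) × Squarefree (+ e)
    × NoCommonPrime d e × ℕ.product ps ≡ c ℕ.^ 3 ℕ.* d ℕ.^ 2 ℕ.* e)
  decompose [] [] = 1 , 1 , 1 , ℕ.s≤s ℕ.z≤n , ℕ.s≤s ℕ.z≤n , one , one , (λ pr h → ⊥-elim (prime∤1 pr h)) , refl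
    where
    one : Squarefree (+ 1)
    one = ∤-squarefree {+ 1} (λ {p} pr h → prime∤1 pr (^∣⇒∣ p 1 h))
  decompose (p ∷ ps) (pr ∷ prs) with decompose ps prs
  ... | c , d , e , 0<c , 0<d , sfd , sfe , ncp , eq with + p ∣? + e
  ...   | yes p∣e with ∣⇒∣ᵤ p∣e
  ...     | ℕ.divides e′ refl = c , p ℕ.* d , e′ , 0<c , ℕ.*-mono-< 0<p 0<d ,
    squarefree-* pr d sfd (λ h → ncp pr h p∣e) ,
    ∤-squarefree {+ e′} (λ qr h → squarefree-∤ qr (+ (e′ ℕ.* p)) sfe (∣-trans h e′∣e)) ,
    (λ {q} qr h k → [ (λ q∣p → square-factor (subst (λ q → + q ∣ + e′) (prime-∣-prime qr pr q∣p) k))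
                    , (λ q∣d → ncp qr q∣d (∣-trans k e′∣e)) ]′ (euclid qr (+ p) (+ d) (subst (+ q ∣_) (ℤ.pos-* p d) h))) ,
    trans (cong (p ℕ.*_) eq) (ℕ*.solve 4 (λ p c d e → p ℕ*.:* (c ℕ*.:^ 3 ℕ*.:* d ℕ*.:^ 2 ℕ*.:* (e ℕ*.:* p))
      ℕ*.:= c ℕ*.:^ 3 ℕ*.:* (p ℕ*.:* d) ℕ*.:^ 2 ℕ*.:* e) refl p c d e′)
    where
    0<p = ℕ.>-nonZero⁻¹ p {{prime⇒nonZero pr}}
    e′∣e : + e′ ∣ + (e′ ℕ.* p)
    e′∣e = ∣ᵤ⇒∣ (ℕ.divides p (ℕ.*-comm e′ p))
    square-factor : ¬ + p ∣ + e′
    square-factor h = squarefree-∤ pr (+ (e′ ℕ.* p)) sfe (subst₂ _∣_ (cong (+ p *_) (sym (ℤ.*-identityʳ (+ p))))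
      (trans (ℤ.*-comm (+ p) (+ e′)) (sym (ℤ.pos-* e′ p))) (*-monoʳ-∣ (+ p) h))
  decompose (p ∷ ps) (pr ∷ prs) | c , d , e , 0<c , 0<d , sfd , sfe , ncp , eq | no p∤e with + p ∣? + d
  ...   | no p∤d = c , d , p ℕ.* e , 0<c , 0<d , sfd , squarefree-* pr e sfe p∤e ,
    (λ {q} qr h k → [ (λ q∣p → p∤d (subst (λ q → + q ∣ + d) (prime-∣-prime qr pr q∣p) h))
                    , ncp qr h ]′ (euclid qr (+ p) (+ e) (subst (+ q ∣_) (ℤ.pos-* p e) k))) ,
    trans (cong (p ℕ.*_) eq) (ℕ*.solve 4 (λ p c d e → p ℕ*.:* (c ℕ*.:^ 3 ℕ*.:* d ℕ*.:^ 2 ℕ*.:* e)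
      ℕ*.:= c ℕ*.:^ 3 ℕ*.:* d ℕ*.:^ 2 ℕ*.:* (p ℕ*.:* e)) refl p c d e)
  ...   | yes p∣d with ∣⇒∣ᵤ p∣d
  ...     | ℕ.divides zero refl = ⊥-elim (ℕ.<-irrefl refl 0<d)
  ...     | ℕ.divides d′@(suc _) refl = c ℕ.* p , d′ , e ,
    ℕ.*-mono-< 0<c (ℕ.>-nonZero⁻¹ p {{prime⇒nonZero pr}}) , ℕ.s≤s ℕ.z≤n ,
    ∤-squarefree {+ d′} (λ qr h → squarefree-∤ qr (+ (d′ ℕ.* p)) sfd (∣-trans h d′∣d)) , sfe ,
    (λ qr h → ncp qr (∣-trans h d′∣d)) ,
    trans (cong (p ℕ.*_) eq) (ℕ*.solve 4 (λ p c d e → p ℕ*.:* (c ℕ*.:^ 3 ℕ*.:* (d ℕ*.:* p) ℕ*.:^ 2 ℕ*.:* e)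
      ℕ*.:= (c ℕ*.:* p) ℕ*.:^ 3 ℕ*.:* d ℕ*.:^ 2 ℕ*.:* e) refl p c d′ e)
    where
    d′∣d : + d′ ∣ + (d′ ℕ.* p)
    d′∣d = ∣ᵤ⇒∣ (ℕ.divides p (ℕ.*-comm d′ p))
... | c , d , e , 0<c , 0<d , sfd , sfe , ncp , eq =
  c , d , e , 0<c , sfd , sfe , noCommonPrime⇒coprime d e 0<d ncp , trans n≡ eq

-- C₃⁰, C₃ and C₄

-- The discriminant is -27 a⁴. Even at 3, p¹² ∣ 27 a⁴ leaves p⁹ ∣ a⁴, and 9 = 2 · 4 + 1 gives p³ ∣
-- a.
C3⁰-result : ∀ a → Cubefree a → Result (ET C3⁰ a) 1
C3⁰-result a cubefree = conclude (identity _) irreducible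
  where
  E : Model 1
  E = model (# 0) (# 0) (var 0F) (# 0) (# 0)

  cube-∤ : ∀ {p} → Prime p → ¬ (+ p) ^ 3 ∣ a
  cube-∤ {p} pr h = cubefree p pr (∣⇒∣ᵤ (subst (_∣ a)
    (trans (solve 1 (λ p → p ↑ 3 := p ⊗ p ⊗ p) (+ p)) (sym (trans (ℤ.pos-* (p ℕ.* p) p)
      (cong (_* + p) (ℤ.pos-* p p))))) h))

  irreducible : ∀ p → Prime p → ¬ Reducible p (ET C3⁰ a)
  irreducible p pr red = split (+ p ∣? + 27)
    where
    p^12∣ : (+ p) ^ 12 ∣ + 27 * a ^ 4
    p^12∣ = subst ((+ p) ^ 12 ∣_) (trans (cong -_ (disc-δ E (a ∷ [])))
      (prove (⊝ δ E) (# 27 ⊗ var 0F ↑ 4) (a ∷ []))) (∣m⇒∣-m (Reducible.∣disc red))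
    split : Dec (+ p ∣ + 27) → ⊥
    split (no p∤27) = cube-∤ pr (valuation-root pr 2 4 a (lower p {9} {12} (cancel-∤ pr 12 (a ^ 4) p∤27 p^12∣)))
    split (yes p∣27) with prime-∣-prime pr 3-prime (euclid-^ pr (+ 3) 3 p∣27)
    ... | refl = cube-∤ pr (valuation-root pr 2 4 a (*-cancelˡ-∣ (+ 27) {(+ 3) ^ 9} {a ^ 4} p^12∣))

-- The last two hypotheses concern c₄ and Δ of the model with a₁ = x, a₃ = z and a₂ = a₄ = a₆ = 0.
C3-core : ∀ {p} → Prime p → ∀ x z → ¬ (+ p) ^ 3 ∣ z → (+ p) ^ 4 ∣ x * (x ^ 3 - + 24 * z) →
  ¬ (+ p) ^ 12 ∣ z ^ 3 * (x ^ 3 - + 27 * z)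
C3-core {p} pr x z p³∤z h4 h12 = at-3 p∣x p³∣27z
  where
  g = x ^ 3 - + 27 * z

  -- As v_p(z) is at most 2, the factor z³ absorbs at most 6 of the 12 powers of p.
  p⁶∣g : (+ p) ^ 6 ∣ g
  p⁶∣g = strip (+ p ∣? z)
    where
    strip : Dec (+ p ∣ z) → (+ p) ^ 6 ∣ g
    strip (no p∤z) = lower p {6} {12} (cancel-∤ pr 12 g (λ h → p∤z (euclid-^ pr z 3 h)) h12)
    strip (yes p∣z) with by-quotient {z} {p} p∣z
    ... | z′ , refl = strip′ (+ p ∣? z′)
      where
      instance p≢0 = prime⇒nonZero pr
      h9 : (+ p) ^ 9 ∣ z′ ^ 3 * g
      h9 = *-cancelˡ-∣ ((+ p) ^ 3) {{^-nonZero (+ p) 3}} (subst₂ _∣_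
        (ℤ.^-distribˡ-+-* (+ p) 3 9)
        (solve 3 (λ p z g → (p ⊗ z) ↑ 3 ⊗ g := p ↑ 3 ⊗ (z ↑ 3 ⊗ g)) (+ p) z′ g) h12)
      strip′ : Dec (+ p ∣ z′) → (+ p) ^ 6 ∣ g
      strip′ (no p∤z′) = lower p {6} {9} (cancel-∤ pr 9 g (λ h → p∤z′ (euclid-^ pr z′ 3 h)) h9)
      strip′ (yes p∣z′) with by-quotient {z′} {p} p∣z′
      ... | z″ , refl = cancel-∤ pr 6 g
        (λ h → p³∤z (*-monoʳ-∣ (+ p) (*-monoʳ-∣ (+ p) (subst (_∣ z″) (sym (ℤ.*-identityʳ (+ p))) (euclid-^ pr z″ 3 h)))))
        (*-cancelˡ-∣ ((+ p) ^ 3) {{^-nonZero (+ p) 3}} (subst₂ _∣_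
          (ℤ.^-distribˡ-+-* (+ p) 3 6)
          (solve 3 (λ p z g → (p ⊗ z) ↑ 3 ⊗ g := p ↑ 3 ⊗ (z ↑ 3 ⊗ g)) (+ p) z″ g) h9))

  p∣g : + p ∣ g
  p∣g = ^∣⇒∣ p 5 p⁶∣g

  p∣x : + p ∣ x
  p∣x = [ (λ h → h) , from-bracket ]′ (euclid pr x (x ^ 3 - + 24 * z) (^∣⇒∣ p 3 h4))
    where
    from-bracket : + p ∣ x ^ 3 - + 24 * z → + p ∣ x
    from-bracket h = euclid-^ pr x 3 (subst (+ p ∣_)
      -- The combination 9 (x³ - 24 z) - 8 (x³ - 27 z) eliminates z.
      (solve 2 (λ v z → # 9 ⊗ (v ⊖ # 24 ⊗ z) ⊖ # 8 ⊗ (v ⊖ # 27 ⊗ z) := v) (x ^ 3) z)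
      (∣m∣n⇒∣m-n (∣n⇒∣m*n (+ 9) h) (∣n⇒∣m*n (+ 8) p∣g)))

  p³∣27z : (+ p) ^ 3 ∣ + 27 * z
  p³∣27z = ∣-subtrahend (x ^ 3) (+ 27 * z) (∣-^ 3 p∣x) (lower p {3} {6} p⁶∣g)

  at-3 : + p ∣ x → (+ p) ^ 3 ∣ + 27 * z → ⊥
  at-3 p∣x p³∣27z with + p ∣? + 27
  ... | no p∤27 = p³∤z (cancel-∤ pr 3 z p∤27 p³∣27z)
  ... | yes p∣27 with prime-∣-prime pr 3-prime (euclid-^ pr (+ 3) 3 p∣27)
  ...   | refl with by-quotient {x} {3} p∣x
  ...     | w , refl = 3∤w 3∣w
    where
    27∣ : + 27 ∣ w ^ 3 - z
    27∣ = *-cancelˡ-∣ (+ 27) {+ 27} (subst ((+ 3) ^ 6 ∣_)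
      (solve 2 (λ w z → (# 3 ⊗ w) ↑ 3 ⊖ # 27 ⊗ z := # 27 ⊗ (w ↑ 3 ⊖ z)) w z) p⁶∣g)
    3∤w : ¬ + 3 ∣ w
    3∤w h = p³∤z (∣-subtrahend (w ^ 3) z (∣-^ 3 h) 27∣)
    9∣ : + 9 ∣ w * (+ 9 * w ^ 3 - + 8 * z)
    9∣ = *-cancelˡ-∣ (+ 9) {+ 9} (subst ((+ 3) ^ 4 ∣_)
      (solve 2 (λ w z → (# 3 ⊗ w) ⊗ ((# 3 ⊗ w) ↑ 3 ⊖ # 24 ⊗ z) := # 9 ⊗ (w ⊗ (# 9 ⊗ w ↑ 3 ⊖ # 8 ⊗ z))) w z) h4)
    -- If 3 ∤ w, then z ≡ w³ modulo 9 and w (9 w³ - 8 z) ≡ w⁴, which 9 cannot divide.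
    3∣w : + 3 ∣ w
    3∣w with + 3 ∣? w
    ... | yes h = h
    ... | no h = ⊥-elim (no-residue 27
      (3 ∤ᴱ X ∷ 27 ∣ᴱ X ↑ 3 ⊖ Y ∷ 9 ∣ᴱ X ⊗ (# 9 ⊗ X ↑ 3 ⊖ # 8 ⊗ Y) ∷ []) (w ∷ z ∷ []) (h ∷ 27∣ ∷ 9∣ ∷ []))

-- Dividing by c² d leaves a₁ = A = c d e and a₃ = B = d e² b. A prime dividing b does not divide A,
-- so it does not divide c₄ = A (A³ - 24 B). For p ∤ b, squarefreeness and coprimality of d and e
-- bound v_p(B) by 2, as `C3-core` demands.
C3-result : ∀ a b → Coprime a b → + 0 ℤ.< a → ∀ u → U C3 (a , b) u → Result (ET C3 (a , b)) u
C3-result (+ n) b cop (+<+ 0<n) u U-a with cubeDecomposition n 0<n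
... | c , d , e , 0<c , sf-d , sf-e , cop-de , eq =
  subst (λ u → Result (ET C3 (+ n , b)) u) (sym (U-a c d e 0<c sf-d sf-e cop-de (cong +_ eq)))
    (specialise {b = b} (λ a → ET C3 (a , b)) (trans (cong +_ eq) cast) cop main)
  where
  x = + c
  y = + d
  z = + e
  cast : + (c ℕ.^ 3 ℕ.* d ℕ.^ 2 ℕ.* e) ≡ x ^ 3 * y ^ 2 * z
  cast = trans (ℤ.pos-* (c ℕ.^ 3 ℕ.* d ℕ.^ 2) e) (cong (_* z)
    (trans (ℤ.pos-* (c ℕ.^ 3) (d ℕ.^ 2)) (cong₂ _*_ (pos-^ c 3) (pos-^ d 2))))
  castᵘ : x ^ 2 * y ≡ + (c ℕ.^ 2 ℕ.* d)
  castᵘ = sym (trans (ℤ.pos-* (c ℕ.^ 2) d) (cong (_* y) (pos-^ c 2)))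
  A B : ℤ
  A = x * y * z
  B = y * z ^ 2 * b
  M : Model 2
  M = model X (# 0) Y (# 0) (# 0)
  ρ : Vec ℤ 2
  ρ = A ∷ B ∷ []

  u≢0 : x ^ 2 * y ≢ + 0
  u≢0 h = ℕ.<-irrefl (sym (ℤ.+-injective (trans (cong +_ eq) (trans cast
    (trans (solve 3 (λ x y z → x ↑ 3 ⊗ y ↑ 2 ⊗ z := (x ↑ 2 ⊗ y) ⊗ (x ⊗ y ⊗ z)) x y z)
      (cong (_* A) h)))))) 0<n

  τ : Transform (+ (c ℕ.^ 2 ℕ.* d)) (ET C3 (x ^ 3 * y ^ 2 * z , b)) (⟦ M ⟧ᴹ ρ)
  τ = subst (λ v → Transform v (ET C3 (x ^ 3 * y ^ 2 * z , b)) (⟦ M ⟧ᴹ ρ)) castᵘ (scaling u≢0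
    (solve 3 (λ x y z → x ↑ 2 ⊗ y ⊗ (x ⊗ y ⊗ z) := x ↑ 3 ⊗ y ↑ 2 ⊗ z) x y z)
    (ℤ.*-zeroʳ (x ^ 2 * y * (x ^ 2 * y)))
    (solve 4 (λ x y z b → let u = x ↑ 2 ⊗ y ; a = x ↑ 3 ⊗ y ↑ 2 ⊗ z in
      u ⊗ u ⊗ u ⊗ (y ⊗ z ↑ 2 ⊗ b) := a ⊗ a ⊗ b) x y z b)
    (solve 1 (λ u → u ⊗ u ⊗ u ⊗ u ⊗ # 0 := # 0) (x ^ 2 * y))
    (solve 1 (λ u → u ⊗ u ⊗ u ⊗ u ⊗ u ⊗ u ⊗ # 0 := # 0) (x ^ 2 * y)))

  main : Coprime (x ^ 3 * y ^ 2 * z) b → Result (ET C3 (x ^ 3 * y ^ 2 * z , b)) (c ℕ.^ 2 ℕ.* d)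
  main cop′ = conclude τ irreducible
    where
    irreducible : ∀ p → Prime p → ¬ Reducible p (⟦ M ⟧ᴹ ρ)
    irreducible p pr red = split (+ p ∣? b)
      where
      h4 : (+ p) ^ 4 ∣ A * (A ^ 3 - + 24 * B)
      h4 = subst ((+ p) ^ 4 ∣_) (trans (c4-γ4 M ρ) (prove (γ4 M) (X ⊗ (X ↑ 3 ⊖ # 24 ⊗ Y)) ρ)) (Reducible.∣c4 red)
      h12 : (+ p) ^ 12 ∣ B ^ 3 * (A ^ 3 - + 27 * B)
      h12 = subst ((+ p) ^ 12 ∣_) (trans (disc-δ M ρ) (prove (δ M) (Y ↑ 3 ⊗ (X ↑ 3 ⊖ # 27 ⊗ Y)) ρ)) (Reducible.∣disc red)
      split : Dec (+ p ∣ b) → ⊥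
      split (yes p∣b) = p∤A ([ (λ h → h) , (λ h → euclid-^ pr A 3 (subst (+ p ∣_)
          (solve 2 (λ v w → (v ⊖ # 24 ⊗ w) ⊕ # 24 ⊗ w := v) (A ^ 3) B)
          (∣m∣n⇒∣m+n h (∣n⇒∣m*n (+ 24) (∣n⇒∣m*n (y * z ^ 2) p∣b))))) ]′
        (euclid pr A (A ^ 3 - + 24 * B) (^∣⇒∣ p 3 h4)))
        where
        p∤A : ¬ + p ∣ A
        p∤A h = coprime⇒∤both {x ^ 3 * y ^ 2 * z} {b} cop′ pr (subst (+ p ∣_)
          (solve 3 (λ x y z → x ↑ 2 ⊗ y ⊗ (x ⊗ y ⊗ z) := x ↑ 3 ⊗ y ↑ 2 ⊗ z) x y z)
          (∣n⇒∣m*n (x ^ 2 * y) h) , p∣b)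
      split (no p∤b) = C3-core pr A B p³∤B h4 h12
        where
        p³∤B : ¬ (+ p) ^ 3 ∣ B
        p³∤B h = on-y (+ p ∣? y)
          where
          h′ : (+ p) ^ 3 ∣ y * z ^ 2
          h′ = cancel-∤ pr 3 (y * z ^ 2) p∤b (subst ((+ p) ^ 3 ∣_) (ℤ.*-comm (y * z ^ 2) b) h)
          on-y : Dec (+ p ∣ y) → ⊥
          on-y (no p∤y) = squarefree-∤ pr z sf-e (valuation-root pr 1 2 z (cancel-∤ pr 3 (z ^ 2) p∤y h′))
          on-y (yes p∣y) = squarefree-∤ pr y sf-d (lower p {2} {3} (cancel-∤ pr 3 y
            (λ k → prime∤coprime pr {y} {z} cop-de p∣y (euclid-^ pr z 2 k))
            (subst ((+ p) ^ 3 ∣_) (ℤ.*-comm y (z ^ 2)) h′)))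

-- The C₄ model with a = x² y, divided by x.
C4-reduced : ∀ {n} → Expr n → Expr n → Expr n → Model n
C4-reduced x y b = model (x ⊗ y) (⊝ (b ⊗ y)) (⊝ (x ⊗ b ⊗ y ⊗ y)) (# 0) (# 0)

v₀ v₁ v₂ : Expr 3
v₀ = var 0F
v₁ = var 1F
v₂ = var 2F

module _ (x y b : ℤ) where
  private
    ρ : Vec ℤ 3
    ρ = x ∷ y ∷ b ∷ []

  module _ (sf : Squarefree y) (both : ∀ {p} → Prime p → ¬ (+ p ∣ x * x * y × + p ∣ b)) where

    -- Here c₄ = y² Br and Δ = x² y⁷ b⁴ (x² y + 16 b). Since y is squarefree, y² cannot supply p⁴,
    -- so p ∣ Br. Modulo each factor of Δ, Br reduces to 16 b² or x⁴ y², and p would divide both a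
    -- and b.
    C4-additive : ∀ {p} → Prime p → p ≢ 2 → ¬ Additive p (⟦ C4-reduced v₀ v₁ v₂ ⟧ᴹ ρ)
    C4-additive {p} pr p≢2 (mkAdditive h4 _ h12) = on-y (+ p ∣? y)
      where
      Br f : ℤ
      Br = ⟦ v₀ ↑ 4 ⊗ v₁ ↑ 2 ⊕ # 16 ⊗ v₀ ↑ 2 ⊗ v₂ ⊗ v₁ ⊕ # 16 ⊗ v₂ ↑ 2 ⟧ ρ
      f = x ^ 2 * y + + 16 * b
      p⁴∣ : (+ p) ^ 4 ∣ y ^ 2 * Br
      p⁴∣ = subst ((+ p) ^ 4 ∣_) (trans (c4-γ4 (C4-reduced v₀ v₁ v₂) ρ) (prove (γ4 (C4-reduced v₀ v₁ v₂))
        (v₁ ↑ 2 ⊗ (v₀ ↑ 4 ⊗ v₁ ↑ 2 ⊕ # 16 ⊗ v₀ ↑ 2 ⊗ v₂ ⊗ v₁ ⊕ # 16 ⊗ v₂ ↑ 2)) ρ)) h4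
      p∣disc : + p ∣ x ^ 2 * (y ^ 7 * (b ^ 4 * f))
      p∣disc = subst (+ p ∣_) (trans (disc-δ (C4-reduced v₀ v₁ v₂) ρ) (prove (δ (C4-reduced v₀ v₁ v₂))
        (v₀ ↑ 2 ⊗ (v₁ ↑ 7 ⊗ (v₂ ↑ 4 ⊗ (v₀ ↑ 2 ⊗ v₁ ⊕ # 16 ⊗ v₂)))) ρ)) (^∣⇒∣ p 11 h12)
      from-16b² : + p ∣ + 16 * b ^ 2 → + p ∣ b
      from-16b² h = [ (λ k → ⊥-elim (prime-∣-2 pr p≢2 (euclid-^ pr (+ 2) 4 k))) , euclid-^ pr b 2 ]′
        (euclid pr (+ 16) (b ^ 2) h)
      x∣a : + p ∣ x → + p ∣ x * x * y
      x∣a h = ∣m⇒∣m*n y (∣m⇒∣m*n x h)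
      y∣a : + p ∣ y → + p ∣ x * x * y
      y∣a h = ∣n⇒∣m*n (x * x) h
      ∣16b²+v⇒∣b : ∀ {v} → + p ∣ v → + p ∣ + 16 * b ^ 2 + v → + p ∣ b
      ∣16b²+v⇒∣b {v} h k = from-16b² (∣m+n∣n⇒∣m k h)
      on-y : Dec (+ p ∣ y) → ⊥
      on-y (yes p∣y) = [ (λ p∣Br → both pr (y∣a p∣y , ∣16b²+v⇒∣b
            (∣m⇒∣m*n (x ^ 4 * y + + 16 * x ^ 2 * b) p∣y) (subst (+ p ∣_)
              (solve 3 (λ x y b → x ↑ 4 ⊗ y ↑ 2 ⊕ # 16 ⊗ x ↑ 2 ⊗ b ⊗ y ⊕ # 16 ⊗ b ↑ 2
                := # 16 ⊗ b ↑ 2 ⊕ y ⊗ (x ↑ 4 ⊗ y ⊕ # 16 ⊗ x ↑ 2 ⊗ b)) x y b) p∣Br)))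
        , (λ k → squarefree-∤ pr y sf k) ]′ (Br-or-y (+ p ∣? Br))
        where
        Br-or-y : Dec (+ p ∣ Br) → (+ p ∣ Br) ⊎ ((+ p) ^ 2 ∣ y)
        Br-or-y (yes h) = inj₁ h
        Br-or-y (no h) = inj₂ (valuation-root pr 1 2 y (lower p {3} {4}
          (cancel-∤ pr 4 (y ^ 2) h (subst ((+ p) ^ 4 ∣_) (ℤ.*-comm (y ^ 2) Br) p⁴∣))))
      on-y (no p∤y) = cases (euclid pr (x ^ 2) (y ^ 7 * (b ^ 4 * f)) p∣disc)
        where
        p∣Br : + p ∣ Br
        p∣Br = ^∣⇒∣ p 3 (cancel-∤ pr 4 Br (λ h → p∤y (euclid-^ pr y 2 h)) p⁴∣)
        from-x : + p ∣ x → ⊥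
        from-x h = both pr (x∣a h , ∣16b²+v⇒∣b (∣m⇒∣m*n (x ^ 3 * y ^ 2 + + 16 * x * b * y) h) (subst (+ p ∣_)
              (solve 3 (λ x y b → x ↑ 4 ⊗ y ↑ 2 ⊕ # 16 ⊗ x ↑ 2 ⊗ b ⊗ y ⊕ # 16 ⊗ b ↑ 2
                := # 16 ⊗ b ↑ 2 ⊕ x ⊗ (x ↑ 3 ⊗ y ↑ 2 ⊕ # 16 ⊗ x ⊗ b ⊗ y)) x y b) p∣Br))
        from-b : + p ∣ b → ⊥
        from-b h = [ (λ k → from-x (euclid-^ pr x 4 k)) , (λ k → p∤y (euclid-^ pr y 2 k)) ]′
          (euclid pr (x ^ 4) (y ^ 2) (∣m+n∣n⇒∣m (subst (+ p ∣_)
            (solve 3 (λ x y b → x ↑ 4 ⊗ y ↑ 2 ⊕ # 16 ⊗ x ↑ 2 ⊗ b ⊗ y ⊕ # 16 ⊗ b ↑ 2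
              := x ↑ 4 ⊗ y ↑ 2 ⊕ b ⊗ (# 16 ⊗ x ↑ 2 ⊗ y ⊕ # 16 ⊗ b)) x y b) p∣Br)
            (∣m⇒∣m*n (+ 16 * x ^ 2 * y + + 16 * b) h)))
        from-f : + p ∣ f → ⊥
        from-f h = from-b (∣16b²+v⇒∣b (∣n⇒∣m*n (x ^ 2 * y) h) (subst (+ p ∣_)
            (solve 3 (λ x y b → x ↑ 4 ⊗ y ↑ 2 ⊕ # 16 ⊗ x ↑ 2 ⊗ b ⊗ y ⊕ # 16 ⊗ b ↑ 2
              := # 16 ⊗ b ↑ 2 ⊕ x ↑ 2 ⊗ y ⊗ (x ↑ 2 ⊗ y ⊕ # 16 ⊗ b)) x y b) p∣Br))
        cases : (+ p ∣ x ^ 2) ⊎ (+ p ∣ y ^ 7 * (b ^ 4 * f)) → ⊥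
        cases (inj₁ h) = from-x (euclid-^ pr x 2 h)
        cases (inj₂ h) = [ (λ k → p∤y (euclid-^ pr y 7 k)) ,
          (λ k → [ (λ l → from-b (euclid-^ pr b 4 l)) , from-f ]′ (euclid pr (b ^ 4) f k)) ]′
          (euclid pr (y ^ 7) (b ^ 4 * f) h)

odd-monomial : ∀ i j k (ρ : Vec ℤ 3) → ¬ + 2 ∣ ⟦ v₀ ⟧ ρ → ¬ + 2 ∣ ⟦ v₁ ⟧ ρ → ¬ + 2 ∣ ⟦ v₂ ⟧ ρ →
  ¬ + 2 ∣ ⟦ v₀ ↑ i ⊗ v₁ ↑ j ⊗ v₂ ↑ k ⟧ ρ
odd-monomial i j k ρ h₀ h₁ h₂ = 2∤* (⟦ v₀ ↑ i ⊗ v₁ ↑ j ⟧ ρ) (⟦ v₂ ↑ k ⟧ ρ)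
  (2∤* (⟦ v₀ ↑ i ⟧ ρ) (⟦ v₁ ↑ j ⟧ ρ) (2∤^ v₀ i ρ h₀) (2∤^ v₁ j ρ h₁)) (2∤^ v₂ k ρ h₂)

-- An even c₄ makes x y even and b odd. With y even, Δ has valuation 8 if x is odd, and Kraus's
-- condition fails if x is even. With y odd, v₂(x) = 1 gives valuation 4; from 4 ∣ x on, c₄ / 16 is
-- odd and c₆ / 64 has to be 3 modulo 4.
C4-at-2 : ∀ x y b → Squarefree y → (∀ {p} → Prime p → ¬ (+ p ∣ x * x * y × + p ∣ b)) →
  (¬ + 256 ∣ x * x * y) ⊎ (¬ + 4 ∣ b * y - + 3) → ¬ Reducible 2 (⟦ C4-reduced v₀ v₁ v₂ ⟧ᴹ (x ∷ y ∷ b ∷ []))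
C4-at-2 x y b sf both hyp red = on-y x y sf odd-b hyp red x∨y (+ 2 ∣? y) (+ 2 ∣? x)
  where
  M₀ : ℤ → ℤ → WModel
  M₀ x y = ⟦ C4-reduced v₀ v₁ v₂ ⟧ᴹ (x ∷ y ∷ b ∷ [])

  x∨y : (+ 2 ∣ x) ⊎ (+ 2 ∣ y)
  x∨y = euclid 2-prime x y (2∣c4⇒2∣a1 (M₀ x y) (^∣⇒∣ 2 3 (Reducible.∣c4 red)))

  odd-b : ¬ + 2 ∣ b
  odd-b h = both 2-prime ([ (λ k → ∣m⇒∣m*n y (∣m⇒∣m*n x k)) , (λ k → ∣n⇒∣m*n (x * x) k) ]′ x∨y , h)

  y-even : ∀ x δ → Squarefree (+ 2 * δ) → ¬ + 2 ∣ b → Dec (+ 2 ∣ x) → ¬ Reducible 2 (M₀ x (+ 2 * δ))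
  y-even x δ sf odd-b x-even? red = on-x x-even?
    where
    odd-δ : ¬ + 2 ∣ δ
    odd-δ h = squarefree-∤ 2-prime (+ 2 * δ) sf (*-monoʳ-∣ (+ 2) h)
    on-x : Dec (+ 2 ∣ x) → ⊥
    on-x (no odd-x) = discriminant-at-2 1 (C4-reduced v₀ (# 2 ⊗ v₁) v₂) (v₀ ↑ 4 ⊗ v₁ ↑ 8 ⊗ v₂ ↑ 4) 256
      (x ∷ δ ∷ b ∷ []) (odd-monomial 4 8 4 (x ∷ δ ∷ b ∷ []) odd-x odd-δ odd-b) (identity _) red
    on-x (yes 2∣x) with by-quotient {x} {2} 2∣x
    ... | g , refl = no-residue 4 (4 ∣ᴱ # 0 ⊖ # 3 ∷ []) ρ
      (kraus-at-2 1 8 (C4-reduced (# 2 ⊗ v₀) (# 2 ⊗ v₁) v₂) (# 4 ⊗ (v₀ ↑ 0 ⊗ v₁ ↑ 2 ⊗ v₂ ↑ 2)) (# 0) ρ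
        (λ h → 2∤* (δ ^ 2) (b ^ 2) (λ k → odd-δ (euclid-^ 2-prime δ 2 k)) (λ k → odd-b (euclid-^ 2-prime b 2 k))
          (subst (+ 2 ∣_) (cong (_* b ^ 2) (ℤ.*-identityˡ (δ ^ 2)))
            (*-cancelˡ-∣ (+ 4) {+ 2} {+ 1 * δ ^ 2 * b ^ 2} h))) (identity _) red ∷ [])
      where
      ρ : Vec ℤ 3
      ρ = g ∷ δ ∷ b ∷ []

  x-even : ∀ g y → ¬ + 2 ∣ y → ¬ + 2 ∣ b →
    (¬ + 256 ∣ + 2 * g * (+ 2 * g) * y) ⊎ (¬ + 4 ∣ b * y - + 3) → Dec (+ 2 ∣ g) → ¬ Reducible 2 (M₀ (+ 2 * g) y)
  x-even g y odd-y odd-b hyp (no odd-g) red = discriminant-at-2 1 (C4-reduced (# 2 ⊗ v₀) v₁ v₂)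
    (v₀ ↑ 4 ⊗ v₁ ↑ 8 ⊗ v₂ ↑ 4) 16 (g ∷ y ∷ b ∷ [])
    (odd-monomial 4 8 4 (g ∷ y ∷ b ∷ []) odd-g odd-y odd-b) (identity _) red
  x-even g y odd-y odd-b hyp (yes 2∣g) red with by-quotient {g} {2} 2∣g
  ... | h , refl = on-h (+ 2 ∣? h)
    where
    ρ : Vec ℤ 3
    ρ = h ∷ y ∷ b ∷ []
    M : Model 3
    M = C4-reduced (# 2 ⊗ (# 2 ⊗ v₀)) v₁ v₂
    W f : Expr 3
    W = v₂ ↑ 3 ⊗ v₁ ↑ 3 ⊕ # 2 ⊗ (v₀ ↑ 2 ⊗ v₁ ↑ 4 ⊗ v₂ ↑ 2)
    f = v₀ ↑ 2 ⊗ v₁ ↑ 7 ⊗ v₂ ↑ 4 ⊗ (v₀ ↑ 2 ⊗ v₁ ⊕ v₂)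
    4∣W-3 : + 4 ∣ ⟦ W ⟧ ρ - + 3
    4∣W-3 = kraus-at-2 1 2 M (v₀ ↑ 0 ⊗ v₁ ↑ 2 ⊗ v₂ ↑ 2) W ρ
      (λ k → 2∤* (y ^ 2) (b ^ 2) (λ l → odd-y (euclid-^ 2-prime y 2 l)) (λ l → odd-b (euclid-^ 2-prime b 2 l))
        (subst (+ 2 ∣_) (cong (_* b ^ 2) (ℤ.*-identityˡ (y ^ 2))) k)) (identity _) red
    on-h : Dec (+ 2 ∣ h) → ⊥
    -- For odd h, W ≡ 3 means b y ≡ 1 mod 4, whereas 4 ∣ f means 4 ∣ y + b, that is b y ≡ 3.
    on-h (no odd-h) = no-residue 4
      (2 ∤ᴱ v₀ ∷ 2 ∤ᴱ v₁ ∷ 2 ∤ᴱ v₂ ∷ 4 ∣ᴱ W ⊖ # 3 ∷ 4 ∣ᴱ f ∷ []) ρ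
      (odd-h ∷ odd-y ∷ odd-b ∷ 4∣W-3 ∷ ∣-trans (divides (+ 4) refl) 16∣f ∷ [])
      where
      16∣f : + 16 ∣ ⟦ f ⟧ ρ
      16∣f = halves 256 16 (⟦ f ⟧ ρ) (subst (+ 4096 ∣_) (prove (δ M) (# 256 ⊗ f) ρ)
        (reducible-disc 1 M ρ (identity _) red))
    on-h (yes 2∣h) = on-hyp hyp
      where
      on-hyp : (¬ + 256 ∣ + 2 * (+ 2 * h) * (+ 2 * (+ 2 * h)) * y) ⊎ (¬ + 4 ∣ b * y - + 3) → ⊥
      on-hyp (inj₂ by≢3) = no-residue 4 (2 ∣ᴱ v₀ ∷ 2 ∤ᴱ v₁ ∷ 2 ∤ᴱ v₂ ∷ 4 ∣ᴱ W ⊖ # 3 ∷ 4 ∤ᴱ v₂ ⊗ v₁ ⊖ # 3 ∷ []) ρ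
        (2∣h ∷ odd-y ∷ odd-b ∷ 4∣W-3 ∷ by≢3 ∷ [])
      -- Now x = 8 i, and 256 ∤ x² y makes i odd, so Δ has valuation 10.
      on-hyp (inj₁ 256∤) with by-quotient {h} {2} 2∣h
      ... | i , refl = discriminant-at-2 1 (C4-reduced (# 2 ⊗ (# 2 ⊗ (# 2 ⊗ v₀))) v₁ v₂)
        (v₀ ↑ 2 ⊗ v₁ ↑ 7 ⊗ v₂ ↑ 5) 1024 (i ∷ y ∷ b ∷ [])
        (odd-monomial 2 7 5 (i ∷ y ∷ b ∷ []) (λ k → 256∤ (even-i k)) odd-y odd-b) (identity _) red
        where
        even-i : + 2 ∣ i → + 256 ∣ + 2 * (+ 2 * (+ 2 * i)) * (+ 2 * (+ 2 * (+ 2 * i))) * y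
        even-i (divides j refl) = subst (+ 256 ∣_)
          (solve 2 (λ j y → (# 256 ⊗ (j ⊗ j ⊗ y)) := # 2 ⊗ (# 2 ⊗ (# 2 ⊗ (j ⊗ # 2))) ⊗ (# 2 ⊗ (# 2 ⊗ (# 2 ⊗ (j ⊗ # 2)))) ⊗ y) j y)
          (∣m⇒∣m*n (j * j * y) ∣-refl)

  on-y : ∀ x y → Squarefree y → ¬ + 2 ∣ b → (¬ + 256 ∣ x * x * y) ⊎ (¬ + 4 ∣ b * y - + 3) → Reducible 2 (M₀ x y) →
    (+ 2 ∣ x) ⊎ (+ 2 ∣ y) → Dec (+ 2 ∣ y) → Dec (+ 2 ∣ x) → ⊥
  on-y x y sf odd-b hyp red _ (yes 2∣y) x-even? with by-quotient {y} {2} 2∣y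
  ... | δ , refl = y-even x δ sf odd-b x-even? red
  on-y x y sf odd-b hyp red _ (no odd-y) (yes 2∣x) with by-quotient {x} {2} 2∣x
  ... | g , refl = x-even g y odd-y odd-b hyp (+ 2 ∣? g) red
  on-y x y sf odd-b hyp red (inj₁ h) (no _) (no odd-x) = odd-x h
  on-y x y sf odd-b hyp red (inj₂ h) (no odd-y) (no _) = odd-y h

-- For 16 ∣ x and b y ≡ 3 mod 4 the change of variables with s = 1 divides the reduced model by 2.
C4-halved : ℤ → ℤ → ℤ → ℤ → WModel
C4-halved h y b v = wm (+ 8 * h * y + + 1) (- (v + + 1 + + 4 * h * y)) (- (+ 2 * h * b * y * y)) (h * b * y * y) (+ 0)

C4-halving : ∀ h y b v → b * y ≡ + 4 * v + + 3 →
  Transform (+ 2) (⟦ C4-reduced v₀ v₁ v₂ ⟧ᴹ (+ 16 * h ∷ y ∷ b ∷ [])) (C4-halved h y b v)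
C4-halving h y b v by = transform (+ 0) (+ 1) (+ 0) (λ ())
  (solve 2 (λ h y → # 2 ⊗ (# 8 ⊗ h ⊗ y ⊕ # 1) := # 16 ⊗ h ⊗ y ⊕ # 2 ⊗ # 1) h y)
  (trans (solve 3 (λ h y v → # 2 ⊗ # 2 ⊗ (⊝ (v ⊕ # 1 ⊕ # 4 ⊗ h ⊗ y)) :=
      ⊝ (# 4 ⊗ v ⊕ # 3) ⊖ # 1 ⊗ (# 16 ⊗ h ⊗ y) ⊕ # 3 ⊗ # 0 ⊖ # 1 ⊗ # 1) h y v)
    (cong (λ z → - z - + 1 * (+ 16 * h * y) + + 3 * + 0 - + 1 * + 1) (sym by)))
  (solve 3 (λ h y b → # 2 ⊗ # 2 ⊗ # 2 ⊗ (⊝ (# 2 ⊗ h ⊗ b ⊗ y ⊗ y)) :=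
      ⊝ (# 16 ⊗ h ⊗ b ⊗ y ⊗ y) ⊕ # 0 ⊗ (# 16 ⊗ h ⊗ y) ⊕ # 2 ⊗ # 0) h y b)
  (solve 3 (λ h y b → # 2 ⊗ # 2 ⊗ # 2 ⊗ # 2 ⊗ (h ⊗ b ⊗ y ⊗ y) :=
      # 0 ⊖ # 1 ⊗ (⊝ (# 16 ⊗ h ⊗ b ⊗ y ⊗ y)) ⊕ # 2 ⊗ # 0 ⊗ (⊝ (b ⊗ y)) ⊖ (# 0 ⊕ # 0 ⊗ # 1) ⊗ (# 16 ⊗ h ⊗ y)
      ⊕ # 3 ⊗ # 0 ⊗ # 0 ⊖ # 2 ⊗ # 1 ⊗ # 0) h y b)
  (solve 3 (λ h y b → # 2 ⊗ # 2 ⊗ # 2 ⊗ # 2 ⊗ # 2 ⊗ # 2 ⊗ # 0 :=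
      # 0 ⊕ # 0 ⊗ # 0 ⊕ # 0 ⊗ # 0 ⊗ (⊝ (b ⊗ y)) ⊕ # 0 ⊗ # 0 ⊗ # 0 ⊖ # 0 ⊗ (⊝ (# 16 ⊗ h ⊗ b ⊗ y ⊗ y))
      ⊖ # 0 ⊗ # 0 ⊖ # 0 ⊗ # 0 ⊗ (# 16 ⊗ h ⊗ y)) h y b)

C4-to-halved : ∀ h y b v → b * y ≡ + 4 * v + + 3 → + 2 * (+ 16 * h) ≢ + 0 →
  Transform (+ 2 * (+ 16 * h)) (ET C4 (+ 16 * h * (+ 16 * h) * y , b)) (C4-halved h y b v)
C4-to-halved h y b v by u≢0 = transform (+ 0) (+ 16 * h) (+ 0) u≢0
  (solve 2 (λ h y → let x = # 16 ⊗ h ; u = # 2 ⊗ x in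
    u ⊗ (# 8 ⊗ h ⊗ y ⊕ # 1) := x ⊗ x ⊗ y ⊕ # 2 ⊗ x) h y)
  (trans (solve 3 (λ h y v → let x = # 16 ⊗ h ; u = # 2 ⊗ x in
      u ⊗ u ⊗ (⊝ (v ⊕ # 1 ⊕ # 4 ⊗ h ⊗ y)) := ⊝ (x ⊗ x ⊗ (# 4 ⊗ v ⊕ # 3)) ⊖ x ⊗ (x ⊗ x ⊗ y) ⊖ x ⊗ x) h y v)
    (trans (cong (λ z → - (+ 16 * h * (+ 16 * h) * z) - + 16 * h * (+ 16 * h * (+ 16 * h) * y) - + 16 * h * (+ 16 * h))
        (sym by))
      (solve 3 (λ h y b → let x = # 16 ⊗ h in
        ⊝ (x ⊗ x ⊗ (b ⊗ y)) ⊖ x ⊗ (x ⊗ x ⊗ y) ⊖ x ⊗ x :=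
        ⊝ (x ⊗ x ⊗ y ⊗ b) ⊖ x ⊗ (x ⊗ x ⊗ y) ⊕ # 3 ⊗ # 0 ⊖ x ⊗ x) h y b)))
  (solve 3 (λ h y b → let x = # 16 ⊗ h ; u = # 2 ⊗ x ; a = x ⊗ x ⊗ y in
    u ⊗ u ⊗ u ⊗ (⊝ (# 2 ⊗ h ⊗ b ⊗ y ⊗ y)) := ⊝ (a ⊗ a ⊗ b) ⊕ # 0 ⊗ a ⊕ # 2 ⊗ # 0) h y b)
  (solve 3 (λ h y b → let x = # 16 ⊗ h ; u = # 2 ⊗ x ; a = x ⊗ x ⊗ y in
    u ⊗ u ⊗ u ⊗ u ⊗ (h ⊗ b ⊗ y ⊗ y) :=
      # 0 ⊖ x ⊗ (⊝ (a ⊗ a ⊗ b)) ⊕ # 2 ⊗ # 0 ⊗ (⊝ (a ⊗ b)) ⊖ (# 0 ⊕ # 0 ⊗ x) ⊗ a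
      ⊕ # 3 ⊗ # 0 ⊗ # 0 ⊖ # 2 ⊗ x ⊗ # 0) h y b)
  (solve 3 (λ h y b → let x = # 16 ⊗ h ; u = # 2 ⊗ x ; a = x ⊗ x ⊗ y in
    u ⊗ u ⊗ u ⊗ u ⊗ u ⊗ u ⊗ # 0 :=
      # 0 ⊕ # 0 ⊗ # 0 ⊕ # 0 ⊗ # 0 ⊗ (⊝ (a ⊗ b)) ⊕ # 0 ⊗ # 0 ⊗ # 0 ⊖ # 0 ⊗ (⊝ (a ⊗ a ⊗ b))
      ⊖ # 0 ⊗ # 0 ⊖ # 0 ⊗ # 0 ⊗ a) h y b)

C4-result : ∀ a b → Coprime a b → + 0 ℤ.< a → ∀ u → U C4 (a , b) u → Result (ET C4 (a , b)) u
C4-result (+ n) b cop (+<+ 0<n) u U-a with squareDecomposition n 0<n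
... | c , d , 0<c , sf , eq = cases (U-a c (+ d) 0<c sf (trans (cong +_ eq) (ℤ.pos-* (c ℕ.* c) d)))
  where
  x = + c
  y = + d
  a≡ : + n ≡ x * x * y
  a≡ = trans (cong +_ eq) (trans (ℤ.pos-* (c ℕ.* c) d) (cong (_* y) (ℤ.pos-* c c)))

  x≢0 : x ≢ + 0
  x≢0 h = ℕ.<-irrefl (sym (ℤ.+-injective h)) 0<c

  both : ∀ {p} → Prime p → ¬ (+ p ∣ x * x * y × + p ∣ b)
  both pr (h , k) = coprime⇒∤both {+ n} {b} cop pr (subst (_ ∣_) (sym a≡) h , k)

  E = λ a → ET C4 (a , b)

  even : ∀ v h → b * y ≡ + 4 * v + + 3 → x ≡ + 16 * h → Result (E (+ n)) (2 ℕ.* c)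
  even v h by x≡ = subst (λ a → Result (E a) (2 ℕ.* c)) (sym (trans a≡ (cong (λ x → x * x * y) x≡)))
    (conclude {u = 2 ℕ.* c}
      (subst (λ u → Transform u (E (+ 16 * h * (+ 16 * h) * y)) (C4-halved h y b v))
        (trans (cong (+ 2 *_) (sym x≡)) (sym (ℤ.pos-* 2 c)))
        (C4-to-halved h y b v by u≢0)) irreducible)
    where
    u≢0 : + 2 * (+ 16 * h) ≢ + 0
    u≢0 k = x≢0 (ℤ.*-cancelˡ-≡ (+ 2) x (+ 0) (trans (cong (+ 2 *_) x≡) k))
    irreducible : ∀ p → Prime p → ¬ Reducible p (C4-halved h y b v)
    irreducible p pr red with p ℕ.≟ 2
    ... | yes refl = no-residue 2 (2 ∣ᴱ # 8 ⊗ X ⊗ Y ⊕ # 1 ∷ []) (h ∷ y ∷ [])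
      (2∣c4⇒2∣a1 (C4-halved h y b v) (^∣⇒∣ 2 3 (Reducible.∣c4 red)) ∷ [])
    ... | no p≢2 = C4-additive (+ 16 * h) y b sf
      (λ pr → subst (λ x → ¬ (+ _ ∣ x * x * y × + _ ∣ b)) x≡ (both pr)) pr p≢2
      (reducible⇒additive (C4-halving h y b v by) red)

  odd : (¬ + 256 ∣ x * x * y) ⊎ (¬ + 4 ∣ b * y - + 3) → Result (E (+ n)) c
  odd hyp = subst (λ a → Result (E a) c) (sym a≡) (conclude τ irreducible)
    where
    M = ⟦ C4-reduced v₀ v₁ v₂ ⟧ᴹ (x ∷ y ∷ b ∷ [])
    τ : Transform x (E (x * x * y)) M
    τ = scaling x≢0 (sym (ℤ.*-assoc x x y))
      (solve 3 (λ x y b → x ⊗ x ⊗ ⊝ (b ⊗ y) := ⊝ (x ⊗ x ⊗ y ⊗ b)) x y b)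
      (solve 3 (λ x y b → x ⊗ x ⊗ x ⊗ ⊝ (x ⊗ b ⊗ y ⊗ y) := ⊝ (x ⊗ x ⊗ y ⊗ (x ⊗ x ⊗ y) ⊗ b)) x y b)
      (solve 1 (λ u → u ⊗ u ⊗ u ⊗ u ⊗ # 0 := # 0) x)
      (solve 1 (λ u → u ⊗ u ⊗ u ⊗ u ⊗ u ⊗ u ⊗ # 0 := # 0) x)
    irreducible : ∀ p → Prime p → ¬ Reducible p M
    irreducible p pr red with p ℕ.≟ 2
    ... | yes refl = C4-at-2 x y b sf both hyp red
    ... | no p≢2 = C4-additive x y b sf both pr p≢2 (reducible⇒additive (identity _) red)

  cases : ((∃[ k ] v₂≡ (8 ℕ.+ 2 ℕ.* k) (+ n)) × (b * y ≡ + 3 [mod 4 ]) × u ≡ 2 ℕ.* c)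
    ⊎ ((v₂≤ 7 (+ n) ⊎ ¬ (b * y ≡ + 3 [mod 4 ])) × u ≡ c) → Result (E (+ n)) u
  cases (inj₂ (inj₁ h , refl)) = odd (inj₁ (λ k → h (∣⇒∣ᵤ {+ 256} (subst (+ 256 ∣_) (sym a≡) k))))
  cases (inj₂ (inj₂ h , refl)) = odd (inj₂ (λ k → h (∣⇒∣ᵤ k)))
  cases (inj₁ ((k , 2^∣ , _) , by≡3 , refl)) with ∣ᵤ⇒∣ {+ 4} {b * y - + 3} by≡3
  ... | divides v eqv = even v (proj₁ 16∣x) (trans (difference≡⇒ {b * y} {+ 3} eqv)
      (cong (_+ + 3) (ℤ.*-comm v (+ 4)))) (proj₂ 16∣x)
    where
    -- As b y is odd, y contributes no factor 2: all of 2⁸ lies in x², hence 16 ∣ x.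
    2∤y : ¬ + 2 ∣ y
    2∤y h = no-residue 4 (2 ∣ᴱ Y ∷ 4 ∣ᴱ X ⊗ Y ⊖ # 3 ∷ []) (b ∷ y ∷ []) (h ∷ divides v eqv ∷ [])
    2⁸∣ : (+ 2) ^ 8 ∣ y * x ^ 2
    2⁸∣ = subst ((+ 2) ^ 8 ∣_) (trans a≡ (solve 2 (λ x y → x ⊗ x ⊗ y := y ⊗ x ↑ 2) x y))
      (∣-trans (∣m⇒∣m*n ((+ 2) ^ (2 ℕ.* k)) ∣-refl)
        (subst (_∣ + n) (trans (pos-^ 2 (8 ℕ.+ 2 ℕ.* k)) (ℤ.^-distribˡ-+-* (+ 2) 8 (2 ℕ.* k))) (∣ᵤ⇒∣ 2^∣)))
    16∣x : ∃[ h ] x ≡ + 16 * h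
    16∣x = by-quotient {x} {16} (valuation-root 2-prime 3 2 x
      (lower 2 {7} {8} (cancel-∤ 2-prime 8 (x ^ 2) 2∤y 2⁸∣)))

-- C₂ × C₂

C2×C2ᴹ : ∀ {n} → Expr n → Expr n → Expr n → Model n
C2×C2ᴹ a b d = model (# 0) (a ⊗ d ⊕ b ⊗ d) (# 0) (a ⊗ b ⊗ d ⊗ d) (# 0)

odd-∤-2^ : ∀ {p} → Prime p → p ≢ 2 → ∀ k → ¬ + p ∣ (+ 2) ^ k
odd-∤-2^ pr p≢2 k h = prime-∣-2 pr p≢2 (euclid-^ pr (+ 2) k h)

-- Up to powers of 2, c₄ is Q d² and Δ is R d⁶. A squarefree d supplies too few factors p, so p
-- divides Q and R. But Q is b², a² and a b modulo a, b and a - b, contradicting coprimality.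
C2×C2-additive : ∀ a b d → Coprime a b → Squarefree d → ∀ {p} → Prime p → p ≢ 2 →
  ¬ Additive p (⟦ C2×C2ᴹ v₀ v₁ v₂ ⟧ᴹ (a ∷ b ∷ d ∷ []))
C2×C2-additive a b d cop sf {p} pr p≢2 (mkAdditive h4 _ h12) = on-factor (euclid pr (a ^ 2) (b ^ 2 * (a - b) ^ 2) p∣R)
  where
  ρ : Vec ℤ 3
  ρ = a ∷ b ∷ d ∷ []
  M : Model 3
  M = C2×C2ᴹ v₀ v₁ v₂
  Q R : ℤ
  Q = a * a - a * b + b * b
  R = a ^ 2 * (b ^ 2 * (a - b) ^ 2)
  p⁴∣ : (+ p) ^ 4 ∣ Q * d ^ 2
  p⁴∣ = cancel-∤ pr 4 (Q * d ^ 2) (odd-∤-2^ pr p≢2 4) (subst ((+ p) ^ 4 ∣_) (trans (c4-γ4 M ρ)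
    (prove (γ4 M) (# 16 ⊗ ((v₀ ⊗ v₀ ⊖ v₀ ⊗ v₁ ⊕ v₁ ⊗ v₁) ⊗ v₂ ↑ 2)) ρ)) h4)
  p¹²∣ : (+ p) ^ 12 ∣ R * d ^ 6
  p¹²∣ = cancel-∤ pr 12 (R * d ^ 6) (odd-∤-2^ pr p≢2 4) (subst ((+ p) ^ 12 ∣_) (trans (disc-δ M ρ)
    (prove (δ M) (# 16 ⊗ (v₀ ↑ 2 ⊗ (v₁ ↑ 2 ⊗ (v₀ ⊖ v₁) ↑ 2) ⊗ v₂ ↑ 6)) ρ)) h12)
  p∣Q : + p ∣ Q
  p∣Q with + p ∣? Q
  ... | yes h = h
  ... | no h = ⊥-elim (squarefree-∤ pr d sf (valuation-root pr 1 2 d (lower p {3} {4} (cancel-∤ pr 4 (d ^ 2) h p⁴∣))))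
  p∣R : + p ∣ R
  p∣R with + p ∣? R
  ... | yes h = h
  ... | no h = ⊥-elim (squarefree-∤ pr d sf (valuation-root pr 1 6 d (lower p {7} {12} (cancel-∤ pr 12 (d ^ 6) h p¹²∣))))
  both : ¬ (+ p ∣ a × + p ∣ b)
  both = coprime⇒∤both {a} {b} cop pr
  square : ∀ x → + p ∣ x * x → + p ∣ x
  square x h = [ (λ k → k) , (λ k → k) ]′ (euclid pr x x h)
  from-a : + p ∣ a → ⊥
  from-a h = both (h , square b (∣m+n∣n⇒∣m (subst (+ p ∣_)
    (solve 2 (λ a b → a ⊗ a ⊖ a ⊗ b ⊕ b ⊗ b := b ⊗ b ⊕ a ⊗ (a ⊖ b)) a b) p∣Q) (∣m⇒∣m*n (a - b) h)))
  from-b : + p ∣ b → ⊥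
  from-b h = both (square a (∣m+n∣n⇒∣m (subst (+ p ∣_)
    (solve 2 (λ a b → a ⊗ a ⊖ a ⊗ b ⊕ b ⊗ b := a ⊗ a ⊕ b ⊗ (b ⊖ a)) a b) p∣Q) (∣m⇒∣m*n (b - a) h)) , h)
  from-a-b : + p ∣ a - b → ⊥
  from-a-b h = [ from-a , from-b ]′ (euclid pr a b (∣m+n∣n⇒∣m (subst (+ p ∣_)
    (solve 2 (λ a b → a ⊗ a ⊖ a ⊗ b ⊕ b ⊗ b := a ⊗ b ⊕ (a ⊖ b) ⊗ (a ⊖ b)) a b) p∣Q) (∣m⇒∣m*n (a - b) h)))
  on-factor : (+ p ∣ a ^ 2) ⊎ (+ p ∣ b ^ 2 * (a - b) ^ 2) → ⊥
  on-factor (inj₁ h) = from-a (euclid-^ pr a 2 h)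
  on-factor (inj₂ h) = [ (λ k → from-b (euclid-^ pr b 2 k)) , (λ k → from-a-b (euclid-^ pr (a - b) 2 k)) ]′
    (euclid pr (b ^ 2) ((a - b) ^ 2) h)

-- For even d, c₄ / 16 is 4 modulo 8 and c₆ / 64 is 0 modulo 4, against Kraus. For odd d, Δ is 64 (a
-- / 2)² times an odd number, so 2¹² ∣ Δ gives 16 ∣ a; then c₆ / 64 ≡ -(b d)³ has to be 3 modulo 4,
-- that is b d ≡ 1.
C2×C2-at-2 : ∀ a b d → Coprime a b → + 2 ∣ a → Squarefree d → (¬ + 16 ∣ a) ⊎ (¬ + 4 ∣ b * d - + 1) →
  ¬ Reducible 2 (⟦ C2×C2ᴹ v₀ v₁ v₂ ⟧ᴹ (a ∷ b ∷ d ∷ []))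
C2×C2-at-2 a b d cop 2∣a sf hyp red = on-d a d 2∣a sf hyp red (+ 2 ∣? d)
  where
  odd-b : ¬ + 2 ∣ b
  odd-b = even⇒odd {a} {b} cop 2∣a
  on-d : ∀ a d → + 2 ∣ a → Squarefree d → (¬ + 16 ∣ a) ⊎ (¬ + 4 ∣ b * d - + 1) →
    Reducible 2 (⟦ C2×C2ᴹ v₀ v₁ v₂ ⟧ᴹ (a ∷ b ∷ d ∷ [])) → Dec (+ 2 ∣ d) → ⊥
  on-d a d 2∣a sf hyp red (yes 2∣d) with by-quotient {a} {2} 2∣a | by-quotient {d} {2} 2∣d
  ... | α , refl | δ , refl = no-residue 4 (4 ∣ᴱ # 0 ⊖ # 3 ∷ []) ρ
    (kraus-at-2 1 8 (C2×C2ᴹ (# 2 ⊗ v₀) v₁ (# 2 ⊗ v₂)) (# 4 ⊗ (v₁ ↑ 2 ⊗ v₂ ↑ 2)) (# 0) ρ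
      (λ h → 2∤* (b ^ 2) (δ ^ 2) (λ k → odd-b (euclid-^ 2-prime b 2 k))
        (λ k → squarefree-∤ 2-prime (+ 2 * δ) sf (*-monoʳ-∣ (+ 2) (euclid-^ 2-prime δ 2 k)))
        (*-cancelˡ-∣ (+ 4) {+ 2} {b ^ 2 * δ ^ 2} h)) (identity _) red ∷ [])
    where
    ρ : Vec ℤ 3
    ρ = α ∷ b ∷ δ ∷ []
  on-d a d 2∣a sf hyp red (no odd-d) with by-quotient {a} {2} 2∣a
  ... | α , refl = on-hyp hyp 8∣α
    where
    M : Model 3
    M = C2×C2ᴹ (# 2 ⊗ v₀) v₁ v₂
    ρ : Vec ℤ 3
    ρ = α ∷ b ∷ d ∷ []
    2α-b : ¬ + 2 ∣ + 2 * α - b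
    2α-b h = odd-b (∣-subtrahend (+ 2 * α) b (2∣ 1 α) h)
    rest : ℤ
    rest = d ^ 6 * (b ^ 2 * (+ 2 * α - b) ^ 2)
    odd-rest : ¬ + 2 ∣ rest
    odd-rest = 2∤* (d ^ 6) (b ^ 2 * (+ 2 * α - b) ^ 2) (λ k → odd-d (euclid-^ 2-prime d 6 k))
      (2∤* (b ^ 2) ((+ 2 * α - b) ^ 2) (λ k → odd-b (euclid-^ 2-prime b 2 k))
        (λ k → 2α-b (euclid-^ 2-prime (+ 2 * α - b) 2 k)))
    f : Expr 3
    f = v₂ ↑ 6 ⊗ (v₁ ↑ 2 ⊗ (# 2 ⊗ v₀ ⊖ v₁) ↑ 2) ⊗ v₀ ↑ 2
    64∣ : + 64 ∣ ⟦ f ⟧ ρ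
    64∣ = halves 64 64 (⟦ f ⟧ ρ) (subst (+ 4096 ∣_) (prove (δ M) (# 64 ⊗ f) ρ)
      (reducible-disc 1 M ρ (identity _) red))
    8∣α : + 8 ∣ α
    8∣α = valuation-root 2-prime 2 2 α (lower 2 {5} {6} (cancel-∤ 2-prime 6 (α ^ 2) odd-rest 64∣))
    on-hyp : (¬ + 16 ∣ + 2 * α) ⊎ (¬ + 4 ∣ b * d - + 1) → + 8 ∣ α → ⊥
    on-hyp (inj₁ 16∤) 8∣α = 16∤ (*-monoʳ-∣ (+ 2) 8∣α)
    on-hyp (inj₂ bd≢1) 8∣α with by-quotient {α} {8} 8∣α
    ... | k , refl = no-residue 4 (2 ∤ᴱ v₁ ∷ 2 ∤ᴱ v₂ ∷ 4 ∤ᴱ v₁ ⊗ v₂ ⊖ # 1 ∷ 4 ∣ᴱ ⊝ (v₁ ↑ 3 ⊗ v₂ ↑ 3) ⊖ # 3 ∷ []) ρ′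
      (odd-b ∷ odd-d ∷ bd≢1 ∷ kraus-at-2 1 2 (C2×C2ᴹ (# 2 ⊗ (# 8 ⊗ v₀)) v₁ v₂) (v₁ ↑ 2 ⊗ v₂ ↑ 2) (⊝ (v₁ ↑ 3 ⊗ v₂ ↑ 3)) ρ′
        (2∤* (b ^ 2) (d ^ 2) (λ k → odd-b (euclid-^ 2-prime b 2 k)) (λ k → odd-d (euclid-^ 2-prime d 2 k)))
        (identity _) red ∷ [])
      where
      ρ′ : Vec ℤ 3
      ρ′ = k ∷ b ∷ d ∷ []

C2×C2-result : ∀ a b d → Coprime a b → + 2 ∣ a → Squarefree d → ∀ u → U C2×C2 (a , b , d) u → Result (ET C2×C2 (a , b , d)) u
C2×C2-result a b d cop 2∣a sf u (inj₁ (16∣ , bd≡1 , refl))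
  with by-quotient {a} {16} (∣ᵤ⇒∣ 16∣) | ∣ᵤ⇒∣ {+ 4} {b * d - + 1} bd≡1
... | k , refl | divides v eqv = conclude-odd τ (C2×C2-additive (+ 16 * k) b d cop sf)
  (λ red → no-residue 2 (2 ∣ᴱ # 1 ∷ []) (k ∷ []) (2∣c4⇒2∣a1 M (^∣⇒∣ 2 3 (Reducible.∣c4 red)) ∷ []))
  where
  M : WModel
  -- The shift s = 1 makes a₁ = 1, and a₂ = (a d + b d - 1) / 4 is integral because b d ≡ 1 mod 4.
  M = wm (+ 1) (+ 4 * k * d + v) (+ 0) (k * b * d * d) (+ 0)
  τ : Transform (+ 2) (ET C2×C2 (+ 16 * k , b , d)) M
  τ = transform (+ 0) (+ 1) (+ 0) (λ ()) refl
    (trans (solve 3 (λ k d v → # 2 ⊗ # 2 ⊗ (# 4 ⊗ k ⊗ d ⊕ v) :=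
        # 16 ⊗ k ⊗ d ⊕ (v ⊗ # 4 ⊕ # 1) ⊖ # 1 ⊗ # 0 ⊕ # 3 ⊗ # 0 ⊖ # 1 ⊗ # 1) k d v)
      (cong (λ z → + 16 * k * d + z - + 1 * + 0 + + 3 * + 0 - + 1 * + 1) (sym (difference≡⇒ {b * d} {+ 1} eqv))))
    refl
    (solve 3 (λ k b d → # 2 ⊗ # 2 ⊗ # 2 ⊗ # 2 ⊗ (k ⊗ b ⊗ d ⊗ d) :=
      # 16 ⊗ k ⊗ b ⊗ d ⊗ d ⊖ # 1 ⊗ # 0 ⊕ # 2 ⊗ # 0 ⊗ (# 16 ⊗ k ⊗ d ⊕ b ⊗ d) ⊖ (# 0 ⊕ # 0 ⊗ # 1) ⊗ # 0
      ⊕ # 3 ⊗ # 0 ⊗ # 0 ⊖ # 2 ⊗ # 1 ⊗ # 0) k b d)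
    refl
C2×C2-result a b d cop 2∣a sf u (inj₂ (hyp , refl)) =
  conclude-odd (identity _) (C2×C2-additive a b d cop sf) (C2×C2-at-2 a b d cop 2∣a sf (signed hyp))
  where
  signed : v₂≤ 3 a ⊎ ¬ (b * d ≡ + 1 [mod 4 ]) → (¬ + 16 ∣ a) ⊎ (¬ + 4 ∣ b * d - + 1)
  signed (inj₁ h) = inj₁ (λ k → h (∣⇒∣ᵤ k))
  signed (inj₂ h) = inj₂ (λ k → h (∣⇒∣ᵤ k))

-- C₂

C2ᴹ : ∀ {n} → Expr n → Expr n → Expr n → Model n
C2ᴹ a b d = model (# 0) (# 2 ⊗ a) (# 0) (a ⊗ a ⊖ b ⊗ b ⊗ d) (# 0)

NoCommonSquare : ℤ → ℤ → Set
NoCommonSquare a b = ∀ {p} → Prime p → ¬ ((+ p) ^ 2 ∣ a × (+ p) ^ 2 ∣ b)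

squarefree-gcd : ∀ {a b} → Squarefree (ℤ.gcd a b) → NoCommonSquare a b
squarefree-gcd {a} {b} sf {p} pr (h , k) = squarefree-∤ pr (ℤ.gcd a b) sf
  (∣ᵤ⇒∣ (ℤ.gcd-greatest {a} {b} {(+ p) ^ 2} (∣⇒∣ᵤ h) (∣⇒∣ᵤ k)))

square-∣ : ∀ p x → (+ p) ^ 2 ∣ (+ p * x) ^ 2
square-∣ p x = ∣-^ {+ p} {+ p * x} 2 (∣m⇒∣m*n x ∣-refl)

p²∣p*x : ∀ p x → + p ∣ x → (+ p) ^ 2 ∣ + p * x
p²∣p*x p x h = *-monoʳ-∣ (+ p) (subst (_∣ x) (sym (ℤ.*-identityʳ (+ p))) h)

-- First p ∣ a, and p ∣ b since otherwise p² ∣ d. After removing these factors, p ∣ α β² d and p² ∣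
-- α² + 3 β² d give p ∣ α in every case; then p² ∣ β² d forces p ∣ β, and p² divides both a and b.
C2-not-3 : ∀ {p} → Prime p → p ≢ 3 → ∀ a b d → Squarefree d → NoCommonSquare a b →
  (+ p) ^ 4 ∣ a ^ 2 + + 3 * (b ^ 2 * d) → ¬ (+ p) ^ 4 ∣ a * (b ^ 2 * d)
C2-not-3 {p} pr p≢3 a b d sf ncs h4 k4 = on-a a ncs h4 k4 p∣a
  where
  instance p≢0 = prime⇒nonZero pr
  p∤3 : ¬ + p ∣ + 3
  p∤3 h = p≢3 (prime-∣-prime pr 3-prime h)

  p∣a : + p ∣ a
  p∣a with + p ∣? a
  ... | yes h = h
  ... | no h = euclid-^ pr a 2 (∣m+n∣n⇒∣m (^∣⇒∣ p 3 h4)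
    (∣n⇒∣m*n (+ 3) (^∣⇒∣ p 3 (cancel-∤ pr 4 (b ^ 2 * d) h k4))))

  on-b : ∀ α b → NoCommonSquare (+ p * α) b → (+ p) ^ 4 ∣ (+ p * α) ^ 2 + + 3 * (b ^ 2 * d) →
    (+ p) ^ 4 ∣ + p * α * (b ^ 2 * d) → + p ∣ b → ⊥
  on-b α b ncs h4 k4 p∣b with by-quotient {b} {p} p∣b
  ... | β , refl = [ from-α , [ from-β , from-d ]′ ∘ euclid pr (β ^ 2) d ]′ (euclid pr α (β ^ 2 * d) k1)
    where
    h2 : (+ p) ^ 2 ∣ α ^ 2 + + 3 * (β ^ 2 * d)
    h2 = *-cancelˡ-∣ ((+ p) ^ 2) {{^-nonZero (+ p) 2}} (subst₂ _∣_ (ℤ.^-distribˡ-+-* (+ p) 2 2)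
      (solve 4 (λ p α β d → (p ⊗ α) ↑ 2 ⊕ # 3 ⊗ ((p ⊗ β) ↑ 2 ⊗ d) := p ↑ 2 ⊗ (α ↑ 2 ⊕ # 3 ⊗ (β ↑ 2 ⊗ d))) (+ p) α β d) h4)
    k1 : + p ∣ α * (β ^ 2 * d)
    k1 = ^∣⇒∣ p 0 (*-cancelˡ-∣ ((+ p) ^ 3) {{^-nonZero (+ p) 3}} (subst₂ _∣_ (ℤ.^-distribˡ-+-* (+ p) 3 1)
      (solve 4 (λ p α β d → (p ⊗ α) ⊗ ((p ⊗ β) ↑ 2 ⊗ d) := p ↑ 3 ⊗ (α ⊗ (β ↑ 2 ⊗ d))) (+ p) α β d) k4))
    from-α : + p ∣ α → ⊥
    from-α h = squarefree-∤ pr d sf (cancel-∤ pr 2 d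
      (λ l → ncs pr (p²∣p*x p α h , p²∣p*x p β (euclid-^ pr β 2 l)))
      (cancel-∤ pr 2 (β ^ 2 * d) p∤3 (∣m+n∣m⇒∣n h2 (∣-^ 2 h))))
    from-d : + p ∣ d → ⊥
    from-d h = from-α (euclid-^ pr α 2 (∣m+n∣n⇒∣m (^∣⇒∣ p 1 h2) (∣n⇒∣m*n (+ 3) (∣n⇒∣m*n (β ^ 2) h))))
    from-β : + p ∣ β ^ 2 → ⊥
    from-β h = from-α (euclid-^ pr α 2 (∣m+n∣n⇒∣m (^∣⇒∣ p 1 h2) (∣n⇒∣m*n (+ 3) (∣m⇒∣m*n d h))))

  on-a : ∀ a → NoCommonSquare a b → (+ p) ^ 4 ∣ a ^ 2 + + 3 * (b ^ 2 * d) →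
    (+ p) ^ 4 ∣ a * (b ^ 2 * d) → + p ∣ a → ⊥
  on-a a ncs h4 k4 p∣a with by-quotient {a} {p} p∣a
  ... | α , refl = on-b α b ncs h4 k4 p∣b
    where
    p∣b : + p ∣ b
    p∣b with + p ∣? b
    ... | yes h = h
    ... | no h = ⊥-elim (squarefree-∤ pr d sf (cancel-∤ pr 2 d (λ l → h (euclid-^ pr b 2 l))
      (cancel-∤ pr 2 (b ^ 2 * d) p∤3 (∣m+n∣m⇒∣n (lower p {2} {4} h4) (square-∣ p α)))))

-- Again 3 ∣ a. If 3 ∤ b, the conditions on c₄ and c₆ give 3 ∣ d and collide modulo 3. If 3 ∣ b,
-- they leave 9 ∣ a, 3 ∣ d and 9 ∤ b, and the last expression has valuation exactly 9.
C2-at-3 : ∀ a b d → Squarefree d → NoCommonSquare a b → (+ 3) ^ 4 ∣ a ^ 2 + + 3 * (b ^ 2 * d) →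
  (+ 3) ^ 6 ∣ a * (a ^ 2 - + 9 * (b ^ 2 * d)) → ¬ (+ 3) ^ 12 ∣ b ^ 2 * d * (a ^ 2 - b ^ 2 * d) ^ 2
C2-at-3 a b d sf ncs h4 h6 h12 = on-a a b d sf ncs h4 h6 h12 3∣a (+ 3 ∣? b)
  where
  3∣a : + 3 ∣ a
  3∣a = euclid-^ 3-prime a 2 (∣m+n∣n⇒∣m (^∣⇒∣ 3 3 h4) (∣m⇒∣m*n (b ^ 2 * d) ∣-refl))

  3∣⇒9∣ : ∀ x → + 3 ∣ x → (+ 3) ^ 2 ∣ + 3 * x
  3∣⇒9∣ = p²∣p*x 3

  last : ∀ α b δ → Squarefree (+ 3 * δ) → NoCommonSquare (+ 3 * α) (+ 3 * b) → + 3 ∣ α →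
    (+ 3) ^ 12 ∣ (+ 3 * b) ^ 2 * (+ 3 * δ) * ((+ 3 * α) ^ 2 - (+ 3 * b) ^ 2 * (+ 3 * δ)) ^ 2 → ⊥
  last α b δ sf ncs 3∣α h12 with by-quotient {α} {3} 3∣α
  ... | α′ , refl = no-residue 3
    (3 ∤ᴱ v₁ ∷ 3 ∤ᴱ v₂ ∷ 3 ∣ᴱ v₁ ↑ 2 ⊗ v₂ ⊗ (# 3 ⊗ v₀ ↑ 2 ⊖ v₁ ↑ 2 ⊗ v₂) ↑ 2 ∷ []) ρ
    ((λ h → ncs 3-prime (3∣⇒9∣ (+ 3 * α′) 3∣α , 3∣⇒9∣ b h)) ∷ (λ h → squarefree-∤ 3-prime (+ 3 * δ) sf (3∣⇒9∣ δ h))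
    ∷ 3∣f ∷ [])
    where
    ρ : Vec ℤ 3
    ρ = α′ ∷ b ∷ δ ∷ []
    f g : Expr 3
    f = v₁ ↑ 2 ⊗ v₂ ⊗ (# 3 ⊗ v₀ ↑ 2 ⊖ v₁ ↑ 2 ⊗ v₂) ↑ 2
    g = (# 3 ⊗ v₁) ↑ 2 ⊗ (# 3 ⊗ v₂) ⊗ ((# 3 ⊗ (# 3 ⊗ v₀)) ↑ 2 ⊖ (# 3 ⊗ v₁) ↑ 2 ⊗ (# 3 ⊗ v₂)) ↑ 2
    3∣f : + 3 ∣ ⟦ f ⟧ ρ
    3∣f = halves 19683 3 (⟦ f ⟧ ρ) (subst (+ 59049 ∣_) (prove g (# 19683 ⊗ f) ρ) (lower 3 {10} {12} h12))

  on-d : ∀ α b d → Squarefree d → NoCommonSquare (+ 3 * α) (+ 3 * b) → + 3 ∣ α → + 3 ∣ d →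
    (+ 3) ^ 12 ∣ (+ 3 * b) ^ 2 * d * ((+ 3 * α) ^ 2 - (+ 3 * b) ^ 2 * d) ^ 2 → ⊥
  on-d α b d sf ncs 3∣α 3∣d h12 with by-quotient {d} {3} 3∣d
  ... | δ , refl = last α b δ sf ncs 3∣α h12

  on-b : ∀ α b d → Squarefree d → NoCommonSquare (+ 3 * α) b → (+ 3) ^ 4 ∣ (+ 3 * α) ^ 2 + + 3 * (b ^ 2 * d) →
    (+ 3) ^ 12 ∣ b ^ 2 * d * ((+ 3 * α) ^ 2 - b ^ 2 * d) ^ 2 → + 3 ∣ b → ⊥
  on-b α b d sf ncs h4 h12 3∣b with by-quotient {b} {3} 3∣b
  ... | β , refl = on-d α β d sf ncs 3∣α 3∣d h12
    where
    9∣ : + 9 ∣ α ^ 2 + + 3 * (β ^ 2 * d)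
    9∣ = *-cancelˡ-∣ (+ 9) {+ 9} (subst ((+ 3) ^ 4 ∣_) (solve 3 (λ α β d →
      (# 3 ⊗ α) ↑ 2 ⊕ # 3 ⊗ ((# 3 ⊗ β) ↑ 2 ⊗ d) := # 9 ⊗ (α ↑ 2 ⊕ # 3 ⊗ (β ↑ 2 ⊗ d))) α β d) h4)
    3∣α : + 3 ∣ α
    3∣α = euclid-^ 3-prime α 2 (∣m+n∣n⇒∣m (∣-trans (divides (+ 3) refl) 9∣) (∣m⇒∣m*n (β ^ 2 * d) ∣-refl))
    3∣d : + 3 ∣ d
    3∣d = [ (λ h → ⊥-elim (ncs 3-prime (3∣⇒9∣ α 3∣α , 3∣⇒9∣ β (euclid-^ 3-prime β 2 h)))) , (λ h → h) ]′
      (euclid 3-prime (β ^ 2) d (*-cancelˡ-∣ (+ 3) {+ 3} (∣m+n∣m⇒∣n 9∣ (∣-^ 2 3∣α))))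

  off-b : ∀ α b d → Squarefree d → ¬ + 3 ∣ b → (+ 3) ^ 4 ∣ (+ 3 * α) ^ 2 + + 3 * (b ^ 2 * d) →
    (+ 3) ^ 6 ∣ + 3 * α * ((+ 3 * α) ^ 2 - + 9 * (b ^ 2 * d)) → + 3 ∣ d → ⊥
  off-b α b d sf 3∤b h4 h6 3∣d with by-quotient {d} {3} 3∣d
  ... | δ , refl = no-residue 3
    (3 ∤ᴱ v₁ ∷ 3 ∤ᴱ v₂ ∷ 3 ∣ᴱ v₀ ↑ 2 ⊕ v₁ ↑ 2 ⊗ v₂ ∷ 3 ∣ᴱ v₀ ⊗ (v₀ ↑ 2 ⊖ # 3 ⊗ v₁ ↑ 2 ⊗ v₂) ∷ []) (α ∷ b ∷ δ ∷ [])
    (3∤b ∷ (λ h → squarefree-∤ 3-prime (+ 3 * δ) sf (3∣⇒9∣ δ h)) ∷ 3∣x ∷ 3∣y ∷ [])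
    where
    3∣x : + 3 ∣ α ^ 2 + b ^ 2 * δ
    3∣x = *-cancelˡ-∣ (+ 9) {+ 3} (subst (+ 27 ∣_) (solve 3 (λ α b δ →
      (# 3 ⊗ α) ↑ 2 ⊕ # 3 ⊗ (b ↑ 2 ⊗ (# 3 ⊗ δ)) := # 9 ⊗ (α ↑ 2 ⊕ b ↑ 2 ⊗ δ)) α b δ) (lower 3 {3} {4} h4))
    3∣y : + 3 ∣ α * (α ^ 2 - + 3 * b ^ 2 * δ)
    3∣y = *-cancelˡ-∣ (+ 27) {+ 3} (subst (+ 81 ∣_) (solve 3 (λ α b δ →
      # 3 ⊗ α ⊗ ((# 3 ⊗ α) ↑ 2 ⊖ # 9 ⊗ (b ↑ 2 ⊗ (# 3 ⊗ δ))) := # 27 ⊗ (α ⊗ (α ↑ 2 ⊖ # 3 ⊗ b ↑ 2 ⊗ δ))) α b δ)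
      (lower 3 {4} {6} h6))

  on-a : ∀ a b d → Squarefree d → NoCommonSquare a b → (+ 3) ^ 4 ∣ a ^ 2 + + 3 * (b ^ 2 * d) →
    (+ 3) ^ 6 ∣ a * (a ^ 2 - + 9 * (b ^ 2 * d)) → (+ 3) ^ 12 ∣ b ^ 2 * d * (a ^ 2 - b ^ 2 * d) ^ 2 →
    + 3 ∣ a → Dec (+ 3 ∣ b) → ⊥
  on-a a b d sf ncs h4 h6 h12 3∣a b? with by-quotient {a} {3} 3∣a
  on-a _ b d sf ncs h4 h6 h12 _ (yes 3∣b) | α , refl = on-b α b d sf ncs h4 h12 3∣b
  on-a _ b d sf ncs h4 h6 h12 _ (no 3∤b) | α , refl = off-b α b d sf 3∤b h4 h6 3∣d
    where
    3∣d : + 3 ∣ d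
    3∣d = [ (λ h → ⊥-elim (3∤b (euclid-^ 3-prime b 2 h))) , (λ h → h) ]′ (euclid 3-prime (b ^ 2) d
      (*-cancelˡ-∣ (+ 3) {+ 3} (∣m+n∣m⇒∣n (lower 3 {2} {4} h4) (square-∣ 3 α))))

module _ (a b d : ℤ) where
  private
    ρ : Vec ℤ 3
    ρ = a ∷ b ∷ d ∷ []
    M : Model 3
    M = C2ᴹ v₀ v₁ v₂
    f₄ f₆ f₁₂ : Expr 3
    f₄ = v₀ ↑ 2 ⊕ # 3 ⊗ (v₁ ↑ 2 ⊗ v₂)
    f₆ = v₀ ⊗ (v₀ ↑ 2 ⊖ # 9 ⊗ (v₁ ↑ 2 ⊗ v₂))
    f₁₂ = v₁ ↑ 2 ⊗ v₂ ⊗ (v₀ ↑ 2 ⊖ v₁ ↑ 2 ⊗ v₂) ↑ 2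

  C2-c4 : ⟦ γ4 M ⟧ ρ ≡ + 16 * ⟦ f₄ ⟧ ρ
  C2-c4 = prove (γ4 M) (# 16 ⊗ f₄) ρ

  C2-c6 : ⟦ γ6 M ⟧ ρ ≡ + 64 * ⟦ f₆ ⟧ ρ
  C2-c6 = prove (γ6 M) (# 64 ⊗ f₆) ρ

  C2-disc : ⟦ δ M ⟧ ρ ≡ + 64 * ⟦ f₁₂ ⟧ ρ
  C2-disc = prove (δ M) (# 64 ⊗ f₁₂) ρ

  -- Eliminating a³ by a f₄ - f₆ = 12 a b² d yields the second condition of `C2-not-3` when p does
  -- not divide 12. At p = 3 this loses a factor, so the discriminant is used there as well.
  C2-additive : Squarefree d → NoCommonSquare a b → ∀ {p} → Prime p → p ≢ 2 → ¬ Additive p (⟦ M ⟧ᴹ ρ)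
  C2-additive sf ncs {p} pr p≢2 (mkAdditive h4 h6 h12) = on-p (p ℕ.≟ 3) pr p≢2 p⁴∣ p⁶∣ p¹²∣
    where
    p⁴∣ : (+ p) ^ 4 ∣ ⟦ f₄ ⟧ ρ
    p⁴∣ = cancel-∤ pr 4 (⟦ f₄ ⟧ ρ) (odd-∤-2^ pr p≢2 4) (subst ((+ p) ^ 4 ∣_) (trans (c4-γ4 M ρ) C2-c4) h4)
    p⁶∣ : (+ p) ^ 6 ∣ ⟦ f₆ ⟧ ρ
    p⁶∣ = cancel-∤ pr 6 (⟦ f₆ ⟧ ρ) (odd-∤-2^ pr p≢2 6) (subst ((+ p) ^ 6 ∣_) (trans (c6-γ6 M ρ) C2-c6) h6)
    p¹²∣ : (+ p) ^ 12 ∣ ⟦ f₁₂ ⟧ ρ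
    p¹²∣ = cancel-∤ pr 12 (⟦ f₁₂ ⟧ ρ) (odd-∤-2^ pr p≢2 6) (subst ((+ p) ^ 12 ∣_) (trans (disc-δ M ρ) C2-disc) h12)
    on-p : ∀ {p} → Dec (p ≡ 3) → Prime p → p ≢ 2 → (+ p) ^ 4 ∣ ⟦ f₄ ⟧ ρ → (+ p) ^ 6 ∣ ⟦ f₆ ⟧ ρ → (+ p) ^ 12 ∣ ⟦ f₁₂ ⟧ ρ → ⊥
    on-p (yes refl) pr _ h4 h6 h12 = C2-at-3 a b d sf ncs h4 h6 h12
    on-p {p} (no p≢3) pr p≢2 h4 h6 h12 = C2-not-3 pr p≢3 a b d sf ncs h4
      (cancel-∤ pr 4 (a * (b ^ 2 * d)) p∤12 (subst ((+ p) ^ 4 ∣_)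
        (prove (v₀ ⊗ f₄ ⊖ f₆) (# 12 ⊗ (v₀ ⊗ (v₁ ↑ 2 ⊗ v₂))) ρ)
        (∣m∣n⇒∣m-n (∣n⇒∣m*n a h4) (lower p {4} {6} h6))))
      where
      p∤12 : ¬ + p ∣ + 12
      p∤12 h = [ odd-∤-2^ pr p≢2 2 , (λ k → p≢3 (prime-∣-prime pr 3-prime k)) ]′ (euclid pr (+ 4) (+ 3) h)

-- y² = x³ + 2 α x² - (b² d - a²) x divided by 2, where a = 2 α and b² d - a² = 16 w
C2-halvedᴹ : ∀ {n} → Expr n → Expr n → Model n
C2-halvedᴹ α w = model (# 0) α (# 0) (⊝ w) (# 0)

-- The discriminant is 16 (α² + 4 w) w² with α odd, so divisibility by 2¹² gives 16 ∣ w. Then c₄ /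
-- 16 is odd and c₆ / 64 ≡ -α³ modulo 4, which excludes α ≡ 3.
C2-halved-at-2 : ∀ α w → ¬ + 2 ∣ α → (¬ + 16 ∣ w) ⊎ (+ 4 ∣ α - + 3) →
  ¬ Reducible 2 (⟦ C2-halvedᴹ X Y ⟧ᴹ (α ∷ w ∷ []))
C2-halved-at-2 α w odd-α hyp red = on-hyp w hyp red 16∣w
  where
  ρ : Vec ℤ 2
  ρ = α ∷ w ∷ []
  16∣w : + 16 ∣ w
  16∣w = valuation-root 2-prime 3 2 w (lower 2 {7} {8} (cancel-∤ 2-prime 8 (w ^ 2) odd-f 256∣f))
    where
    f : Expr 2
    f = (X ↑ 2 ⊕ # 4 ⊗ Y) ⊗ Y ↑ 2
    256∣f : + 256 ∣ ⟦ f ⟧ ρ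
    256∣f = halves 16 256 (⟦ f ⟧ ρ) (subst (+ 4096 ∣_) (prove (δ (C2-halvedᴹ X Y)) (# 16 ⊗ f) ρ)
      (reducible-disc 1 (C2-halvedᴹ X Y) ρ (identity _) red))
    odd-f : ¬ + 2 ∣ α ^ 2 + + 4 * w
    odd-f h = odd-α (euclid-^ 2-prime α 2 (∣m+n∣n⇒∣m h (2∣ 2 w)))
  on-hyp : ∀ w → (¬ + 16 ∣ w) ⊎ (+ 4 ∣ α - + 3) → Reducible 2 (⟦ C2-halvedᴹ X Y ⟧ᴹ (α ∷ w ∷ [])) → + 16 ∣ w → ⊥
  on-hyp w (inj₁ 16∤w) red 16∣w = 16∤w 16∣w
  on-hyp w (inj₂ α≡3) red 16∣w with by-quotient {w} {16} 16∣w
  ... | t , refl = no-residue 4 (4 ∣ᴱ X ⊖ # 3 ∷ 4 ∣ᴱ (⊝ (X ↑ 3)) ⊖ # 3 ∷ []) (α ∷ t ∷ [])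
    (α≡3 ∷ kraus-at-2 1 2 (C2-halvedᴹ X (# 16 ⊗ Y)) (X ↑ 2) (⊝ (X ↑ 3)) (α ∷ t ∷ [])
      (2∤^ X 2 (α ∷ t ∷ []) odd-α) (identity _) red ∷ [])

C2-halving : ∀ α b d w → b * b * d - + 2 * α * (+ 2 * α) ≡ + 16 * w →
  Transform (+ 2) (ET C2 (+ 2 * α , b , d)) (⟦ C2-halvedᴹ X Y ⟧ᴹ (α ∷ w ∷ []))
C2-halving α b d w eq = scaling (λ ()) refl
  (solve 1 (λ α → # 2 ⊗ # 2 ⊗ α := # 2 ⊗ (# 2 ⊗ α)) α) refl
  (trans (solve 1 (λ w → # 2 ⊗ # 2 ⊗ # 2 ⊗ # 2 ⊗ ⊝ w := ⊝ (# 16 ⊗ w)) w) (trans (cong -_ (sym eq))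
    (solve 3 (λ α b d → ⊝ (b ⊗ b ⊗ d ⊖ # 2 ⊗ α ⊗ (# 2 ⊗ α)) := # 2 ⊗ α ⊗ (# 2 ⊗ α) ⊖ b ⊗ b ⊗ d) α b d)))
  refl

C2-quartering : ∀ m b d w → b * b * d - (+ 8 * m + + 2) * (+ 8 * m + + 2) ≡ + 256 * w →
  Transform (+ 4) (ET C2 (+ 8 * m + + 2 , b , d)) (wm (+ 1) m (+ 0) (- w) (+ 0))
C2-quartering m b d w eq = transform (+ 0) (+ 2) (+ 0) (λ ()) refl
  (solve 1 (λ m → # 4 ⊗ # 4 ⊗ m := # 2 ⊗ (# 8 ⊗ m ⊕ # 2) ⊖ # 2 ⊗ # 0 ⊕ # 3 ⊗ # 0 ⊖ # 2 ⊗ # 2) m) refl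
  (trans (scale-w w) (trans (cong -_ (sym eq))
    (solve 3 (λ a b d → ⊝ (b ⊗ b ⊗ d ⊖ a ⊗ a) := a ⊗ a ⊖ b ⊗ b ⊗ d ⊖ # 2 ⊗ # 0 ⊕ # 2 ⊗ # 0 ⊗ (# 2 ⊗ a)
      ⊖ (# 0 ⊕ # 0 ⊗ # 2) ⊗ # 0 ⊕ # 3 ⊗ # 0 ⊗ # 0 ⊖ # 2 ⊗ # 2 ⊗ # 0) (+ 8 * m + + 2) b d)))
  (solve 3 (λ a b d → # 4 ⊗ # 4 ⊗ # 4 ⊗ # 4 ⊗ # 4 ⊗ # 4 ⊗ # 0 := # 0 ⊕ # 0 ⊗ (a ⊗ a ⊖ b ⊗ b ⊗ d)
    ⊕ # 0 ⊗ # 0 ⊗ (# 2 ⊗ a) ⊕ # 0 ⊗ # 0 ⊗ # 0 ⊖ # 0 ⊗ # 0 ⊖ # 0 ⊗ # 0 ⊖ # 0 ⊗ # 0 ⊗ # 0) (+ 8 * m + + 2) b d)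
  where
  scale-w : ∀ w → + 4 * + 4 * + 4 * + 4 * - w ≡ - (+ 256 * w)
  scale-w w = sym (ℤ.neg-distribʳ-* (+ 256) w)

-- The cubic is x ((x + a)² - b² d). The shift r = -a completes the square and leaves a₄ = -b² d and
-- a₆ = a b² d, divisible by 16 and 64 as 8 ∣ b; s = 1 then makes a₂ = -(a + 1) / 4.
C2-shifted-halving : ∀ m β d → Transform (+ 2) (ET C2 (+ 4 * m + + 3 , + 8 * β , d))
  (wm (+ 1) (- (m + + 1)) (+ 0) (- (+ 4 * (β * β * d))) (β * β * d * (+ 4 * m + + 3)))
C2-shifted-halving m β d = transform (- (+ 4 * m + + 3)) (+ 1) (+ 0) (λ ()) refl
  (solve 1 (λ m → let a = # 4 ⊗ m ⊕ # 3 in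
    # 2 ⊗ # 2 ⊗ ⊝ (m ⊕ # 1) := # 2 ⊗ a ⊖ # 1 ⊗ # 0 ⊕ # 3 ⊗ ⊝ a ⊖ # 1 ⊗ # 1) m)
  (solve 1 (λ m → let a = # 4 ⊗ m ⊕ # 3 in # 2 ⊗ # 2 ⊗ # 2 ⊗ # 0 := # 0 ⊕ ⊝ a ⊗ # 0 ⊕ # 2 ⊗ # 0) m)
  (solve 3 (λ m β d → let a = # 4 ⊗ m ⊕ # 3 ; b = # 8 ⊗ β in
    # 2 ⊗ # 2 ⊗ # 2 ⊗ # 2 ⊗ ⊝ (# 4 ⊗ (β ⊗ β ⊗ d)) :=
      a ⊗ a ⊖ b ⊗ b ⊗ d ⊖ # 1 ⊗ # 0 ⊕ # 2 ⊗ ⊝ a ⊗ (# 2 ⊗ a) ⊖ (# 0 ⊕ ⊝ a ⊗ # 1) ⊗ # 0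
      ⊕ # 3 ⊗ ⊝ a ⊗ ⊝ a ⊖ # 2 ⊗ # 1 ⊗ # 0) m β d)
  (solve 3 (λ m β d → let a = # 4 ⊗ m ⊕ # 3 ; b = # 8 ⊗ β ; r = ⊝ a in
    # 2 ⊗ # 2 ⊗ # 2 ⊗ # 2 ⊗ # 2 ⊗ # 2 ⊗ (β ⊗ β ⊗ d ⊗ a) :=
      # 0 ⊕ r ⊗ (a ⊗ a ⊖ b ⊗ b ⊗ d) ⊕ r ⊗ r ⊗ (# 2 ⊗ a) ⊕ r ⊗ r ⊗ r ⊖ # 0 ⊗ # 0 ⊖ # 0 ⊗ # 0 ⊖ r ⊗ # 0 ⊗ # 0) m β d)

a1≡1⇒irreducible-at-2 : ∀ {a2 a3 a4 a6} → ¬ Reducible 2 (wm (+ 1) a2 a3 a4 a6)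
a1≡1⇒irreducible-at-2 {a2} {a3} {a4} {a6} red = no-residue 2 (2 ∣ᴱ # 1 ∷ []) (a2 ∷ [])
  (2∣c4⇒2∣a1 (wm (+ 1) a2 a3 a4 a6) (^∣⇒∣ 2 3 (Reducible.∣c4 red)) ∷ [])

module _ (a b d : ℤ) (sf : Squarefree d) (ncs : NoCommonSquare a b) where
  private
    s : ℤ
    s = b ^ 2 * d

  -- y ≡ 3 mod 4 in Kraus's condition leads to case (iii), 16 ∣ x and 8 ∣ y to the other cases.
  C2-kraus : + 64 ∣ s * (a ^ 2 - s) ^ 2 → Kraus (a ^ 2 + + 3 * s) (a * (a ^ 2 - + 9 * s)) →
    (+ 8 ∣ b × + 4 ∣ a - + 3) ⊎ (+ 16 ∣ s - a ^ 2 × (+ 2 ∣ a × ¬ + 4 ∣ a) × (+ 2 ∣ b × ¬ + 4 ∣ b))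
  C2-kraus h64 (inj₁ y≡3) = inj₁ (8∣b , 4∣a-3 8∣b)
    where
    2∣s×odd : (+ 2 ∣ s) × (¬ + 2 ∣ a)
    2∣s×odd = 2∣s , odd-a
      where
      odd-a : ¬ + 2 ∣ a
      odd-a h = no-residue 4 (2 ∣ᴱ X ∷ 4 ∣ᴱ X ⊗ (X ↑ 2 ⊖ # 9 ⊗ Y) ⊖ # 3 ∷ []) (a ∷ s ∷ []) (h ∷ y≡3 ∷ [])
      2∣s : + 2 ∣ s
      2∣s with + 2 ∣? s
      ... | yes h = h
      ... | no h = ⊥-elim (no-residue 4 (2 ∤ᴱ X ∷ 2 ∤ᴱ Y ∷ 4 ∣ᴱ X ⊗ (X ↑ 2 ⊖ # 9 ⊗ Y) ⊖ # 3 ∷ []) (a ∷ s ∷ [])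
        (odd-a ∷ h ∷ y≡3 ∷ []))
    odd-a²-s : ¬ + 2 ∣ (a ^ 2 - s) ^ 2
    odd-a²-s h = proj₂ 2∣s×odd (euclid-^ 2-prime a 2 (subst (+ 2 ∣_)
      (solve 2 (λ v w → (v ⊖ w) ⊕ w := v) (a ^ 2) s)
      (∣m∣n⇒∣m+n (euclid-^ 2-prime (a ^ 2 - s) 2 h) (proj₁ 2∣s×odd))))
    64∣ : (+ 2) ^ 6 ∣ d * b ^ 2
    64∣ = subst ((+ 2) ^ 6 ∣_) (ℤ.*-comm (b ^ 2) d)
      (cancel-∤ 2-prime 6 s odd-a²-s (subst (+ 64 ∣_) (ℤ.*-comm s ((a ^ 2 - s) ^ 2)) h64))
    -- A squarefree d takes at most one factor 2 of the six, and 2⁵ ∣ b² already gives 8 ∣ b.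
    32∣b² : ∀ d → Squarefree d → (+ 2) ^ 6 ∣ d * b ^ 2 → (+ 2) ^ 5 ∣ b ^ 2
    32∣b² d sf h = on-d d sf h (+ 2 ∣? d)
      where
      on-d : ∀ d → Squarefree d → (+ 2) ^ 6 ∣ d * b ^ 2 → Dec (+ 2 ∣ d) → (+ 2) ^ 5 ∣ b ^ 2
      on-d d sf h (no odd-d) = lower 2 {5} {6} (cancel-∤ 2-prime 6 (b ^ 2) odd-d h)
      on-d d sf h (yes 2∣d) with by-quotient {d} {2} 2∣d
      ... | δ , refl = cancel-∤ 2-prime 5 (b ^ 2) (λ k → squarefree-∤ 2-prime (+ 2 * δ) sf (p²∣p*x 2 δ k))
        (*-cancelˡ-∣ (+ 2) {(+ 2) ^ 5} {δ * b ^ 2} (subst ((+ 2) ^ 6 ∣_) (ℤ.*-assoc (+ 2) δ (b ^ 2)) h))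
    8∣b : + 8 ∣ b
    8∣b = valuation-root 2-prime 2 2 b (32∣b² d sf 64∣)
    4∣a-3 : + 8 ∣ b → + 4 ∣ a - + 3
    4∣a-3 h with + 4 ∣? a - + 3
    ... | yes k = k
    ... | no k = ⊥-elim (no-residue 4 (2 ∣ᴱ v₁ ∷ 4 ∤ᴱ v₀ ⊖ # 3 ∷ 4 ∣ᴱ v₀ ⊗ (v₀ ↑ 2 ⊖ # 9 ⊗ (v₁ ↑ 2 ⊗ v₂)) ⊖ # 3 ∷ [])
      (a ∷ b ∷ d ∷ []) (∣-trans (divides (+ 4) refl) h ∷ k ∷ y≡3 ∷ []))
  C2-kraus h64 (inj₂ (16∣x , 8∣y)) = inj₂ (on-a a b ncs 16∣x 2∣a 2∣b)
    where
    2∣a : + 2 ∣ a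
    2∣a with + 2 ∣? a
    ... | yes h = h
    ... | no h = ⊥-elim (no-residue 16 (2 ∤ᴱ X ∷ 16 ∣ᴱ X ↑ 2 ⊕ # 3 ⊗ Y ∷ 8 ∣ᴱ X ⊗ (X ↑ 2 ⊖ # 9 ⊗ Y) ∷ []) (a ∷ s ∷ [])
      (h ∷ 16∣x ∷ 8∣y ∷ []))
    4∣s : + 4 ∣ s
    4∣s with + 4 ∣? s
    ... | yes h = h
    ... | no h = ⊥-elim (no-residue 4 (2 ∣ᴱ X ∷ 4 ∤ᴱ Y ∷ 4 ∣ᴱ X ↑ 2 ⊕ # 3 ⊗ Y ∷ []) (a ∷ s ∷ [])
      (2∣a ∷ h ∷ ∣-trans (divides (+ 4) refl) 16∣x ∷ []))
    2∣b : + 2 ∣ b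
    2∣b with + 2 ∣? b
    ... | yes h = h
    ... | no h = ⊥-elim (squarefree-∤ 2-prime d sf (cancel-∤ 2-prime 2 d (λ k → h (euclid-^ 2-prime b 2 k)) 4∣s))
    on-a : ∀ a b → NoCommonSquare a b → + 16 ∣ a ^ 2 + + 3 * (b ^ 2 * d) → + 2 ∣ a → + 2 ∣ b →
      + 16 ∣ b ^ 2 * d - a ^ 2 × (+ 2 ∣ a × ¬ + 4 ∣ a) × (+ 2 ∣ b × ¬ + 4 ∣ b)
    on-a a b ncs 16∣x 2∣a 2∣b with by-quotient {a} {2} 2∣a | by-quotient {b} {2} 2∣b
    ... | α , refl | β , refl = 16∣s-a² , (2∣a , 4∤a) , (2∣b , 4∤b)
      where
      4∣ : + 4 ∣ α ^ 2 + + 3 * (β ^ 2 * d)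
      4∣ = *-cancelˡ-∣ (+ 4) {+ 4} (subst (+ 16 ∣_) (solve 3 (λ α β d →
        (# 2 ⊗ α) ↑ 2 ⊕ # 3 ⊗ ((# 2 ⊗ β) ↑ 2 ⊗ d) := # 4 ⊗ (α ↑ 2 ⊕ # 3 ⊗ (β ↑ 2 ⊗ d))) α β d) 16∣x)
      16∣s-a² : + 16 ∣ (+ 2 * β) ^ 2 * d - (+ 2 * α) ^ 2
      16∣s-a² = subst (+ 16 ∣_) (solve 3 (λ α β d → # 4 ⊗ (# 4 ⊗ (β ↑ 2 ⊗ d) ⊖ (α ↑ 2 ⊕ # 3 ⊗ (β ↑ 2 ⊗ d)))
          := (# 2 ⊗ β) ↑ 2 ⊗ d ⊖ (# 2 ⊗ α) ↑ 2) α β d)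
        (*-monoʳ-∣ (+ 4) {+ 4} (∣m∣n⇒∣m-n (∣m⇒∣m*n (β ^ 2 * d) ∣-refl) 4∣))
      not-both : ¬ (+ 2 ∣ α × + 2 ∣ β)
      not-both (h , k) = ncs 2-prime (p²∣p*x 2 α h , p²∣p*x 2 β k)
      -- An even α would give 4 ∣ β² d; since α and β are not both even, 4 would divide the
      -- squarefree d.
      odd-α : ¬ + 2 ∣ α
      odd-α h = squarefree-∤ 2-prime d sf (cancel-∤ 2-prime 2 d (λ k → not-both (h , euclid-^ 2-prime β 2 k))
        (cancel-∤ 2-prime 2 (β ^ 2 * d) (λ k → no-residue 2 (2 ∣ᴱ # 3 ∷ []) (d ∷ []) (k ∷ [])) (∣m+n∣m⇒∣n 4∣ (∣-^ 2 h))))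
      4∤a : ¬ + 4 ∣ + 2 * α
      4∤a h = odd-α (*-cancelˡ-∣ (+ 2) {+ 2} {α} h)
      4∤b : ¬ + 4 ∣ + 2 * β
      4∤b h = odd-α (euclid-^ 2-prime α 2 (∣m+n∣n⇒∣m (∣-trans (divides (+ 2) refl) 4∣)
        (∣n⇒∣m*n (+ 3) (∣m⇒∣m*n d (∣m⇒∣m*n (β ^ 1) (*-cancelˡ-∣ (+ 2) {+ 2} {β} h))))))

C2-quartered-result : ∀ a b d → Squarefree d → NoCommonSquare a b → + 256 ∣ b * b * d - a * a → + 8 ∣ a - + 2 →
  Result (ET C2 (a , b , d)) 4
C2-quartered-result a b d sf ncs 256∣ a≡2 with by-quotient {a - + 2} {8} a≡2
... | m , eq = on-a a ncs 256∣ (difference≡⇒ {a} {+ 2} eq)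
  where
  on-a : ∀ a → NoCommonSquare a b → + 256 ∣ b * b * d - a * a → a ≡ + 8 * m + + 2 → Result (ET C2 (a , b , d)) 4
  on-a _ ncs 256∣ refl with by-quotient {b * b * d - (+ 8 * m + + 2) * (+ 8 * m + + 2)} {256} 256∣
  ... | w , eq = conclude-odd (C2-quartering m b d w eq) (C2-additive (+ 8 * m + + 2) b d sf ncs)
    a1≡1⇒irreducible-at-2

C2-halved-result : ∀ a b d → Squarefree d → NoCommonSquare a b → + 2 ∣ a → ¬ + 4 ∣ a → + 16 ∣ b * b * d - a * a →
  (¬ + 256 ∣ b * b * d - a * a) ⊎ (+ 8 ∣ a - + 6) → Result (ET C2 (a , b , d)) 2
C2-halved-result a b d sf ncs 2∣a 4∤a 16∣ hyp with by-quotient {a} {2} 2∣a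
... | α , refl with by-quotient {b * b * d - + 2 * α * (+ 2 * α)} {16} 16∣
...   | w , eq = conclude-odd (C2-halving α b d w eq) (C2-additive (+ 2 * α) b d sf ncs)
  (C2-halved-at-2 α w (λ h → 4∤a (*-monoʳ-∣ (+ 2) h)) (on-hyp hyp))
  where
  on-hyp : (¬ + 256 ∣ b * b * d - + 2 * α * (+ 2 * α)) ⊎ (+ 8 ∣ + 2 * α - + 6) → (¬ + 16 ∣ w) ⊎ (+ 4 ∣ α - + 3)
  on-hyp (inj₁ 256∤) = inj₁ (λ h → 256∤ (subst (+ 256 ∣_) (sym eq) (*-monoʳ-∣ (+ 16) {+ 16} h)))
  on-hyp (inj₂ h) = inj₂ (*-cancelˡ-∣ (+ 2) {+ 4} (subst (+ 8 ∣_)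
    (solve 1 (λ α → # 2 ⊗ α ⊖ # 6 := # 2 ⊗ (α ⊖ # 3)) α) h))

C2-shifted-result : ∀ a b d → Squarefree d → NoCommonSquare a b → + 8 ∣ b → + 4 ∣ a - + 3 → Result (ET C2 (a , b , d)) 2
C2-shifted-result a b d sf ncs 8∣b a≡3 with by-quotient {b} {8} 8∣b | by-quotient {a - + 3} {4} a≡3
... | β , refl | m , eq = on-a a ncs (difference≡⇒ {a} {+ 3} eq)
  where
  on-a : ∀ a → NoCommonSquare a (+ 8 * β) → a ≡ + 4 * m + + 3 → Result (ET C2 (a , + 8 * β , d)) 2
  on-a _ ncs refl = conclude-odd (C2-shifted-halving m β d) (C2-additive (+ 4 * m + + 3) (+ 8 * β) d sf ncs)
    a1≡1⇒irreducible-at-2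

C2-unscaled-result : ∀ a b d → Squarefree d → NoCommonSquare a b →
  ¬ ((+ 8 ∣ b × + 4 ∣ a - + 3) ⊎ (+ 16 ∣ b ^ 2 * d - a ^ 2 × (+ 2 ∣ a × ¬ + 4 ∣ a) × (+ 2 ∣ b × ¬ + 4 ∣ b))) →
  Result (ET C2 (a , b , d)) 1
C2-unscaled-result a b d sf ncs exclude = conclude-odd (identity _) (C2-additive a b d sf ncs) at-2
  where
  ρ : Vec ℤ 3
  ρ = a ∷ b ∷ d ∷ []
  M : Model 3
  M = C2ᴹ v₀ v₁ v₂
  at-2 : ¬ Reducible 2 (⟦ M ⟧ᴹ ρ)
  at-2 red = on-kraus (Reducible.kraus red refl)
    where
    64∣ : + 64 ∣ b ^ 2 * d * (a ^ 2 - b ^ 2 * d) ^ 2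
    64∣ = halves 64 64 _ (subst (+ 4096 ∣_) (C2-disc a b d) (reducible-disc 1 M ρ (identity _) red))
    on-kraus : ∃[ x ] ∃[ y ] (c4 (⟦ M ⟧ᴹ ρ) ≡ + 16 * x × c6 (⟦ M ⟧ᴹ ρ) ≡ + 64 * y × Kraus x y) → ⊥
    on-kraus (x , y , c4≡ , c6≡ , k) = exclude (C2-kraus a b d sf ncs 64∣ (subst₂ Kraus
      (ℤ.*-cancelˡ-≡ (+ 16) x _ (trans (sym c4≡) (trans (c4-γ4 M ρ) (C2-c4 a b d))))
      (ℤ.*-cancelˡ-≡ (+ 64) y _ (trans (sym c6≡) (trans (c6-γ6 M ρ) (C2-c6 a b d)))) k))

C2-result : ∀ a b d → Squarefree d → NoCommonSquare a b → ∀ u → U C2 (a , b , d) u → Result (ET C2 (a , b , d)) u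
C2-result a b d sf ncs u (inj₁ ((256∣ , _ , _ , a≡2) , refl)) =
  C2-quartered-result a b d sf ncs (∣ᵤ⇒∣ 256∣) (∣ᵤ⇒∣ a≡2)
C2-result a b d sf ncs u (inj₂ (inj₁ (inj₁ (256∣ , (2∣a , 4∤a) , _ , a≡6) , refl))) =
  C2-halved-result a b d sf ncs (∣ᵤ⇒∣ 2∣a) (λ h → 4∤a (∣⇒∣ᵤ h))
    (∣-trans (divides (+ 16) refl) (∣ᵤ⇒∣ {+ 256} 256∣)) (inj₂ (∣ᵤ⇒∣ a≡6))
C2-result a b d sf ncs u (inj₂ (inj₁ (inj₂ (inj₁ (16∣ , 256∤ , (2∣a , 4∤a) , _)) , refl))) =
  C2-halved-result a b d sf ncs (∣ᵤ⇒∣ 2∣a) (λ h → 4∤a (∣⇒∣ᵤ h)) (∣ᵤ⇒∣ 16∣) (inj₁ (λ h → 256∤ (∣⇒∣ᵤ h)))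
C2-result a b d sf ncs u (inj₂ (inj₁ (inj₂ (inj₂ (8∣b , a≡3)) , refl))) =
  C2-shifted-result a b d sf ncs (∣ᵤ⇒∣ 8∣b) (∣ᵤ⇒∣ a≡3)
C2-result a b d sf ncs u (inj₂ (inj₂ (¬4 , ¬2 , refl))) = C2-unscaled-result a b d sf ncs exclude
  where
  s≡ : b ^ 2 * d - a ^ 2 ≡ b * b * d - a * a
  s≡ = solve 3 (λ a b d → b ↑ 2 ⊗ d ⊖ a ↑ 2 := b ⊗ b ⊗ d ⊖ a ⊗ a) a b d
  exclude : ¬ ((+ 8 ∣ b × + 4 ∣ a - + 3) ⊎ (+ 16 ∣ b ^ 2 * d - a ^ 2 × (+ 2 ∣ a × ¬ + 4 ∣ a) × (+ 2 ∣ b × ¬ + 4 ∣ b)))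
  exclude (inj₁ (8∣b , a≡3)) = ¬2 (inj₂ (inj₂ (∣⇒∣ᵤ 8∣b , ∣⇒∣ᵤ a≡3)))
  exclude (inj₂ (16∣ , (2∣a , 4∤a) , (2∣b , 4∤b))) =
    split (+ 256 ∣? b * b * d - a * a) (+ 8 ∣? a - + 2) (+ 8 ∣? a - + 6)
    where
    v₂a : v₂≡ 1 a
    v₂a = ∣⇒∣ᵤ 2∣a , (λ h → 4∤a (∣ᵤ⇒∣ h))
    v₂b : v₂≡ 1 b
    v₂b = ∣⇒∣ᵤ 2∣b , (λ h → 4∤b (∣ᵤ⇒∣ h))
    split : Dec (+ 256 ∣ b * b * d - a * a) → Dec (+ 8 ∣ a - + 2) → Dec (+ 8 ∣ a - + 6) → ⊥
    split (no 256∤) _ _ = ¬2 (inj₂ (inj₁ (∣⇒∣ᵤ (subst (+ 16 ∣_) s≡ 16∣) , (λ h → 256∤ (∣ᵤ⇒∣ h)) , v₂a , v₂b)))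
    split (yes 256∣) (yes a≡2) _ = ¬4 (∣⇒∣ᵤ 256∣ , v₂a , v₂b , ∣⇒∣ᵤ a≡2)
    split (yes 256∣) (no _) (yes a≡6) = ¬2 (inj₁ (∣⇒∣ᵤ 256∣ , v₂a , v₂b , ∣⇒∣ᵤ a≡6))
    -- An integer of 2-adic valuation 1 is 2 or 6 modulo 8, so no case is left.
    split (yes _) (no a≢2) (no a≢6) = no-residue 8
      (2 ∣ᴱ var 0F ∷ 4 ∤ᴱ var 0F ∷ 8 ∤ᴱ var 0F ⊖ # 2 ∷ 8 ∤ᴱ var 0F ⊖ # 6 ∷ []) (a ∷ []) (2∣a ∷ 4∤a ∷ a≢2 ∷ a≢6 ∷ [])

theorem4p4 : (T : Tors) (p : Params T) → P T p → (u : ℕ) → U T p u →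
    Σ ℤ (λ D → MinDisc (ET T p) D × D * (+ u) ^ 12 ≡ γ T p)
theorem4p4 T p P-p u U-u = Result.minimal-discriminant (main T p P-p u U-u)
  where
  main : ∀ T p → P T p → ∀ u → U T p u → Result (ET T p) u
  main C2 (a , b , d) (_ , _ , sf , sf-gcd , _) u h = C2-result a b d sf (squarefree-gcd {a} {b} sf-gcd) u h
  main C3⁰ a (_ , cubefree , _) _ refl = C3⁰-result a cubefree
  main C3 (a , b) (cop , 0<a , _) u h = C3-result a b cop 0<a u h
  main C4 (a , b) (cop , 0<a , _) u h = C4-result a b cop 0<a u h
  main C5 (a , b) (cop , _) _ refl = C5-result a b cop
  main C6 (a , b) (cop , _) u h = C6-result a b cop u h
  main C7 (a , b) (cop , _) _ refl = C7-result a b cop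
  main C8 (a , b) (cop , _) u h = C8-result a b cop u h
  main C9 (a , b) (cop , _) _ refl = C9-result a b cop
  main C10 (a , b) (cop , _) u h = C10-result a b cop u h
  main C12 (a , b) (cop , _) u h = C12-result a b cop u h
  main C2×C2 (a , b , d) (cop , 2∣a , _ , sf , _) u h = C2×C2-result a b d cop (∣ᵤ⇒∣ 2∣a) sf u h
  main C2×C4 (a , b) (cop , _) u h = C2×C4-result a b cop u h
  main C2×C6 (a , b) (cop , _) u h = C2×C6-result a b cop u h
  main C2×C8 (a , b) (cop , _) u h = C2×C8-result a b cop u h
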